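{- Let $A$ be a finite abelian group of even order and exponent at least $3$, let $y\in A$ have order $2$, and let $G=\mathrm{Dic}(A,y)=\langle A,x \mid x^2=y,\ xax^{ -1}=a^{ -1}\ (a\in A)\rangle$. Let $S\subseteq G$ with $1\notin S$, $S^{ -1}=S$ and $\langle S\rangle=G$, write $S=S_1\cup xS_2$ with $S_1,S_2\subseteq A$, and assume $S_2^{ -1}=S_2$. Then $\mathrm{Cay}(G,S)$ is distance integral if and only if $\mathrm{Cay}(G,S)$ is integral.
   Context: The Cayley graph $\mathrm{Cay}(G,S)$ has vertex set $G$ and edges $\{g,h\}$ with $g^{ -1}h\in S$. A graph is integral if all eigenvalues of its adjacency matrix are integers; a connected graph is distance integral if all eigenvalues of its distance matrix are integers. -}

module Defs where

open import Data.Nat as ℕ using (ℕ; zero; suc; _≤_; _<_)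
open import Data.Integer as ℤ using (ℤ; +_; -_; _-_)
open import Data.Fin using (Fin; zero; suc; punchIn; splitAt)
open import Data.Fin.Subset using (Subset)
open import Data.Vec using (Vec; lookup)
open import Data.Bool using (Bool; true; false; if_then_else_)
open import Data.Sum using (_⊎_; inj₁; inj₂)
open import Data.Product using (Σ; _×_; _,_)
open import Relation.Binary.PropositionalEquality using (_≡_)
open import Relation.Nullary using (¬_)
open import Relation.Nullary.Decidable using (⌊_⌋)
open import Algebra.Structures using (IsAbelianGroup)
import Data.Fin as Fin

Matrix : ℕ → Set
Matrix m = Fin m → Fin m → ℤ

sumFin : ∀ {m} → (Fin m → ℤ) → ℤ
sumFin {zero}  f = + 0
sumFin {suc m} f = f zero ℤ.+ sumFin (λ i → f (suc i))

prodFin : ∀ {m} → (Fin m → ℤ) → ℤ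
prodFin {zero}  f = + 1
prodFin {suc m} f = f zero ℤ.* prodFin (λ i → f (suc i))

sgn : ℕ → ℤ
sgn zero    = + 1
sgn (suc k) = - sgn k

det : ∀ {m} → Matrix m → ℤ
det {zero}  M = + 1
det {suc m} M =
  sumFin (λ j → sgn (Fin.toℕ j) ℤ.* (M zero j ℤ.* det (λ i k → M (suc i) (punchIn j k))))

charPoly : ∀ {m} → Matrix m → ℤ → ℤ
charPoly M t = det (λ i j → (if ⌊ i Fin.≟ j ⌋ then t else + 0) - M i j)

-- all eigenvalues (roots of the characteristic polynomial, with multiplicity)
-- are integers: the characteristic polynomial splits into integer linear factors
-- (polynomial identity over ℤ, checked pointwise on ℤ, which is equivalent).
IntegralSpectrum : ∀ {m} → Matrix m → Set
IntegralSpectrum {m} M =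
  Σ (Vec ℤ m) λ λs → ∀ t → charPoly M t ≡ prodFin (λ i → t - lookup λs i)

record FinAbGroup (n : ℕ) : Set where
  field
    _∙_ : Fin n → Fin n → Fin n
    ε   : Fin n
    _⁻¹ : Fin n → Fin n
    isAbelianGroup : IsAbelianGroup _≡_ _∙_ ε _⁻¹

module _ {n : ℕ} (A : FinAbGroup n) where
  open FinAbGroup A

  pow : ℕ → Fin n → Fin n
  pow zero    a = ε
  pow (suc k) a = a ∙ pow k a

  IsExponent : ℕ → Set
  IsExponent e = (0 < e) × (∀ a → pow e a ≡ ε)
               × (∀ m → 0 < m → (∀ a → pow m a ≡ ε) → e ≤ m)

  HasOrder2 : Fin n → Set
  HasOrder2 y = ¬ (y ≡ ε) × (y ∙ y ≡ ε)

  -- Dic(A,y) = ⟨A, x | x² = y, x a x⁻¹ = a⁻¹⟩.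
  -- Elements: inj₁ a  ↦  a,   inj₂ a  ↦  a x.
  module Dic (y : Fin n) where
    Elt : Set
    Elt = Fin n ⊎ Fin n

    _·_ : Elt → Elt → Elt
    inj₁ a · inj₁ b = inj₁ (a ∙ b)
    inj₁ a · inj₂ b = inj₂ (a ∙ b)
    inj₂ a · inj₁ b = inj₂ (a ∙ (b ⁻¹))
    inj₂ a · inj₂ b = inj₁ ((a ∙ (b ⁻¹)) ∙ y)

    e : Elt
    e = inj₁ ε

    inv : Elt → Elt
    inv (inj₁ a) = inj₁ (a ⁻¹)
    inv (inj₂ a) = inj₂ (a ∙ y)

    idx : Fin (n ℕ.+ n) → Elt
    idx = splitAt n

    -- S = S₁ ∪ x S₂ given by S₁ S₂ ⊆ A  (x b = b⁻¹ x, so x S₂ = { b⁻¹ x | b ∈ S₂ })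
    module Conn (S₁ S₂ : Subset n) where
      inS : Elt → Bool
      inS (inj₁ a) = lookup S₁ a
      inS (inj₂ a) = lookup S₂ (a ⁻¹)   -- a x = x a⁻¹ ∈ x S₂  iff  a⁻¹ ∈ S₂

      data InGen : Elt → Set where
        gen  : ∀ {g} → inS g ≡ true → InGen g
        unit : InGen e
        mul  : ∀ {g h} → InGen g → InGen h → InGen (g · h)
        inv' : ∀ {g} → InGen g → InGen (inv g)

      adj : Fin (n ℕ.+ n) → Fin (n ℕ.+ n) → Bool
      adj i j = inS (inv (idx i) · idx j)

      Adjacency : Matrix (n ℕ.+ n)
      Adjacency i j = if adj i j then + 1 else + 0

      data Walk : ℕ → Fin (n ℕ.+ n) → Fin (n ℕ.+ n) → Set where
        here : ∀ {i} → Walk 0 i i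
        step : ∀ {k i j l} → adj i j ≡ true → Walk k j l → Walk (suc k) i l

      IsDistanceMatrix : (Fin (n ℕ.+ n) → Fin (n ℕ.+ n) → ℕ) → Set
      IsDistanceMatrix D = ∀ i j → Walk (D i j) i j × (∀ k → Walk k i j → D i j ≤ k)

      DistanceMatrix : (Fin (n ℕ.+ n) → Fin (n ℕ.+ n) → ℕ) → Matrix (n ℕ.+ n)
      DistanceMatrix D i j = + (D i j)

{-# OPTIONS --safe #-}

-- Since S₂ = S₂⁻¹ and S₂ y = S₂, the graph has the same edges as a Cayley graph of the abelian
-- group B = A × C₂, so both matrices have the form f(i⁻¹j) for a symmetric f in ℤ[B].
-- Such a matrix has integral spectrum iff f(bᵖ) = f(b) for all b and all large primes p:
-- * If ∏ (f - a) = 0 over integers a, then, ℤ[B] having no symmetric nilpotents, interpolation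
--   and Fermat give fᵖ ≡ f mod p for large p; Frobenius gives fᵖ ≡ ∑ f(b) bᵖ mod p, and a congruence
--   between bounded coefficients modulo a large p is an equality.
-- * If f is invariant under large prime powers, it is constant on the generators of each cyclic
--   subgroup, hence an integer combination of indicators 1_C of cyclic subgroups C. These commute and
--   satisfy 1_C² = |C| 1_C, so f is killed by some ∏ (x - a), and the characteristic polynomial
--   divides a power of it.
-- The connection set is power invariant iff the distance function is, because b ↦ bᵖ is then a graph
-- automorphism, and S = {d = 1}.
module Submission where

open import Defs using (Matrix; sumFin; prodFin; sgn; det; charPoly; IntegralSpectrum; FinAbGroup; IsExponent; HasOrder2; module Dic)
open import Level using (_⊔_; 0ℓ)
open import Function using (_∘_; id; case_of_)
open import Function.Bundles using (_⇔_; mk⇔)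
open import Data.Empty using (⊥-elim)
open import Data.Bool using (Bool; true; false; if_then_else_)
open import Data.Maybe using (Maybe; just; nothing)
open import Data.Product using (Σ; ∃; _×_; _,_; proj₁; proj₂)
open import Data.Sum using (_⊎_; inj₁; inj₂)
open import Data.Nat as ℕ using (ℕ; zero; suc; _!)
import Data.Nat.Properties as ℕₚ
open import Data.Nat.Combinatorics using (_C_; nCk≡n!/k![n-k]!; nCk≡nC[n∸k]; nCn≡1; k![n∸k]!∣n!)
open import Data.Nat.Coprimality using (Coprime; coprime?; coprime-Bézout; prime⇒coprime)
open import Data.Nat.Divisibility using (_∣_; divides; ∣⇒≤; m∣m*n; ∣m+n∣m⇒∣n; ∣1⇒≡1; ∣n⇒∣m*n; ∣m⇒∣m*n; _∣?_; _∣0)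
open import Data.Nat.DivMod using (_%_; _/_; m/n*n≡m; m≡m%n+[m/n]*n; m%n<n)
open import Data.Nat.GCD using (module Bézout)
open import Data.Nat.ListAction using (product)
open import Data.Nat.Primality using (Prime; euclidsLemma; ¬prime[0]; ¬prime[1]; prime[2]; prime⇒irreducible)
open import Data.Nat.Primality.Factorisation using (factorise; PrimeFactorisation)
open import Data.Integer as ℤ using (ℤ; +_; -[1+_]; ∣_∣)
import Data.Integer.Divisibility.Signed as Signed
import Data.Integer.Properties as ℤₚ
import Data.Integer.Tactic.RingSolver as ℤ-Solver
open import Data.Fin as Fin using (Fin; zero; suc; toℕ; fromℕ; inject₁; punchIn; punchOut; splitAt; join)
import Data.Fin.Properties as Finₚ
open import Data.Fin.Permutation using (permutation)
open import Data.Fin.Subset using (Subset)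
open import Data.List as List using (List; []; _∷_; _++_)
open import Data.List.Membership.DecPropositional ℤ._≟_ using (_∈?_)
open import Data.List.Membership.Propositional using (_∈_; _∉_)
open import Data.List.Membership.Propositional.Properties using (∈-allFin)
open import Data.List.Relation.Unary.All using (All; []; _∷_)
import Data.List.Relation.Unary.All.Properties as Allₚ
open import Data.List.Relation.Unary.Any using (here; there)
open import Data.Vec as Vec using (Vec; []; _∷_; lookup)
open import Data.Vec.Functional using (updateAt)
open import Data.Vec.Functional.Properties using (updateAt-updates; updateAt-minimal)
open import Relation.Binary.Definitions using (tri<; tri≈; tri>)
open import Relation.Binary.PropositionalEquality as ≡ using (_≡_; _≢_)
import Relation.Binary.Reasoning.Setoid as SetoidReasoning
open import Relation.Nullary using (¬_; Dec; yes; no; contradiction)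
open import Relation.Nullary.Decidable using (⌊_⌋; map′)
open import Relation.Unary using (Decidable)
open import Algebra.Bundles using (RawRing; CommutativeRing; AbelianGroup)
import Algebra.Definitions.RawMonoid as RawMonoidDefinitions
import Algebra.Morphism.Construct.Identity as Identity
open import Algebra.Morphism.Structures using (module RingMorphisms)
import Algebra.Properties.AbelianGroup as AbelianGroupProperties
import Algebra.Properties.CommutativeMonoid.Mult as CommutativeMonoidMult
import Algebra.Properties.CommutativeMonoid.Sum as CommutativeMonoidSum
import Algebra.Properties.CommutativeSemiring.Binomial as Binomial
import Algebra.Properties.Group as GroupProperties
import Algebra.Properties.Ring as RingProperties
import Algebra.Properties.Semiring.Exp as SemiringExp
import Algebra.Properties.Semiring.Mult as SemiringMult
import Algebra.Properties.Semiring.Sum as SemiringSum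
import Algebra.Solver.Ring as RingSolver
open import Algebra.Solver.Ring.AlmostCommutativeRing using (fromCommutativeRing; _-Raw-AlmostCommutative⟶_)
import Algebra.Solver.Ring.NaturalCoefficients.Default as SemiringSolver

-- Determinants

-- The argument stays over `ℤ`: no character, root of unity or complex eigenvalue is formed.
-- `Split f`, the vanishing of some product of factors `f - ι a` in the group ring, stands in for a
-- statement about eigenvalues and is the middle term between spectrum and power invariance. It
-- follows from the spectrum by Cayley-Hamilton; the way back needs multiplicative determinants,
-- since the characteristic polynomial must be exhibited as a divisor of a known product. Two
-- obstacles shape the details. Lagrange interpolation divides by differences of roots, so it is
-- carried out up to a nonzero integer `Δ` independent of `p`, which any prime above `∣ Δ ∣`
-- cancels. And invariance is given for large primes only, while generators of a cyclic group differ
-- by arbitrary exponents coprime to the order. Dirichlet's theorem would supply a prime in the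
-- residue class, but a number all of whose prime factors are large is enough, and that is
-- elementary. The relation `S₂ y = S₂` comes from `S⁻¹ = S`, because the inverse of `a x` is
-- `a y x`.

punchIn-adjacent : ∀ {n} (i j : Fin (suc n)) → toℕ j ≡ suc (toℕ i) → ∀ l →
  punchIn i l ≡ punchIn j l ⊎ (punchIn i l ≡ j × punchIn j l ≡ i)
punchIn-adjacent zero    (suc zero) eq zero    = inj₂ (≡.refl , ≡.refl)
punchIn-adjacent zero    (suc zero) eq (suc l) = inj₁ ≡.refl
punchIn-adjacent (suc i) (suc j)    eq zero    = inj₁ ≡.refl
punchIn-adjacent (suc i) (suc j)    eq (suc l)
  with punchIn-adjacent i j (ℕₚ.suc-injective eq) l
... | inj₁ e         = inj₁ (≡.cong suc e)
... | inj₂ (e₁ , e₂) = inj₂ (≡.cong suc e₁ , ≡.cong suc e₂)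

-- Two neighbouring columns stay neighbours when a third one is deleted; this carries the induction
-- of `det-adjacent` to the minors.
punchOut-adjacent : ∀ {n} {k i j : Fin (suc n)} (k≢i : k ≢ i) (k≢j : k ≢ j) →
  toℕ j ≡ suc (toℕ i) → toℕ (punchOut k≢j) ≡ suc (toℕ (punchOut k≢i))
punchOut-adjacent {_}     {zero}        {zero}  {_}        k≢i k≢j eq = contradiction ≡.refl k≢i
punchOut-adjacent {_}     {zero}        {suc i} {suc j}    k≢i k≢j eq = ℕₚ.suc-injective eq
punchOut-adjacent {suc n} {suc zero}    {zero}  {suc zero} k≢i k≢j eq = contradiction ≡.refl k≢j
punchOut-adjacent {suc (suc n)} {suc (suc k)} {zero}  {suc zero} k≢i k≢j eq = ≡.refl
punchOut-adjacent {suc n} {suc k}       {suc i} {suc j}    k≢i k≢j eq =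
  ≡.cong suc (punchOut-adjacent {n} {k} {i} {j} (k≢i ∘ ≡.cong suc) (k≢j ∘ ≡.cong suc) (ℕₚ.suc-injective eq))

module _ {a} {A : Set a} {n : ℕ} (i j : Fin n) where

  set₂ : A → A → (Fin n → A) → Fin n → A
  set₂ x y u l with l Finₚ.≟ i | l Finₚ.≟ j
  ... | yes _ | _     = x
  ... | no _  | yes _ = y
  ... | no _  | no _  = u l

  set₂-first : ∀ x y u → set₂ x y u i ≡ x
  set₂-first x y u with i Finₚ.≟ i | i Finₚ.≟ j
  ... | yes _  | _ = ≡.refl
  ... | no i≢i | _ = contradiction ≡.refl i≢i

  set₂-second : i ≢ j → ∀ x y u → set₂ x y u j ≡ y
  set₂-second i≢j x y u with j Finₚ.≟ i | j Finₚ.≟ j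
  ... | yes j≡i | _      = contradiction (≡.sym j≡i) i≢j
  ... | no _    | yes _  = ≡.refl
  ... | no _    | no j≢j = contradiction ≡.refl j≢j

  set₂-other : ∀ x y u l → l ≢ i → l ≢ j → set₂ x y u l ≡ u l
  set₂-other x y u l l≢i l≢j with l Finₚ.≟ i | l Finₚ.≟ j
  ... | yes l≡i | _       = contradiction l≡i l≢i
  ... | no _    | yes l≡j = contradiction l≡j l≢j
  ... | no _    | no _    = ≡.refl

  swap : (Fin n → A) → Fin n → A
  swap u = set₂ (u j) (u i) u

by-cases₂ : ∀ {n p} (P : Fin n → Set p) (i j : Fin n) → P i → P j →
  (∀ l → l ≢ i → l ≢ j → P l) → ∀ l → P l
by-cases₂ P i j Pi Pj other l with l Finₚ.≟ i | l Finₚ.≟ j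
... | yes ≡.refl | _          = Pi
... | no _       | yes ≡.refl = Pj
... | no l≢i     | no l≢j     = other l l≢i l≢j

nonsurjective⇒collision : ∀ {n} (σ : Fin n → Fin n) (k : Fin n) → (∀ i → σ i ≢ k) →
  ∃ λ i → ∃ λ j → i ≢ j × σ i ≡ σ j
nonsurjective⇒collision {suc n} σ k miss
  with i , j , i<j , e ← Finₚ.pigeonhole (ℕₚ.n<1+n n) (λ i → punchOut (miss i ∘ ≡.sym))
  = i , j , Finₚ.<⇒≢ i<j , Finₚ.punchOut-injective (miss i ∘ ≡.sym) (miss j ∘ ≡.sym) e

-- Only raw operations are assumed, so that determinants can also be taken over coefficient lists.
-- These satisfy the ring laws only after evaluation: `p` plus its negative is a list of zeros, not
-- `[]`.
module RawDeterminant {c ℓ} (R : RawRing c ℓ) where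
  open RawRing R
  open RawMonoidDefinitions +-rawMonoid using (sum)

  sign : ℕ → Carrier
  sign zero    = 1#
  sign (suc k) = - sign k

  determinant : ∀ {n} → (Fin n → Fin n → Carrier) → Carrier
  determinant {zero}  M = 1#
  determinant {suc n} M =
    sum (λ j → sign (toℕ j) * (M zero j * determinant (λ i k → M (suc i) (punchIn j k))))

module Determinant {c ℓ} (R : CommutativeRing c ℓ) where
  open CommutativeRing R hiding (zero)
  open SemiringSum semiring
  open RingProperties ring using (-0#≈0#)
  open SetoidReasoning setoid
  open RawDeterminant rawRing public
  open SemiringSolver commutativeSemiring using (solve; _:=_; _:+_; _:*_)

  sum-linear : ∀ {n} a b (u v : Fin n → Carrier) →
    sum (λ k → a * u k + b * v k) ≈ a * sum u + b * sum v
  sum-linear a b u v = trans (∑-distrib-+ (λ k → a * u k) (λ k → b * v k))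
    (+-cong (sym (*-distribˡ-sum a u)) (sym (*-distribˡ-sum b v)))

  sum-zero : ∀ {n} (t : Fin n → Carrier) → (∀ k → t k ≈ 0#) → sum t ≈ 0#
  sum-zero {n} t t≈0 = trans (sum-cong-≋ t≈0) (sum-replicate-zero n)

  sum-single : ∀ {n} (i : Fin n) (t : Fin n → Carrier) → (∀ k → k ≢ i → t k ≈ 0#) → sum t ≈ t i
  sum-single {suc n} i t t≈0 = begin
    sum t                        ≈⟨ sum-remove {i = i} t ⟩
    t i + sum (t ∘ punchIn i)    ≈⟨ +-congˡ (sum-zero _ λ k → t≈0 _ (Finₚ.punchInᵢ≢i i k)) ⟩
    t i + 0#                     ≈⟨ +-identityʳ _ ⟩
    t i                          ∎

  sum-pair : ∀ {n} {i j : Fin n} (t : Fin n → Carrier) → i ≢ j →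
    (∀ k → k ≢ i → k ≢ j → t k ≈ 0#) → sum t ≈ t i + t j
  sum-pair {suc n} {i} {j} t i≢j t≈0 = begin
    sum t                              ≈⟨ sum-remove {i = i} t ⟩
    t i + sum (t ∘ punchIn i)          ≈⟨ +-congˡ (sum-single (punchOut i≢j) _ off) ⟩
    t i + t (punchIn i (punchOut i≢j)) ≡⟨ ≡.cong (λ k → t i + t k) (Finₚ.punchIn-punchOut i≢j) ⟩
    t i + t j                          ∎
    where
    off : ∀ k → k ≢ punchOut i≢j → t (punchIn i k) ≈ 0#
    off k k≢ = t≈0 _ (Finₚ.punchInᵢ≢i i k)
      (λ e → k≢ (Finₚ.punchIn-injective i k _ (≡.trans e (≡.sym (Finₚ.punchIn-punchOut i≢j)))))

  determinant-cong : ∀ {n} {M N : Fin n → Fin n → Carrier} →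
    (∀ i j → M i j ≈ N i j) → determinant M ≈ determinant N
  determinant-cong {zero}  M≈N = refl
  determinant-cong {suc n} M≈N = sum-cong-≋ λ j →
    *-congˡ {sign (toℕ j)} (*-cong (M≈N zero j) (determinant-cong λ i k → M≈N (suc i) (punchIn j k)))

  Columns : ℕ → ℕ → Set c
  Columns n r = Fin n → Fin r → Carrier

  -- Vanishing is demanded only for adjacent equal columns, the case that Laplace expansion along
  -- the first row yields directly; `Alternating.vanishes` extends it to any two columns.
  record IsAlternating {n r} (F : Columns n r → Carrier) : Set (c ⊔ ℓ) where
    field
      cong      : ∀ {u v} → (∀ j i → u j i ≈ v j i) → F u ≈ F v
      linear    : ∀ j a b (u u₁ u₂ : Columns n r) →
                  (∀ l → l ≢ j → ∀ i → u l i ≈ u₁ l i) →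
                  (∀ l → l ≢ j → ∀ i → u l i ≈ u₂ l i) →
                  (∀ i → u j i ≈ a * u₁ j i + b * u₂ j i) →
                  F u ≈ a * F u₁ + b * F u₂
      adjacent  : ∀ i j → toℕ j ≡ suc (toℕ i) → ∀ u → (∀ k → u i k ≈ u j k) → F u ≈ 0#

  detᶜ : ∀ {n} → Columns n n → Carrier
  detᶜ u = determinant (λ i j → u j i)

  private
    term-linear₁ : ∀ s a b x₁ x₂ d → s * ((a * x₁ + b * x₂) * d) ≈ a * (s * (x₁ * d)) + b * (s * (x₂ * d))
    term-linear₁ = solve 6 (λ s a b x₁ x₂ d →
      s :* ((a :* x₁ :+ b :* x₂) :* d) := a :* (s :* (x₁ :* d)) :+ b :* (s :* (x₂ :* d))) refl

    term-linear₂ : ∀ s a b x d₁ d₂ → s * (x * (a * d₁ + b * d₂)) ≈ a * (s * (x * d₁)) + b * (s * (x * d₂))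
    term-linear₂ = solve 6 (λ s a b x d₁ d₂ →
      s :* (x :* (a :* d₁ :+ b :* d₂)) := a :* (s :* (x :* d₁)) :+ b :* (s :* (x :* d₂))) refl

    cancel : ∀ s x → s * x + (- s) * x ≈ 0#
    cancel s x = trans (sym (distribʳ x s (- s))) (trans (*-congʳ (-‿inverseʳ s)) (zeroˡ x))

  det-linear : ∀ {n} j a b (u u₁ u₂ : Columns n n) →
    (∀ l → l ≢ j → ∀ i → u l i ≈ u₁ l i) →
    (∀ l → l ≢ j → ∀ i → u l i ≈ u₂ l i) →
    (∀ i → u j i ≈ a * u₁ j i + b * u₂ j i) →
    detᶜ u ≈ a * detᶜ u₁ + b * detᶜ u₂
  det-linear {suc n} j a b u u₁ u₂ off₁ off₂ on =
    trans (sum-cong-≋ term) (sum-linear a b (T u₁) (T u₂))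
    where
    minor : Columns (suc n) (suc n) → Fin (suc n) → Columns n n
    minor w k l i = w (punchIn k l) (suc i)

    T : Columns (suc n) (suc n) → Fin (suc n) → Carrier
    T w k = sign (toℕ k) * (w k zero * detᶜ (minor w k))

    term : ∀ k → T u k ≈ a * T u₁ k + b * T u₂ k
    term k with k Finₚ.≟ j
    ... | yes ≡.refl = begin
      s * (u k zero * detᶜ (minor u k))
        ≈⟨ *-congˡ (*-congʳ (on zero)) ⟩
      s * ((a * u₁ k zero + b * u₂ k zero) * detᶜ (minor u k))
        ≈⟨ term-linear₁ _ _ _ _ _ _ ⟩
      a * (s * (u₁ k zero * detᶜ (minor u k))) + b * (s * (u₂ k zero * detᶜ (minor u k)))
        ≈⟨ +-cong
             (*-congˡ (*-congˡ (*-congˡ (determinant-cong λ i l → off₁ (punchIn k l) (Finₚ.punchInᵢ≢i k l) (suc i)))))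
             (*-congˡ (*-congˡ (*-congˡ (determinant-cong λ i l → off₂ (punchIn k l) (Finₚ.punchInᵢ≢i k l) (suc i))))) ⟩
      a * T u₁ k + b * T u₂ k ∎
      where s = sign (toℕ k)
    ... | no k≢j = begin
      s * (u k zero * detᶜ (minor u k))
        ≈⟨ *-congˡ (*-congˡ (det-linear j′ a b (minor u k) (minor u₁ k) (minor u₂ k)
             (λ l l≢ i → off₁ _ (avoid l l≢) (suc i)) (λ l l≢ i → off₂ _ (avoid l l≢) (suc i)) on′)) ⟩
      s * (u k zero * (a * detᶜ (minor u₁ k) + b * detᶜ (minor u₂ k)))
        ≈⟨ term-linear₂ _ _ _ _ _ _ ⟩
      a * (s * (u k zero * detᶜ (minor u₁ k))) + b * (s * (u k zero * detᶜ (minor u₂ k)))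
        ≈⟨ +-cong (*-congˡ (*-congˡ (*-congʳ (off₁ k k≢j zero)))) (*-congˡ (*-congˡ (*-congʳ (off₂ k k≢j zero)))) ⟩
      a * T u₁ k + b * T u₂ k ∎
      where
      s = sign (toℕ k)
      j′ = punchOut k≢j

      avoid : ∀ l → l ≢ j′ → punchIn k l ≢ j
      avoid l l≢ e = l≢ (Finₚ.punchIn-injective k l _ (≡.trans e (≡.sym (Finₚ.punchIn-punchOut k≢j))))

      on′ : ∀ i → minor u k j′ i ≈ a * minor u₁ k j′ i + b * minor u₂ k j′ i
      on′ i = ≡.subst (λ q → u q (suc i) ≈ a * u₁ q (suc i) + b * u₂ q (suc i))
        (≡.sym (Finₚ.punchIn-punchOut k≢j)) (on (suc i))

  -- In the expansion along the first row, every term away from `i` and `j` has a minor with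
  -- adjacent equal columns and vanishes by induction. The two remaining terms have equal minors and
  -- opposite signs.
  det-adjacent : ∀ {n} (i j : Fin n) → toℕ j ≡ suc (toℕ i) → (u : Columns n n) →
    (∀ k → u i k ≈ u j k) → detᶜ u ≈ 0#
  det-adjacent {suc n} i j j≡1+i u ui≈uj = begin
    sum T           ≈⟨ sum-pair T i≢j vanish ⟩
    T i + T j       ≈⟨ +-congˡ (*-cong (reflexive (≡.cong sign j≡1+i)) (*-cong (sym (ui≈uj zero)) (determinant-cong λ r l → sym (minors l (suc r))))) ⟩
    sign (toℕ i) * _ + (- sign (toℕ i)) * _ ≈⟨ cancel _ _ ⟩
    0# ∎
    where
    minor : Fin (suc n) → Columns n n
    minor k l r = u (punchIn k l) (suc r)

    T : Fin (suc n) → Carrier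
    T k = sign (toℕ k) * (u k zero * detᶜ (minor k))

    i≢j : i ≢ j
    i≢j ≡.refl = ℕₚ.1+n≢n (≡.sym j≡1+i)

    minors : ∀ l r → u (punchIn i l) r ≈ u (punchIn j l) r
    minors l r with punchIn-adjacent i j j≡1+i l
    ... | inj₁ e         = reflexive (≡.cong (λ q → u q r) e)
    ... | inj₂ (e₁ , e₂) = trans (reflexive (≡.cong (λ q → u q r) e₁))
                             (trans (sym (ui≈uj r)) (reflexive (≡.cong (λ q → u q r) (≡.sym e₂))))

    vanish : ∀ k → k ≢ i → k ≢ j → T k ≈ 0#
    vanish k k≢i k≢j = begin
      sign (toℕ k) * (u k zero * detᶜ (minor k)) ≈⟨ *-congˡ (*-congˡ (det-adjacent _ _ (punchOut-adjacent k≢i k≢j j≡1+i) (minor k) cols)) ⟩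
      sign (toℕ k) * (u k zero * 0#)            ≈⟨ *-congˡ (zeroʳ _) ⟩
      sign (toℕ k) * 0#                         ≈⟨ zeroʳ _ ⟩
      0#                                        ∎
      where
      cols : ∀ r → minor k (punchOut k≢i) r ≈ minor k (punchOut k≢j) r
      cols r = begin
        u (punchIn k (punchOut k≢i)) (suc r) ≡⟨ ≡.cong (λ q → u q (suc r)) (Finₚ.punchIn-punchOut k≢i) ⟩
        u i (suc r)                          ≈⟨ ui≈uj (suc r) ⟩
        u j (suc r)                          ≡⟨ ≡.cong (λ q → u q (suc r)) (Finₚ.punchIn-punchOut k≢j) ⟨
        u (punchIn k (punchOut k≢j)) (suc r) ∎

  det-isAlternating : ∀ {n} → IsAlternating (detᶜ {n})
  det-isAlternating = record
    { cong = λ u≈v → determinant-cong (λ i j → u≈v j i)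
    ; linear = det-linear
    ; adjacent = det-adjacent
    }

  e : ∀ {n} → Columns n n
  e j i with i Finₚ.≟ j
  ... | yes _ = 1#
  ... | no _  = 0#

  e-diagonal : ∀ {n} (j : Fin n) → e j j ≈ 1#
  e-diagonal j with j Finₚ.≟ j
  ... | yes _  = refl
  ... | no j≢j = contradiction ≡.refl j≢j

  e-off-diagonal : ∀ {n} {i j : Fin n} → i ≢ j → e j i ≈ 0#
  e-off-diagonal {_} {i} {j} i≢j with i Finₚ.≟ j
  ... | yes i≡j = contradiction i≡j i≢j
  ... | no _    = refl

  -- Alternating forms and the product rule for determinants

  module Alternating {n r} {F : Columns n r → Carrier} (isAlternating : IsAlternating F) where
    open IsAlternating isAlternating

    additive : ∀ j (u u₁ u₂ : Columns n r) →
      (∀ l → l ≢ j → ∀ i → u l i ≈ u₁ l i) →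
      (∀ l → l ≢ j → ∀ i → u l i ≈ u₂ l i) →
      (∀ i → u j i ≈ u₁ j i + u₂ j i) → F u ≈ F u₁ + F u₂
    additive j u u₁ u₂ off₁ off₂ on = trans
      (linear j 1# 1# u u₁ u₂ off₁ off₂
        (λ i → trans (on i) (+-cong (sym (*-identityˡ _)) (sym (*-identityˡ _)))))
      (+-cong (*-identityˡ _) (*-identityˡ _))

    VanishesOn : Fin n → Fin n → Set (c ⊔ ℓ)
    VanishesOn i j = ∀ u → (∀ k → u i k ≈ u j k) → F u ≈ 0#

    -- Polarisation: with `u i + u j` in both places the form is zero, and so are two of the four
    -- terms of its expansion.
    swap-negates : ∀ {i j} → i ≢ j → VanishesOn i j → ∀ u → F u ≈ - F (swap i j u)
    swap-negates {i} {j} i≢j vanishes u = begin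
      F u                                    ≈⟨ cong (by-cases₂ (λ l → ∀ k → u l k ≈ set₂ i j (u i) (u j) u l k) i j
                                                   (at (≡.sym (set₂-first i j _ _ u)))
                                                   (at (≡.sym (set₂-second i j i≢j _ _ u)))
                                                   (λ l l≢i l≢j → at (≡.sym (set₂-other i j _ _ u l l≢i l≢j)))) ⟩
      G (u i) (u j)                          ≈⟨ move _ _ _ _ expand (diagonal _) (diagonal _) (diagonal _) ⟩
      - F (swap i j u)                       ∎
      where
      at : ∀ {x y : Fin r → Carrier} → x ≡ y → ∀ k → x k ≈ y k
      at ≡.refl k = refl

      G : (Fin r → Carrier) → (Fin r → Carrier) → Carrier
      G x y = F (set₂ i j x y u)

      _⊕_ : (Fin r → Carrier) → (Fin r → Carrier) → Fin r → Carrier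
      (x ⊕ y) k = x k + y k

      diagonal : ∀ x → G x x ≈ 0#
      diagonal x = vanishes _ λ k →
        trans (at (set₂-first i j x x u) k) (sym (at (set₂-second i j i≢j x x u) k))

      unaffectedˡ : ∀ x x′ y l → l ≢ i → ∀ k → set₂ i j x y u l k ≈ set₂ i j x′ y u l k
      unaffectedˡ x x′ y l l≢i k with l Finₚ.≟ i | l Finₚ.≟ j
      ... | yes l≡i | _     = contradiction l≡i l≢i
      ... | no _    | yes _ = refl
      ... | no _    | no _  = refl

      unaffectedʳ : ∀ x y y′ l → l ≢ j → ∀ k → set₂ i j x y u l k ≈ set₂ i j x y′ u l k
      unaffectedʳ x y y′ l l≢j k with l Finₚ.≟ i | l Finₚ.≟ j
      ... | yes _ | _       = refl
      ... | no _  | yes l≡j = contradiction l≡j l≢j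
      ... | no _  | no _    = refl

      addˡ : ∀ x x′ y → G (x ⊕ x′) y ≈ G x y + G x′ y
      addˡ x x′ y = additive i _ _ _ (unaffectedˡ _ _ y) (unaffectedˡ _ _ y) λ k →
        trans (at (set₂-first i j _ y u) k)
          (sym (+-cong (at (set₂-first i j x y u) k) (at (set₂-first i j x′ y u) k)))

      addʳ : ∀ x y y′ → G x (y ⊕ y′) ≈ G x y + G x y′
      addʳ x y y′ = additive j _ _ _ (unaffectedʳ x _ _) (unaffectedʳ x _ _) λ k →
        trans (at (set₂-second i j i≢j x _ u) k)
          (sym (+-cong (at (set₂-second i j i≢j x y u) k) (at (set₂-second i j i≢j x y′ u) k)))

      expand : G (u i ⊕ u j) (u i ⊕ u j) ≈ (G (u i) (u i) + G (u i) (u j)) + (G (u j) (u i) + G (u j) (u j))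
      expand = trans (addˡ _ _ _) (+-cong (addʳ _ _ _) (addʳ _ _ _))

      regroup : ∀ a b → a ≈ (0# + a) + (b + 0#) + - b
      regroup a b = begin
        a                          ≈⟨ +-identityʳ a ⟨
        a + 0#                     ≈⟨ +-congˡ (-‿inverseʳ b) ⟨
        a + (b + - b)              ≈⟨ +-assoc a b (- b) ⟨
        a + b + - b                ≈⟨ +-congʳ (+-cong (sym (+-identityˡ a)) (sym (+-identityʳ b))) ⟩
        (0# + a) + (b + 0#) + - b  ∎

      move : ∀ {s} p a b q → s ≈ (p + a) + (b + q) → s ≈ 0# → p ≈ 0# → q ≈ 0# → a ≈ - b
      move {s} p a b q e s≈0 p≈0 q≈0 = begin
        a                          ≈⟨ regroup a b ⟩
        (0# + a) + (b + 0#) + - b  ≈⟨ +-congʳ (+-cong (+-congʳ (sym p≈0)) (+-congˡ (sym q≈0))) ⟩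
        (p + a) + (b + q) + - b    ≈⟨ +-congʳ (trans (sym e) s≈0) ⟩
        0# + - b                   ≈⟨ +-identityˡ _ ⟩
        - b                        ∎

    private
      negate-zero : ∀ {x} → x ≈ 0# → - x ≈ 0#
      negate-zero x≈0 = trans (-‿cong x≈0) -0#≈0#

      -- Swapping the right-hand column with its left neighbour only changes the sign and brings the
      -- equal columns one step closer.
      vanishesAtGap : ∀ d i j → toℕ j ≡ suc d ℕ.+ toℕ i → VanishesOn i j
      vanishesAtGap zero    i j gap = adjacent i j gap
      vanishesAtGap (suc d) i (suc j) gap u ui≈uj = trans
        (swap-negates j′≢j (adjacent j′ (suc j) (≡.cong suc (≡.sym (Finₚ.toℕ-inject₁ j)))) u)
        (negate-zero (vanishesAtGap d i j′ (≡.trans (Finₚ.toℕ-inject₁ j) (ℕₚ.suc-injective gap)) (swap j′ (suc j) u) cols))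
        where
        j′ = Fin.inject₁ j

        j′≢j : j′ ≢ suc j
        j′≢j e′ = ℕₚ.1+n≢n (≡.trans (≡.sym (≡.cong toℕ e′)) (Finₚ.toℕ-inject₁ j))

        i<j : toℕ i ℕ.< toℕ j
        i<j = ≡.subst (toℕ i ℕ.<_) (≡.sym (ℕₚ.suc-injective gap)) (ℕ.s≤s (ℕₚ.m≤n+m (toℕ i) d))

        cols : ∀ k → swap j′ (suc j) u i k ≈ swap j′ (suc j) u j′ k
        cols k = begin
          swap j′ (suc j) u i k  ≡⟨ ≡.cong (λ w → w k) (set₂-other j′ (suc j) _ _ u i
                                     (λ e′ → ℕₚ.<⇒≢ i<j (≡.trans (≡.cong toℕ e′) (Finₚ.toℕ-inject₁ j)))
                                     (λ e′ → ℕₚ.<⇒≢ (ℕₚ.m<n⇒m<1+n i<j) (≡.cong toℕ e′))) ⟩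
          u i k                  ≈⟨ ui≈uj k ⟩
          u (suc j) k            ≡⟨ ≡.cong (λ w → w k) (set₂-first j′ (suc j) _ _ u) ⟨
          swap j′ (suc j) u j′ k ∎

      vanishes< : ∀ {i j} → toℕ i ℕ.< toℕ j → VanishesOn i j
      vanishes< {i} {j} i<j = vanishesAtGap (toℕ j ℕ.∸ suc (toℕ i)) i j
        (≡.sym (≡.trans (≡.sym (ℕₚ.+-suc _ (toℕ i))) (ℕₚ.m∸n+n≡m i<j)))

    vanishes : ∀ {i j} → i ≢ j → VanishesOn i j
    vanishes {i} {j} i≢j with ℕₚ.<-cmp (toℕ i) (toℕ j)
    ... | tri< i<j _ _ = vanishes< i<j
    ... | tri≈ _ i≡j _ = contradiction (Finₚ.toℕ-injective i≡j) i≢j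
    ... | tri> _ _ j<i = λ u ui≈uj → vanishes< j<i u (λ k → sym (ui≈uj k))

    _[_]≔_ : Columns n r → Fin n → (Fin r → Carrier) → Columns n r
    u [ j ]≔ x = updateAt u j (λ _ → x)

    update-on : ∀ u j x i → (u [ j ]≔ x) j i ≈ x i
    update-on u j x i = reflexive (≡.cong (λ w → w i) (updateAt-updates j u))

    update-off : ∀ u j x l → l ≢ j → ∀ i → (u [ j ]≔ x) l i ≈ u l i
    update-off u j x l l≢j i = reflexive (≡.cong (λ w → w i) (updateAt-minimal l j u l≢j))

    update-self : ∀ u j x → (∀ i → u j i ≈ x i) → F (u [ j ]≔ x) ≈ F u
    update-self u j x uj≈x = cong λ l i → case l Finₚ.≟ j of λ
      { (yes ≡.refl) → trans (update-on u l x i) (sym (uj≈x i))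
      ; (no l≢j)     → update-off u j x l l≢j i }

    zero-column : ∀ u j → (∀ i → u j i ≈ 0#) → F u ≈ 0#
    zero-column u j uj≈0 = trans
      (linear j 0# 0# u u u (λ _ _ _ → refl) (λ _ _ _ → refl) (λ i → trans (uj≈0 i) (sym (0*+0* _ _))))
      (0*+0* _ _)
      where
      0*+0* : ∀ x y → 0# * x + 0# * y ≈ 0#
      0*+0* x y = trans (+-cong (zeroˡ x) (zeroˡ y)) (+-identityˡ 0#)

    linear-sum : ∀ {k} u j (a : Fin k → Carrier) (w : Fin k → Fin r → Carrier) →
      F (u [ j ]≔ (λ i → sum (λ q → a q * w q i))) ≈ sum (λ q → a q * F (u [ j ]≔ w q))
    linear-sum {zero}  u j a w = zero-column _ j (update-on u j _)
    linear-sum {suc k} u j a w = begin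
      F (u [ j ]≔ _)
        ≈⟨ linear j (a zero) 1# _ (u [ j ]≔ w zero) (u [ j ]≔ rest)
             (λ l l≢j i → trans (update-off u j _ l l≢j i) (sym (update-off u j _ l l≢j i)))
             (λ l l≢j i → trans (update-off u j _ l l≢j i) (sym (update-off u j _ l l≢j i)))
             (λ i → trans (update-on u j _ i)
               (+-cong (*-congˡ (sym (update-on u j _ i))) (sym (trans (*-identityˡ _) (update-on u j _ i))))) ⟩
      a zero * F (u [ j ]≔ w zero) + 1# * F (u [ j ]≔ rest)
        ≈⟨ +-congˡ (trans (*-identityˡ _) (linear-sum u j (a ∘ suc) (w ∘ suc))) ⟩
      sum (λ q → a q * F (u [ j ]≔ w q)) ∎
      where
      rest : Fin r → Carrier
      rest i = sum (λ q → a (suc q) * w (suc q) i)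

  module Uniqueness {n} {F : Columns n n → Carrier} (isAlternating : IsAlternating F) (Fe≈0 : F e ≈ 0#) where
    open IsAlternating isAlternating
    open Alternating isAlternating

    private
      -- Sorting: `k` columns are already in place and `d` remain. If the next index `κ` is not a
      -- value of `σ`, then `σ` repeats a value and two columns agree. Otherwise one swap brings `κ`
      -- into place, at the cost of a sign.
      onPermutedBasis : ∀ d k → d ℕ.+ k ≡ n → (σ : Fin n → Fin n) → (∀ l → toℕ l ℕ.< k → σ l ≡ l) →
        F (e ∘ σ) ≈ 0#
      onPermutedBasis zero    k k≡n σ fixed = trans
        (cong λ j i → reflexive (≡.cong (λ q → e q i) (fixed j (≡.subst (toℕ j ℕ.<_) (≡.sym k≡n) (Finₚ.toℕ<n j))))) Fe≈0
      onPermutedBasis (suc d) k d+k≡n σ fixed with Finₚ.any? (λ i → σ i Finₚ.≟ κ)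
        where
        κ = Fin.fromℕ< (≡.subst (k ℕ.<_) d+k≡n (ℕ.s≤s (ℕₚ.m≤n+m k d)))
      ... | no miss = let i , j , i≢j , eq = nonsurjective⇒collision σ _ (λ i eq → miss (i , eq)) in
        vanishes i≢j (e ∘ σ) (λ k′ → reflexive (≡.cong (λ q → e q k′) eq))
      ... | yes (i , σi≡κ) = go (i Finₚ.≟ κ)
        where
        k<n : k ℕ.< n
        k<n = ≡.subst (k ℕ.<_) d+k≡n (ℕ.s≤s (ℕₚ.m≤n+m k d))

        κ : Fin n
        κ = Fin.fromℕ< k<n

        extend : ∀ τ → (∀ l → toℕ l ℕ.< k → τ l ≡ l) → τ κ ≡ κ → ∀ l → toℕ l ℕ.< suc k → τ l ≡ l
        extend τ τ-fixed τκ≡κ l (ℕ.s≤s l≤k) with ℕₚ.m≤n⇒m<n∨m≡n l≤k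
        ... | inj₁ l<k = τ-fixed l l<k
        ... | inj₂ l≡k = ≡.subst (λ q → τ q ≡ q)
          (Finₚ.toℕ-injective (≡.trans (Finₚ.toℕ-fromℕ< k<n) (≡.sym l≡k))) τκ≡κ

        step : ∀ τ → (∀ l → toℕ l ℕ.< k → τ l ≡ l) → τ κ ≡ κ → F (e ∘ τ) ≈ 0#
        step τ τ-fixed τκ≡κ =
          onPermutedBasis d (suc k) (≡.trans (ℕₚ.+-suc d k) d+k≡n) τ (extend τ τ-fixed τκ≡κ)

        go : Dec (i ≡ κ) → F (e ∘ σ) ≈ 0#
        go (yes ≡.refl) = step σ fixed σi≡κ
        go (no i≢κ) = begin
          F (e ∘ σ)               ≈⟨ swap-negates κ≢i (vanishes κ≢i) (e ∘ σ) ⟩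
          - F (swap κ i (e ∘ σ))  ≈⟨ -‿cong (cong (by-cases₂ (λ l → ∀ q → swap κ i (e ∘ σ) l q ≈ e (swap κ i σ l) q) κ i
               (λ q → reflexive (≡.trans (≡.cong (λ w → w q) (set₂-first κ i _ _ (e ∘ σ)))
                                         (≡.cong (λ w → e w q) (≡.sym (set₂-first κ i _ _ σ)))))
               (λ q → reflexive (≡.trans (≡.cong (λ w → w q) (set₂-second κ i κ≢i _ _ (e ∘ σ)))
                                         (≡.cong (λ w → e w q) (≡.sym (set₂-second κ i κ≢i _ _ σ)))))
               (λ l l≢κ l≢i q → reflexive (≡.trans (≡.cong (λ w → w q) (set₂-other κ i _ _ (e ∘ σ) l l≢κ l≢i))
                                         (≡.cong (λ w → e w q) (≡.sym (set₂-other κ i _ _ σ l l≢κ l≢i))))))) ⟩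
          - F (e ∘ swap κ i σ)    ≈⟨ -‿cong (step (swap κ i σ) swap-fixed (≡.trans (set₂-first κ i _ _ σ) σi≡κ)) ⟩
          - 0#                    ≈⟨ -0#≈0# ⟩
          0#                      ∎
          where
          κ≢i : κ ≢ i
          κ≢i = i≢κ ∘ ≡.sym

          below≢κ : ∀ l → toℕ l ℕ.< k → l ≢ κ
          below≢κ l l<k l≡κ = ℕₚ.<⇒≢ l<k (≡.trans (≡.cong toℕ l≡κ) (Finₚ.toℕ-fromℕ< k<n))

          swap-fixed : ∀ l → toℕ l ℕ.< k → swap κ i σ l ≡ l
          swap-fixed l l<k = ≡.trans
            (set₂-other κ i _ _ σ l (below≢κ l l<k)
              (λ l≡i → below≢κ l l<k (≡.trans (≡.sym (fixed l l<k)) (≡.trans (≡.cong σ l≡i) σi≡κ))))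
            (fixed l l<k)

      -- The columns from position `k` on are basis vectors. Expanding column `k - 1` in the basis
      -- lowers `k`; at `k = n` the condition is vacuous, which is where `alternating≈0` starts with
      -- an arbitrary `σ`.
      onPartialBasis : ∀ k → k ℕ.≤ n → (u : Columns n n) (σ : Fin n → Fin n) →
        (∀ l → k ℕ.≤ toℕ l → ∀ i → u l i ≈ e (σ l) i) → F u ≈ 0#
      onPartialBasis zero    _   u σ basis = trans (cong λ j i → basis j ℕ.z≤n i)
        (onPermutedBasis n 0 (ℕₚ.+-identityʳ n) σ (λ _ ()))
      onPartialBasis (suc k) k<n u σ basis = begin
        F u
          ≈⟨ update-self u κ _ (λ i → sym (expand i)) ⟨
        F (u [ κ ]≔ (λ i → sum (λ q → u κ q * e q i)))
          ≈⟨ linear-sum u κ (u κ) e ⟩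
        sum (λ q → u κ q * F (u [ κ ]≔ e q))
          ≈⟨ sum-zero _ (λ q → trans (*-congˡ (onPartialBasis k (ℕₚ.<⇒≤ k<n) (u [ κ ]≔ e q) (updateAt σ κ (λ _ → q)) (basis′ q))) (zeroʳ _)) ⟩
        0# ∎
        where
        κ : Fin n
        κ = Fin.fromℕ< k<n

        expand : ∀ i → sum (λ q → u κ q * e q i) ≈ u κ i
        expand i = begin
          sum (λ q → u κ q * e q i) ≈⟨ sum-single i _ (λ q q≢i → trans (*-congˡ (e-off-diagonal (q≢i ∘ ≡.sym))) (zeroʳ _)) ⟩
          u κ i * e i i             ≈⟨ *-congˡ (e-diagonal i) ⟩
          u κ i * 1#                ≈⟨ *-identityʳ _ ⟩
          u κ i                     ∎

        basis′ : ∀ q l → k ℕ.≤ toℕ l → ∀ i → (u [ κ ]≔ e q) l i ≈ e (updateAt σ κ (λ _ → q) l) i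
        basis′ q l k≤l i with l Finₚ.≟ κ
        ... | yes ≡.refl = trans (update-on u κ _ i) (reflexive (≡.cong (λ w → e w i) (≡.sym (updateAt-updates κ σ))))
        ... | no l≢κ = trans (update-off u κ _ l l≢κ i) (trans
          (basis l (ℕₚ.≤∧≢⇒< k≤l (λ k≡l → l≢κ (Finₚ.toℕ-injective (≡.trans (≡.sym k≡l) (≡.sym (Finₚ.toℕ-fromℕ< k<n)))))) i)
          (reflexive (≡.cong (λ w → e w i) (≡.sym (updateAt-minimal l κ σ l≢κ)))))

    alternating≈0 : ∀ u → F u ≈ 0#
    alternating≈0 u = onPartialBasis n ℕₚ.≤-refl u id
      (λ l n≤l _ → contradiction (Finₚ.toℕ<n l) (ℕₚ.≤⇒≯ n≤l))

  e-sym : ∀ {n} (i j : Fin n) → e i j ≈ e j i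
  e-sym i j = case i Finₚ.≟ j of λ
    { (yes ≡.refl) → refl
    ; (no i≢j)     → trans (e-off-diagonal (i≢j ∘ ≡.sym)) (sym (e-off-diagonal i≢j)) }

  e-suc : ∀ {n} (i j : Fin n) → e (suc i) (suc j) ≈ e i j
  e-suc i j = case j Finₚ.≟ i of λ
    { (yes ≡.refl) → trans (e-diagonal (suc j)) (sym (e-diagonal j))
    ; (no j≢i)     → trans (e-off-diagonal (j≢i ∘ Finₚ.suc-injective)) (sym (e-off-diagonal j≢i)) }

  det-e : ∀ {n} → detᶜ (e {n}) ≈ 1#
  det-e {zero}  = refl
  det-e {suc n} = begin
    sum T                              ≈⟨ sum-single zero T vanish ⟩
    1# * (e {suc n} zero zero * detᶜ (λ l i → e {suc n} (suc l) (suc i)))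
                                       ≈⟨ *-identityˡ _ ⟩
    e {suc n} zero zero * detᶜ (λ l i → e {suc n} (suc l) (suc i))
                                       ≈⟨ *-cong (e-diagonal {suc n} zero) (trans (determinant-cong {n} λ i l → e-suc l i) (det-e {n})) ⟩
    1# * 1#                            ≈⟨ *-identityˡ _ ⟩
    1#                                 ∎
    where
    T : Fin (suc n) → Carrier
    T k = sign (toℕ k) * (e k zero * detᶜ (λ l i → e {suc n} (punchIn k l) (suc i)))

    vanish : ∀ k → k ≢ zero → T k ≈ 0#
    vanish k k≢0 = trans (*-congˡ (trans (*-congʳ (e-off-diagonal (k≢0 ∘ ≡.sym))) (zeroˡ _))) (zeroʳ _)

  _⊗_ : ∀ {n} → (Fin n → Fin n → Carrier) → (Fin n → Fin n → Carrier) → Fin n → Fin n → Carrier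
  (M ⊗ N) i j = sum (λ k → M i k * N k j)

  private
    module Multiplicativity {n} (M : Fin n → Fin n → Carrier) where
      apply : Columns n n → Columns n n
      apply u j i = sum (λ k → M i k * u j k)

      -- The defect of the product rule, as a function of the columns of the right-hand factor. It
      -- is alternating and vanishes at the identity, hence is zero.
      F : Columns n n → Carrier
      F u = detᶜ (apply u) + (- determinant M) * detᶜ u

      apply-cong : ∀ (u v : Columns n n) j → (∀ i → u j i ≈ v j i) → ∀ i → apply u j i ≈ apply v j i
      apply-cong u v j u≈v i = sum-cong-≋ λ k → *-congˡ {M i k} (u≈v k)

      rearrange : ∀ a b p q m d₁ d₂ → (a * p + b * q) + m * (a * d₁ + b * d₂) ≈ a * (p + m * d₁) + b * (q + m * d₂)
      rearrange = solve 7 (λ a b p q m d₁ d₂ → (a :* p :+ b :* q) :+ m :* (a :* d₁ :+ b :* d₂)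
        := a :* (p :+ m :* d₁) :+ b :* (q :+ m :* d₂)) refl

      distribute : ∀ m a b x y → m * (a * x + b * y) ≈ a * (m * x) + b * (m * y)
      distribute = solve 5 (λ m a b x y → m :* (a :* x :+ b :* y) := a :* (m :* x) :+ b :* (m :* y)) refl

      F-linear : ∀ j a b (u u₁ u₂ : Columns n n) →
        (∀ l → l ≢ j → ∀ i → u l i ≈ u₁ l i) →
        (∀ l → l ≢ j → ∀ i → u l i ≈ u₂ l i) →
        (∀ i → u j i ≈ a * u₁ j i + b * u₂ j i) →
        F u ≈ a * F u₁ + b * F u₂
      F-linear j a b u u₁ u₂ off₁ off₂ on = trans
        (+-cong (det-linear j a b (apply u) (apply u₁) (apply u₂)
                   (λ l l≢j → apply-cong u u₁ l (off₁ l l≢j)) (λ l l≢j → apply-cong u u₂ l (off₂ l l≢j))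
                   (λ i → trans (sum-cong-≋ λ k → trans (*-congˡ {M i k} (on k)) (distribute _ a b _ _))
                                (sum-linear a b (λ k → M i k * u₁ j k) (λ k → M i k * u₂ j k))))
                (*-congˡ (det-linear j a b u u₁ u₂ off₁ off₂ on)))
        (rearrange _ _ _ _ _ _ _)

      F-isAlternating : IsAlternating F
      F-isAlternating = record
        { cong = λ {u} {v} u≈v → +-cong (determinant-cong λ i j → apply-cong u v j (u≈v j) i)
                                (*-congˡ (determinant-cong λ i j → u≈v j i))
        ; linear = F-linear
        ; adjacent = λ i j j≡1+i u ui≈uj → trans
            (+-cong (det-adjacent i j j≡1+i (apply u) (λ k → sum-cong-≋ λ q → *-congˡ {M k q} (ui≈uj q)))
                    (trans (*-congˡ (det-adjacent i j j≡1+i u ui≈uj)) (zeroʳ _)))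
            (+-identityˡ 0#)
        }

      F-e≈0 : F e ≈ 0#
      F-e≈0 = begin
        detᶜ (apply e) + (- determinant M) * detᶜ (e {n}) ≈⟨ +-cong (determinant-cong M*e) (trans (*-congˡ (det-e {n})) (*-identityʳ _)) ⟩
        determinant M + - determinant M                 ≈⟨ -‿inverseʳ _ ⟩
        0#                                              ∎
        where
        M*e : ∀ i j → sum (λ k → M i k * e j k) ≈ M i j
        M*e i j = begin
          sum (λ k → M i k * e j k) ≈⟨ sum-single j _ (λ k k≢j → trans (*-congˡ (e-off-diagonal k≢j)) (zeroʳ _)) ⟩
          M i j * e j j             ≈⟨ trans (*-congˡ (e-diagonal j)) (*-identityʳ _) ⟩
          M i j                     ∎

  determinant-* : ∀ {n} (M N : Fin n → Fin n → Carrier) →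
    determinant (M ⊗ N) ≈ determinant M * determinant N
  determinant-* M N = begin
    p                     ≈⟨ +-identityʳ p ⟨
    p + 0#                ≈⟨ +-congˡ (trans (*-congʳ (-‿inverseˡ m)) (zeroˡ d)) ⟨
    p + (- m + m) * d     ≈⟨ solve 4 (λ p n m d → p :+ (n :+ m) :* d := (p :+ n :* d) :+ m :* d) refl p (- m) m d ⟩
    (p + (- m) * d) + m * d ≈⟨ +-congʳ (Uniqueness.alternating≈0 F-isAlternating F-e≈0 (λ j i → N i j)) ⟩
    0# + m * d            ≈⟨ +-identityˡ _ ⟩
    m * d                 ∎
    where
    open Multiplicativity M
    p = determinant (M ⊗ N)
    m = determinant M
    d = determinant N

  -- Cramer's rule: putting the zero combination of all columns in place of column `k` gives zero,
  -- while by linearity only its `k`-th term survives. Nothing is divided by, so zero divisors are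
  -- harmless.
  determinant-kernel : ∀ {n} (M : Fin n → Fin n → Carrier) (v : Fin n → Carrier) →
    (∀ i → sum (λ j → v j * M i j) ≈ 0#) → ∀ k → v k * determinant M ≈ 0#
  determinant-kernel {n} M v Mv≈0 k = begin
    v k * determinant M
      ≈⟨ *-congˡ (update-self u k (u k) (λ _ → refl)) ⟨
    v k * detᶜ (u [ k ]≔ u k)
      ≈⟨ sum-single k (λ j → v j * detᶜ (u [ k ]≔ u j)) (λ j j≢k → trans (*-congˡ (repeated j j≢k)) (zeroʳ _)) ⟨
    sum (λ j → v j * detᶜ (u [ k ]≔ u j))
      ≈⟨ linear-sum u k v u ⟨
    detᶜ (u [ k ]≔ (λ i → sum (λ j → v j * u j i)))
      ≈⟨ zero-column (u [ k ]≔ _) k (λ i → trans (update-on u k (λ i → sum (λ j → v j * u j i)) i) (Mv≈0 i)) ⟩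
    0# ∎
    where
    open Alternating (det-isAlternating {n})

    u : Columns n n
    u j i = M i j

    repeated : ∀ j → j ≢ k → detᶜ (u [ k ]≔ u j) ≈ 0#
    repeated j j≢k = vanishes (j≢k ∘ ≡.sym) (u [ k ]≔ u j) λ i →
      trans (update-on u k (u j) i) (sym (update-off u k (u j) j j≢k i))

-- Integer polynomials and characteristic polynomials

module _ {a ℓ₁ b ℓ₂} (A : RawRing a ℓ₁) (B : CommutativeRing b ℓ₂) where
  private
    module A = RawRing A
    module B = CommutativeRing B
    open RawMonoidDefinitions A.+-rawMonoid using () renaming (sum to sumᴬ)
    open RawMonoidDefinitions B.+-rawMonoid using () renaming (sum to sumᴮ)
    open RawDeterminant A using () renaming (sign to signᴬ; determinant to determinantᴬ)
    open Determinant B using () renaming (sign to signᴮ; determinant to determinantᴮ)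

  record PreservesRingOperations (h : A.Carrier → B.Carrier) : Set (a ⊔ ℓ₂) where
    field
      0-homo : h A.0# B.≈ B.0#
      1-homo : h A.1# B.≈ B.1#
      +-homo : ∀ x y → h (x A.+ y) B.≈ h x B.+ h y
      *-homo : ∀ x y → h (x A.* y) B.≈ h x B.* h y
      -‿homo : ∀ x → h (A.- x) B.≈ B.- h x

    sum-homo : ∀ {n} (t : Fin n → A.Carrier) → h (sumᴬ t) B.≈ sumᴮ (h ∘ t)
    sum-homo {zero}  t = 0-homo
    sum-homo {suc n} t = B.trans (+-homo _ _) (B.+-congˡ (sum-homo (t ∘ suc)))

    sign-homo : ∀ k → h (signᴬ k) B.≈ signᴮ k
    sign-homo zero    = 1-homo
    sign-homo (suc k) = B.trans (-‿homo _) (B.-‿cong (sign-homo k))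

    determinant-homo : ∀ {n} (M : Fin n → Fin n → A.Carrier) →
      h (determinantᴬ M) B.≈ determinantᴮ (λ i j → h (M i j))
    determinant-homo {zero}  M = 1-homo
    determinant-homo {suc n} M = B.trans (sum-homo term) (sum-cong λ j →
      B.trans (*-homo _ _) (B.*-cong (sign-homo (toℕ j)) (B.trans (*-homo (M zero j) _)
        (B.*-congˡ (determinant-homo (λ i k → M (suc i) (punchIn j k)))))))
      where
      term : Fin (suc n) → A.Carrier
      term j = signᴬ (toℕ j) A.* (M zero j A.* determinantᴬ (λ i k → M (suc i) (punchIn j k)))

      sum-cong : ∀ {m} {s t : Fin m → B.Carrier} → (∀ i → s i B.≈ t i) → sumᴮ s B.≈ sumᴮ t
      sum-cong {zero}  eq = B.refl
      sum-cong {suc m} eq = B.+-cong (eq zero) (sum-cong (eq ∘ suc))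

-- Integer polynomials as coefficient lists

infixl 6 _⊞_
infixl 7 _⊠_

_⊞_ : List ℤ → List ℤ → List ℤ
[]      ⊞ q       = q
(a ∷ p) ⊞ []      = a ∷ p
(a ∷ p) ⊞ (b ∷ q) = (a ℤ.+ b) ∷ (p ⊞ q)

_⊠_ : List ℤ → List ℤ → List ℤ
[]      ⊠ q = []
(a ∷ p) ⊠ q = List.map (a ℤ.*_) q ⊞ (+ 0 ∷ (p ⊠ q))

polynomialRawRing : RawRing 0ℓ 0ℓ
polynomialRawRing = record
  { Carrier = List ℤ
  ; _≈_ = _≡_
  ; _+_ = _⊞_
  ; _*_ = _⊠_
  ; -_  = List.map (ℤ.-_)
  ; 0#  = []
  ; 1#  = + 1 ∷ []
  }

module Evaluation {c ℓ} (R : CommutativeRing c ℓ) (ι : ℤ → CommutativeRing.Carrier R)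
  (isHom : RingMorphisms.IsRingHomomorphism ℤ.+-*-rawRing (CommutativeRing.rawRing R) ι) where
  open CommutativeRing R hiding (zero)
  open RingMorphisms.IsRingHomomorphism isHom
  open SetoidReasoning setoid
  open SemiringSolver commutativeSemiring using (solve; _:=_; _:+_; _:*_; con)
  open RingProperties ring using (-‿+-comm; -‿distribʳ-*; -0#≈0#)

  eval : Carrier → List ℤ → Carrier
  eval x []      = 0#
  eval x (a ∷ p) = ι a + x * eval x p

  module _ (x : Carrier) where
    eval-⊞ : ∀ p q → eval x (p ⊞ q) ≈ eval x p + eval x q
    eval-⊞ []      q       = sym (+-identityˡ _)
    eval-⊞ (a ∷ p) []      = sym (+-identityʳ _)
    eval-⊞ (a ∷ p) (b ∷ q) = begin
      ι (a ℤ.+ b) + x * eval x (p ⊞ q)        ≈⟨ +-cong (+-homo a b) (*-congˡ (eval-⊞ p q)) ⟩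
      (ι a + ι b) + x * (eval x p + eval x q) ≈⟨ solve 5 (λ a b x p q → (a :+ b) :+ x :* (p :+ q) := (a :+ x :* p) :+ (b :+ x :* q)) refl _ _ _ _ _ ⟩
      (ι a + x * eval x p) + (ι b + x * eval x q) ∎

    eval-scale : ∀ a q → eval x (List.map (a ℤ.*_) q) ≈ ι a * eval x q
    eval-scale a []      = sym (zeroʳ _)
    eval-scale a (b ∷ q) = begin
      ι (a ℤ.* b) + x * eval x (List.map (a ℤ.*_) q) ≈⟨ +-cong (*-homo a b) (*-congˡ (eval-scale a q)) ⟩
      ι a * ι b + x * (ι a * eval x q)               ≈⟨ solve 4 (λ a b x q → a :* b :+ x :* (a :* q) := a :* (b :+ x :* q)) refl _ _ _ _ ⟩
      ι a * (ι b + x * eval x q)                     ∎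

    eval-⊠ : ∀ p q → eval x (p ⊠ q) ≈ eval x p * eval x q
    eval-⊠ []      q = sym (zeroˡ _)
    eval-⊠ (a ∷ p) q = begin
      eval x (List.map (a ℤ.*_) q ⊞ (+ 0 ∷ (p ⊠ q)))         ≈⟨ eval-⊞ (List.map (a ℤ.*_) q) _ ⟩
      eval x (List.map (a ℤ.*_) q) + (ι (+ 0) + x * eval x (p ⊠ q)) ≈⟨ +-cong (eval-scale a q) (+-cong 0#-homo (*-congˡ (eval-⊠ p q))) ⟩
      ι a * eval x q + (0# + x * (eval x p * eval x q))      ≈⟨ solve 4 (λ a x p q → a :* q :+ (con 0 :+ x :* (p :* q)) := (a :+ x :* p) :* q) refl _ _ _ _ ⟩
      (ι a + x * eval x p) * eval x q                        ∎

    eval-neg : ∀ p → eval x (List.map (ℤ.-_) p) ≈ - eval x p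
    eval-neg []      = sym -0#≈0#
    eval-neg (a ∷ p) = begin
      ι (ℤ.- a) + x * eval x (List.map (ℤ.-_) p) ≈⟨ +-cong (-‿homo a) (*-congˡ (eval-neg p)) ⟩
      - ι a + x * - eval x p                   ≈⟨ +-congˡ (-‿distribʳ-* x _) ⟨
      - ι a + - (x * eval x p)                 ≈⟨ -‿+-comm _ _ ⟩
      - (ι a + x * eval x p)                   ∎

    eval-constant : ∀ a → eval x (a ∷ []) ≈ ι a
    eval-constant a = trans (+-congˡ (zeroʳ x)) (+-identityʳ _)

    eval-zero : ∀ p → All (_≡ + 0) p → eval x p ≈ 0#
    eval-zero []      []            = refl
    eval-zero (a ∷ p) (≡.refl ∷ p≡0) = trans (+-cong 0#-homo (trans (*-congˡ (eval-zero p p≡0)) (zeroʳ x))) (+-identityʳ 0#)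

    eval-preserves : PreservesRingOperations polynomialRawRing R (eval x)
    eval-preserves = record
      { 0-homo = refl
      ; 1-homo = trans (eval-constant (+ 1)) 1#-homo
      ; +-homo = eval-⊞
      ; *-homo = eval-⊠
      ; -‿homo = eval-neg
      }

open Evaluation ℤₚ.+-*-commutativeRing id (Identity.isRingHomomorphism ℤ.+-*-rawRing ≡.refl) public
  using () renaming (eval to evalℤ; eval-⊞ to evalℤ-⊞; eval-⊠ to evalℤ-⊠; eval-neg to evalℤ-neg; eval-constant to evalℤ-constant; eval-zero to evalℤ-zero; eval-preserves to evalℤ-preserves)

-- For large t the constant term is a multiple of t smaller than t.
eventually-zero : ∀ p N → (∀ t → N ℕ.≤ t → evalℤ (+ t) p ≡ + 0) → All (_≡ + 0) p
eventually-zero []      N vanishes = []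
eventually-zero (a ∷ p) N vanishes = a≡0 ∷ eventually-zero p (suc N) λ t N<t → case
  ℤₚ.i*j≡0⇒i≡0∨j≡0 (+ t) (≡.trans (≡.sym (ℤₚ.+-identityˡ _))
    (≡.trans (≡.cong (ℤ._+ (+ t ℤ.* evalℤ (+ t) p)) (≡.sym a≡0)) (vanishes t (ℕₚ.<⇒≤ N<t)))) of λ
  { (inj₁ t≡0) → contradiction (ℤₚ.+-injective t≡0) (ℕₚ.m<n⇒n≢0 N<t)
  ; (inj₂ e)   → e }
  where
  T = suc (∣ a ∣ ℕ.+ N)

  negation : ∀ x y → x ℤ.+ y ≡ + 0 → x ≡ ℤ.- y
  negation x y x+y≡0 = ≡.trans (regroup x y) (≡.trans (≡.cong (ℤ._+ (ℤ.- y)) x+y≡0) (ℤₚ.+-identityˡ _))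
    where
    regroup : ∀ x y → x ≡ (x ℤ.+ y) ℤ.+ (ℤ.- y)
    regroup = ℤ-Solver.solve-∀

  ∣a∣≡T*∣p[T]∣ : ∣ a ∣ ≡ T ℕ.* ∣ evalℤ (+ T) p ∣
  ∣a∣≡T*∣p[T]∣ = ≡.trans (≡.cong ∣_∣ (negation a _ (vanishes T (ℕₚ.m≤n⇒m≤1+n (ℕₚ.m≤n+m N ∣ a ∣)))))
    (≡.trans (ℤₚ.∣-i∣≡∣i∣ (+ T ℤ.* evalℤ (+ T) p)) (ℤₚ.abs-* (+ T) (evalℤ (+ T) p)))

  a≡0 : a ≡ + 0
  a≡0 with ∣ evalℤ (+ T) p ∣ | ∣a∣≡T*∣p[T]∣
  ... | zero  | e = ℤₚ.∣i∣≡0⇒i≡0 (≡.trans e (ℕₚ.*-zeroʳ T))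
  ... | suc k | e = contradiction
    (ℕₚ.≤-trans (ℕₚ.m≤m*n T (suc k)) (ℕₚ.≤-reflexive (≡.sym e)))
    (ℕₚ.<⇒≱ (ℕ.s≤s (ℕₚ.m≤m+n ∣ a ∣ N)))

IsPolynomial : (ℤ → ℤ) → Set
IsPolynomial φ = ∃ λ p → ∀ t → φ t ≡ evalℤ t p

polynomial-const : ∀ a → IsPolynomial (λ _ → a)
polynomial-const a = a ∷ [] , λ t → ≡.sym (evalℤ-constant t a)

polynomial-var : IsPolynomial id
polynomial-var = + 0 ∷ + 1 ∷ [] , identity
  where
  identity : ∀ t → t ≡ + 0 ℤ.+ t ℤ.* (+ 1 ℤ.+ t ℤ.* + 0)
  identity = ℤ-Solver.solve-∀

polynomial-+ : ∀ {φ ψ} → IsPolynomial φ → IsPolynomial ψ → IsPolynomial (λ t → φ t ℤ.+ ψ t)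
polynomial-+ (p , φ≡) (q , ψ≡) = p ⊞ q , λ t → ≡.trans (≡.cong₂ ℤ._+_ (φ≡ t) (ψ≡ t)) (≡.sym (evalℤ-⊞ t p q))

polynomial-* : ∀ {φ ψ} → IsPolynomial φ → IsPolynomial ψ → IsPolynomial (λ t → φ t ℤ.* ψ t)
polynomial-* (p , φ≡) (q , ψ≡) = p ⊠ q , λ t → ≡.trans (≡.cong₂ ℤ._*_ (φ≡ t) (ψ≡ t)) (≡.sym (evalℤ-⊠ t p q))

polynomial-neg : ∀ {φ} → IsPolynomial φ → IsPolynomial (λ t → ℤ.- φ t)
polynomial-neg (p , φ≡) = List.map (ℤ.-_) p , λ t → ≡.trans (≡.cong (ℤ.-_) (φ≡ t)) (≡.sym (evalℤ-neg t p))

-- At `t = a` the hypothesis is empty, so values cannot be cancelled one by one. Cancelling for `t`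
-- above `∣ a ∣` makes the difference of the polynomials eventually zero, hence zero everywhere.
linear-cancel : ∀ {φ ψ} → IsPolynomial φ → IsPolynomial ψ → ∀ a →
  (∀ t → (t ℤ.- a) ℤ.* φ t ≡ (t ℤ.- a) ℤ.* ψ t) → ∀ t → φ t ≡ ψ t
linear-cancel {φ} {ψ} φ-poly ψ-poly a eq t with polynomial-+ φ-poly (polynomial-neg ψ-poly)
... | p , diff≡ = ℤₚ.i-j≡0⇒i≡j (φ t) (ψ t) (≡.trans (diff≡ t) (evalℤ-zero t p
  (eventually-zero p (suc ∣ a ∣) λ s a<s → ≡.trans (≡.sym (diff≡ (+ s))) (ℤₚ.i≡j⇒i-j≡0 (cancelled s a<s)))))
  where
  cancelled : ∀ s → suc ∣ a ∣ ℕ.≤ s → φ (+ s) ≡ ψ (+ s)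
  cancelled s a<s = ℤₚ.*-cancelˡ-≡ (+ s ℤ.- a) _ _ {{ℤ.≢-nonZero s-a≢0}} (eq (+ s))
    where
    s-a≢0 : + s ℤ.- a ≢ + 0
    s-a≢0 e = ℕₚ.<⇒≢ a<s (≡.cong ∣_∣ (≡.sym (ℤₚ.i-j≡0⇒i≡j (+ s) a e)))

-- The polynomial of formal degree d with leading coefficient a and lower coefficients v.
withLeading : ∀ {d} → Vec ℤ d → ℤ → ℤ → ℤ
withLeading []      a t = a
withLeading (c ∷ v) a t = c ℤ.+ t ℤ.* withLeading v a t

withLeading≡eval : ∀ {d} (v : Vec ℤ d) a t → withLeading v a t ≡ evalℤ t (Vec.toList v ++ a ∷ [])
withLeading≡eval []      a t = ≡.sym (evalℤ-constant t a)
withLeading≡eval (c ∷ v) a t = ≡.cong (λ x → c ℤ.+ t ℤ.* x) (withLeading≡eval v a t)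

withLeading-isPolynomial : ∀ {d} (v : Vec ℤ d) a → IsPolynomial (withLeading v a)
withLeading-isPolynomial v a = Vec.toList v ++ a ∷ [] , withLeading≡eval v a

monic : ∀ {d} → Vec ℤ d → ℤ → ℤ
monic v = withLeading v (+ 1)

monic-not-eventually-zero : ∀ {d} (v : Vec ℤ d) N → ¬ (∀ t → N ℕ.≤ t → monic v (+ t) ≡ + 0)
monic-not-eventually-zero v N vanishes
  with Allₚ.++⁻ʳ (Vec.toList v) (eventually-zero (Vec.toList v ++ + 1 ∷ []) N
         (λ t N≤t → ≡.trans (≡.sym (withLeading≡eval v (+ 1) (+ t))) (vanishes t N≤t)))
... | () ∷ _

-- Synthetic division by `t - a`: the coefficients are the intermediate values of Horner's scheme at
-- `a`. The index records that the degree falls by exactly one.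
monic-quotient : ∀ {d} → ℤ → Vec ℤ (suc d) → Vec ℤ d
monic-quotient {zero}  a v       = []
monic-quotient {suc d} a (c ∷ v) = monic v a ∷ monic-quotient a v

monic-division : ∀ {d} a (v : Vec ℤ (suc d)) t →
  monic v t ≡ monic v a ℤ.+ (t ℤ.- a) ℤ.* monic (monic-quotient a v) t
monic-division {zero}  a (c ∷ []) t = identity a c t
  where
  identity : ∀ a c t → c ℤ.+ t ℤ.* + 1 ≡ (c ℤ.+ a ℤ.* + 1) ℤ.+ (t ℤ.- a) ℤ.* + 1
  identity = ℤ-Solver.solve-∀
monic-division {suc d} a (c ∷ v) t = ≡.trans
  (≡.cong (λ x → c ℤ.+ t ℤ.* x) (monic-division a v t)) (identity a c t _ _)
  where
  identity : ∀ a c t r q → c ℤ.+ t ℤ.* (r ℤ.+ (t ℤ.- a) ℤ.* q) ≡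
                           (c ℤ.+ a ℤ.* r) ℤ.+ (t ℤ.- a) ℤ.* (r ℤ.+ t ℤ.* q)
  identity = ℤ-Solver.solve-∀

quotient : ℤ → List ℤ → List ℤ
quotient a []      = []
quotient a (c ∷ p) = evalℤ a p ∷ quotient a p

division : ∀ a p t → evalℤ t p ≡ evalℤ a p ℤ.+ (t ℤ.- a) ℤ.* evalℤ t (quotient a p)
division a []      t = ≡.sym (≡.trans (ℤₚ.+-identityˡ _) (ℤₚ.*-zeroʳ (t ℤ.- a)))
division a (c ∷ p) t = ≡.trans (≡.cong (λ x → c ℤ.+ t ℤ.* x) (division a p t)) (identity a c t _ _)
  where
  identity : ∀ a c t r q → c ℤ.+ t ℤ.* (r ℤ.+ (t ℤ.- a) ℤ.* q) ≡
                           (c ℤ.+ a ℤ.* r) ℤ.+ (t ℤ.- a) ℤ.* (r ℤ.+ t ℤ.* q)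
  identity = ℤ-Solver.solve-∀

linearFactors : List ℤ → ℤ → ℤ
linearFactors []       t = + 1
linearFactors (a ∷ as) t = (t ℤ.- a) ℤ.* linearFactors as t

linearFactorsPolynomial : List ℤ → List ℤ
linearFactorsPolynomial []       = + 1 ∷ []
linearFactorsPolynomial (a ∷ as) = (ℤ.- a ∷ + 1 ∷ []) ⊠ linearFactorsPolynomial as

linearFactors-isPolynomial : ∀ as → IsPolynomial (linearFactors as)
linearFactors-isPolynomial as = linearFactorsPolynomial as , eval-factors as
  where
  identity : ∀ t a → t ℤ.- a ≡ (ℤ.- a) ℤ.+ t ℤ.* (+ 1 ℤ.+ t ℤ.* + 0)
  identity = ℤ-Solver.solve-∀

  eval-factors : ∀ as t → linearFactors as t ≡ evalℤ t (linearFactorsPolynomial as)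
  eval-factors []       t = ≡.sym (evalℤ-constant t (+ 1))
  eval-factors (a ∷ as) t = ≡.trans (≡.cong₂ ℤ._*_ (identity t a) (eval-factors as t))
    (≡.sym (evalℤ-⊠ t (ℤ.- a ∷ + 1 ∷ []) (linearFactorsPolynomial as)))

linearFactors-++ : ∀ as bs t → linearFactors (as ++ bs) t ≡ linearFactors as t ℤ.* linearFactors bs t
linearFactors-++ []       bs t = ≡.sym (ℤₚ.*-identityˡ _)
linearFactors-++ (a ∷ as) bs t = ≡.trans (≡.cong ((t ℤ.- a) ℤ.*_) (linearFactors-++ as bs t))
  (≡.sym (ℤₚ.*-assoc (t ℤ.- a) (linearFactors as t) (linearFactors bs t)))

prodFin≡linearFactors : ∀ {n} (bs : Vec ℤ n) t →
  prodFin (λ i → t ℤ.- lookup bs i) ≡ linearFactors (Vec.toList bs) t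
prodFin≡linearFactors []       t = ≡.refl
prodFin≡linearFactors (b ∷ bs) t = ≡.cong ((t ℤ.- b) ℤ.*_) (prodFin≡linearFactors bs t)

unit⇒∣∣≡1 : ∀ i j → i ℤ.* j ≡ + 1 → ∣ i ∣ ≡ 1
unit⇒∣∣≡1 i j ij≡1 = ℕₚ.m*n≡1⇒m≡1 ∣ i ∣ ∣ j ∣ (≡.trans (≡.sym (ℤₚ.abs-* i j)) (≡.cong ∣_∣ ij≡1))

-- If the values of c + t P(t) are units, then t P(t) is bounded, so P vanishes for t ≥ 3.
monic-not-unit : ∀ {d} (v : Vec ℤ (suc d)) (ψ : ℤ → ℤ) → ¬ (∀ t → monic v t ℤ.* ψ t ≡ + 1)
monic-not-unit (c ∷ v) ψ unit = monic-not-eventually-zero v 3 small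
  where
  value : ∀ t → ∣ monic (c ∷ v) t ∣ ≡ 1
  value t = unit⇒∣∣≡1 (monic (c ∷ v) t) (ψ t) (unit t)

  constant : ∣ c ∣ ≡ 1
  constant = ≡.trans (≡.cong ∣_∣ (≡.sym (ℤₚ.+-identityʳ c))) (value (+ 0))

  difference : ∀ c x → x ≡ (c ℤ.+ x) ℤ.- c
  difference = ℤ-Solver.solve-∀

  small : ∀ t → 3 ℕ.≤ t → monic v (+ t) ≡ + 0
  small t 3≤t with ∣ monic v (+ t) ∣ in eq
  ... | zero  = ℤₚ.∣i∣≡0⇒i≡0 eq
  ... | suc k = contradiction 3≤t (ℕₚ.<⇒≱ (ℕ.s≤s (begin
    t                          ≤⟨ ℕₚ.m≤m*n t (suc k) ⟩
    t ℕ.* suc k                ≡⟨ ≡.cong (t ℕ.*_) eq ⟨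
    t ℕ.* ∣ monic v (+ t) ∣    ≡⟨ ℤₚ.abs-* (+ t) (monic v (+ t)) ⟨
    ∣ + t ℤ.* monic v (+ t) ∣  ≡⟨ ≡.cong ∣_∣ (difference c (+ t ℤ.* monic v (+ t))) ⟩
    ∣ monic (c ∷ v) (+ t) ℤ.- c ∣       ≤⟨ ℤₚ.∣i-j∣≤∣i∣+∣j∣ (monic (c ∷ v) (+ t)) c ⟩
    ∣ monic (c ∷ v) (+ t) ∣ ℕ.+ ∣ c ∣   ≡⟨ ≡.cong₂ ℕ._+_ (value (+ t)) constant ⟩
    2                          ∎)))
    where open ℕₚ.≤-Reasoning

-- `ℤ` is a domain, so each root `a` of the right-hand side is a root of `v` or of `q`, and `t - a`
-- is cancelled from that factor. When the list is exhausted, `monic-not-unit` leaves no room for a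
-- `v` of positive degree.
monic-divisor-splits : ∀ as {d} (v : Vec ℤ d) (q : List ℤ) →
  (∀ t → monic v t ℤ.* evalℤ t q ≡ linearFactors as t) →
  Σ (Vec ℤ d) λ bs → ∀ t → monic v t ≡ prodFin (λ i → t ℤ.- lookup bs i)
monic-divisor-splits as       []          q eq = [] , λ t → ≡.refl
monic-divisor-splits []       v@(_ ∷ _)   q eq = contradiction eq (monic-not-unit v (λ t → evalℤ t q))
monic-divisor-splits (a ∷ as) v@(_ ∷ _)   q eq
  with ℤₚ.i*j≡0⇒i≡0∨j≡0 (monic v a) (≡.trans (eq a) (≡.trans (≡.cong (ℤ._* linearFactors as a) (ℤₚ.i≡j⇒i-j≡0 {a} ≡.refl)) (ℤₚ.*-zeroˡ (linearFactors as a))))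
... | inj₁ v[a]≡0 =
  let bs , splits = monic-divisor-splits as (monic-quotient a v) q cancelled
  in a ∷ bs , λ t → ≡.trans (factor t) (≡.cong ((t ℤ.- a) ℤ.*_) (splits t))
  where
  factor : ∀ t → monic v t ≡ (t ℤ.- a) ℤ.* monic (monic-quotient a v) t
  factor t = ≡.trans (monic-division a v t) (≡.trans (≡.cong (ℤ._+ (t ℤ.- a) ℤ.* monic (monic-quotient a v) t) v[a]≡0) (ℤₚ.+-identityˡ _))

  cancelled : ∀ t → monic (monic-quotient a v) t ℤ.* evalℤ t q ≡ linearFactors as t
  cancelled = linear-cancel
    (polynomial-* (withLeading-isPolynomial (monic-quotient a v) (+ 1)) (q , λ _ → ≡.refl))
    (linearFactors-isPolynomial as) a
    λ t → ≡.trans (≡.sym (ℤₚ.*-assoc (t ℤ.- a) _ _)) (≡.trans (≡.cong (ℤ._* evalℤ t q) (≡.sym (factor t))) (eq t))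
... | inj₂ q[a]≡0 = monic-divisor-splits as v (quotient a q) cancelled
  where
  factor : ∀ t → evalℤ t q ≡ (t ℤ.- a) ℤ.* evalℤ t (quotient a q)
  factor t = ≡.trans (division a q t) (≡.trans (≡.cong (ℤ._+ (t ℤ.- a) ℤ.* evalℤ t (quotient a q)) q[a]≡0) (ℤₚ.+-identityˡ _))

  swap-factors : ∀ x y z → x ℤ.* (y ℤ.* z) ≡ y ℤ.* (x ℤ.* z)
  swap-factors = ℤ-Solver.solve-∀

  cancelled : ∀ t → monic v t ℤ.* evalℤ t (quotient a q) ≡ linearFactors as t
  cancelled = linear-cancel
    (polynomial-* (withLeading-isPolynomial v (+ 1)) (quotient a q , λ _ → ≡.refl))
    (linearFactors-isPolynomial as) a
    λ t → ≡.trans (swap-factors (t ℤ.- a) (monic v t) _) (≡.trans (≡.cong (monic v t ℤ.*_) (≡.sym (factor t))) (eq t))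

-- Characteristic polynomials are monic

module ℤDet = Determinant ℤₚ.+-*-commutativeRing
open ℤDet public using () renaming (determinant to determinantℤ; sign to signℤ; determinant-cong to determinantℤ-cong; e to eℤ)
open RawMonoidDefinitions ℤ.+-0-rawMonoid public using () renaming (sum to sumℤ)

sumFin≡sum : ∀ {n} (t : Fin n → ℤ) → sumFin t ≡ sumℤ t
sumFin≡sum {zero}  t = ≡.refl
sumFin≡sum {suc n} t = ≡.cong (λ x → t zero ℤ.+ x) (sumFin≡sum (t ∘ suc))

sum-cong : ∀ {n} {s t : Fin n → ℤ} → (∀ i → s i ≡ t i) → sumℤ s ≡ sumℤ t
sum-cong {zero}  eq = ≡.refl
sum-cong {suc n} eq = ≡.cong₂ ℤ._+_ (eq zero) (sum-cong (eq ∘ suc))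

sgn≡sign : ∀ k → sgn k ≡ signℤ k
sgn≡sign zero    = ≡.refl
sgn≡sign (suc k) = ≡.cong (ℤ.-_) (sgn≡sign k)

det≡determinant : ∀ {n} (M : Matrix n) → det M ≡ determinantℤ M
det≡determinant {zero}  M = ≡.refl
det≡determinant {suc n} M = ≡.trans
  (sumFin≡sum (λ j → sgn (toℕ j) ℤ.* (M zero j ℤ.* det (λ i k → M (suc i) (punchIn j k)))))
  (sum-cong {suc n} λ j → ≡.cong₂ (λ s d → s ℤ.* (M zero j ℤ.* d)) (sgn≡sign (toℕ j))
    (det≡determinant (λ i k → M (suc i) (punchIn j k))))

determinant-isPolynomial : ∀ {n} (M : ℤ → Matrix n) → (∀ i j → IsPolynomial (λ t → M t i j)) →
  IsPolynomial (λ t → determinantℤ (M t))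
determinant-isPolynomial M M-poly = determinant P , λ t → ≡.trans
  (determinantℤ-cong λ i j → proj₂ (M-poly i j) t)
  (≡.sym (PreservesRingOperations.determinant-homo (evalℤ-preserves t) P))
  where
  open RawDeterminant polynomialRawRing using (determinant)
  P = λ i j → proj₁ (M-poly i j)

-- The degree is formal: `a` may be zero. All terms of a Laplace expansion then share one degree and
-- their leading coefficients add.
HasLeading : ℕ → ℤ → (ℤ → ℤ) → Set
HasLeading d a φ = Σ (Vec ℤ d) λ v → ∀ t → φ t ≡ withLeading v a t

leading-+ : ∀ {d a b φ ψ} → HasLeading d a φ → HasLeading d b ψ → HasLeading d (a ℤ.+ b) (λ t → φ t ℤ.+ ψ t)
leading-+ {a = a} {b} (v , φ≡) (w , ψ≡) =
  Vec.zipWith ℤ._+_ v w , λ t → ≡.trans (≡.cong₂ ℤ._+_ (φ≡ t) (ψ≡ t)) (add v w t)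
  where
  identity : ∀ c x t y z → (c ℤ.+ t ℤ.* y) ℤ.+ (x ℤ.+ t ℤ.* z) ≡ (c ℤ.+ x) ℤ.+ t ℤ.* (y ℤ.+ z)
  identity = ℤ-Solver.solve-∀

  add : ∀ {d} (v w : Vec ℤ d) t →
    withLeading v a t ℤ.+ withLeading w b t ≡ withLeading (Vec.zipWith ℤ._+_ v w) (a ℤ.+ b) t
  add []      []      t = ≡.refl
  add (c ∷ v) (x ∷ w) t = ≡.trans (identity c x t _ _) (≡.cong (λ y → (c ℤ.+ x) ℤ.+ t ℤ.* y) (add v w t))

leading-scale : ∀ {d a φ} k → HasLeading d a φ → HasLeading d (k ℤ.* a) (λ t → k ℤ.* φ t)
leading-scale {a = a} k (v , φ≡) = Vec.map (k ℤ.*_) v , λ t → ≡.trans (≡.cong (k ℤ.*_) (φ≡ t)) (scale v t)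
  where
  identity : ∀ k c t y → k ℤ.* (c ℤ.+ t ℤ.* y) ≡ k ℤ.* c ℤ.+ t ℤ.* (k ℤ.* y)
  identity = ℤ-Solver.solve-∀

  scale : ∀ {d} (v : Vec ℤ d) t → k ℤ.* withLeading v a t ≡ withLeading (Vec.map (k ℤ.*_) v) (k ℤ.* a) t
  scale []      t = ≡.refl
  scale (c ∷ v) t = ≡.trans (identity k c t _) (≡.cong (λ y → k ℤ.* c ℤ.+ t ℤ.* y) (scale v t))

leading-raise : ∀ {d a φ} → HasLeading d a φ → HasLeading (suc d) (+ 0) φ
leading-raise {a = a} (v , φ≡) = v Vec.∷ʳ a , λ t → ≡.trans (φ≡ t) (raise v t)
  where
  identity : ∀ a t → a ≡ a ℤ.+ t ℤ.* + 0
  identity = ℤ-Solver.solve-∀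

  raise : ∀ {d} (v : Vec ℤ d) t → withLeading v a t ≡ withLeading (v Vec.∷ʳ a) (+ 0) t
  raise []      t = identity a t
  raise (c ∷ v) t = ≡.cong (λ y → c ℤ.+ t ℤ.* y) (raise v t)

leading-shift : ∀ {d a φ} → HasLeading d a φ → HasLeading (suc d) a (λ t → t ℤ.* φ t)
leading-shift (v , φ≡) = + 0 ∷ v , λ t → ≡.trans (≡.cong (t ℤ.*_) (φ≡ t)) (≡.sym (ℤₚ.+-identityˡ _))

leading-cong : ∀ {d a b φ ψ} → a ≡ b → (∀ t → ψ t ≡ φ t) → HasLeading d a φ → HasLeading d b ψ
leading-cong ≡.refl ψ≡φ (v , φ≡) = v , λ t → ≡.trans (ψ≡φ t) (φ≡ t)

leading-sum : ∀ {n d} {a : Fin n → ℤ} {φ : Fin n → ℤ → ℤ} → (∀ i → HasLeading d (a i) (φ i)) →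
  HasLeading d (sumℤ a) (λ t → sumℤ (λ i → φ i t))
leading-sum {zero}  {d} leads = Vec.replicate d (+ 0) , zeros d
  where
  zeros : ∀ d t → + 0 ≡ withLeading (Vec.replicate d (+ 0)) (+ 0) t
  zeros zero    t = ≡.refl
  zeros (suc d) t = ≡.sym (≡.trans (ℤₚ.+-identityˡ _) (≡.trans (≡.cong (t ℤ.*_) (≡.sym (zeros d t))) (ℤₚ.*-zeroʳ t)))
leading-sum {suc n} leads = leading-+ (leads zero) (leading-sum (leads ∘ suc))

leading-determinant : ∀ {n} (E M : Matrix n) →
  HasLeading n (determinantℤ E) (λ t → determinantℤ (λ i j → M i j ℤ.+ t ℤ.* E i j))
leading-determinant {zero}  E M = [] , λ t → ≡.refl
leading-determinant {suc n} E M = leading-sum λ j →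
  let minor = leading-determinant (λ i k → E (suc i) (punchIn j k)) (λ i k → M (suc i) (punchIn j k))
  -- The constant part of the entry leaves the degree of the minor unchanged and is padded with
  -- leading coefficient zero; the part with `t` raises the degree and carries the leading
  -- coefficient.
  in leading-scale (signℤ (toℕ j)) (leading-cong (ℤₚ.+-identityˡ (E zero j ℤ.* determinantℤ (λ i k → E (suc i) (punchIn j k)))) (λ t → identity (M zero j) (E zero j) t _)
       (leading-+ (leading-raise (leading-scale (M zero j) minor)) (leading-shift (leading-scale (E zero j) minor))))
  where
  identity : ∀ m e t y → (m ℤ.+ t ℤ.* e) ℤ.* y ≡ m ℤ.* y ℤ.+ t ℤ.* (e ℤ.* y)
  identity = ℤ-Solver.solve-∀

charMatrix-entry : ∀ {n} (M : Matrix n) t i j →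
  (if ⌊ i Fin.≟ j ⌋ then t else + 0) ℤ.- M i j ≡ (ℤ.- M i j) ℤ.+ t ℤ.* eℤ j i
charMatrix-entry M t i j with i Fin.≟ j
... | yes _ = identity (M i j) t
  where
  identity : ∀ m t → t ℤ.- m ≡ (ℤ.- m) ℤ.+ t ℤ.* + 1
  identity = ℤ-Solver.solve-∀
... | no _  = identity (M i j) t
  where
  identity : ∀ m t → + 0 ℤ.- m ≡ (ℤ.- m) ℤ.+ t ℤ.* + 0
  identity = ℤ-Solver.solve-∀

charPoly≡determinant : ∀ {n} (M : Matrix n) t →
  charPoly M t ≡ determinantℤ (λ i j → (ℤ.- M i j) ℤ.+ t ℤ.* eℤ j i)
charPoly≡determinant M t = ≡.trans
  (det≡determinant (λ i j → (if ⌊ i Fin.≟ j ⌋ then t else + 0) ℤ.- M i j)) (determinantℤ-cong (charMatrix-entry M t))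

charPoly-monic : ∀ {n} (M : Matrix n) → Σ (Vec ℤ n) λ v → ∀ t → charPoly M t ≡ monic v t
charPoly-monic {n} M = leading-cong (ℤDet.det-e {n}) (charPoly≡determinant M)
  (leading-determinant (λ i j → eℤ j i) (λ i j → ℤ.- M i j))

charPoly-cong : ∀ {n} {M N : Matrix n} → (∀ i j → M i j ≡ N i j) → ∀ t → charPoly M t ≡ charPoly N t
charPoly-cong {M = M} {N} M≡N t = ≡.trans (charPoly≡determinant M t)
  (≡.trans (determinantℤ-cong λ i j → ≡.cong (λ m → (ℤ.- m) ℤ.+ t ℤ.* eℤ j i) (M≡N i j))
    (≡.sym (charPoly≡determinant N t)))

-- The `n`-th power of the scalar is written as linear factors over a repeated list, the shape that
-- `monic-divisor-splits` consumes.
scalar-determinant : ∀ n (as : List ℤ) t →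
  determinantℤ {n} (λ i j → linearFactors as t ℤ.* eℤ j i) ≡ linearFactors (List.concat (List.replicate n as)) t
scalar-determinant zero    as t = ≡.refl
scalar-determinant (suc n) as t = begin
  sumℤ T
    ≡⟨ ℤDet.sum-single zero T (λ k k≢0 → zero-entry (signℤ (toℕ k)) a _ (ℤDet.e-off-diagonal (k≢0 ∘ ≡.sym))) ⟩
  + 1 ℤ.* (a ℤ.* eℤ {suc n} zero zero ℤ.* determinantℤ (λ i j → a ℤ.* eℤ {suc n} (suc j) (suc i)))
    ≡⟨ unit-entry a _ (ℤDet.e-diagonal {suc n} zero) ⟩
  a ℤ.* determinantℤ (λ i j → a ℤ.* eℤ {suc n} (suc j) (suc i))
    ≡⟨ ≡.cong (a ℤ.*_) (≡.trans (determinantℤ-cong {n} (λ i j → ≡.cong (a ℤ.*_) (ℤDet.e-suc j i))) (scalar-determinant n as t)) ⟩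
  a ℤ.* linearFactors (List.concat (List.replicate n as)) t
    ≡⟨ linearFactors-++ as _ t ⟨
  linearFactors (List.concat (List.replicate (suc n) as)) t ∎
  where
  open ≡.≡-Reasoning
  a = linearFactors as t

  T : Fin (suc n) → ℤ
  T k = signℤ (toℕ k) ℤ.* (a ℤ.* eℤ k zero ℤ.* determinantℤ (λ i j → a ℤ.* eℤ {suc n} (punchIn k j) (suc i)))

  zero-entry : ∀ s a {x} d → x ≡ + 0 → s ℤ.* (a ℤ.* x ℤ.* d) ≡ + 0
  zero-entry s a d ≡.refl = identity s a d
    where
    identity : ∀ s a d → s ℤ.* (a ℤ.* + 0 ℤ.* d) ≡ + 0
    identity = ℤ-Solver.solve-∀

  unit-entry : ∀ a {x} d → x ≡ + 1 → + 1 ℤ.* (a ℤ.* x ℤ.* d) ≡ a ℤ.* d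
  unit-entry a d ≡.refl = identity a d
    where
    identity : ∀ a d → + 1 ℤ.* (a ℤ.* + 1 ℤ.* d) ≡ a ℤ.* d
    identity = ℤ-Solver.solve-∀

-- Split elements of a commutative ring

module IntegerAlgebra {c ℓ} (R : CommutativeRing c ℓ) (ι : ℤ → CommutativeRing.Carrier R)
  (isHom : RingMorphisms.IsRingHomomorphism ℤ.+-*-rawRing (CommutativeRing.rawRing R) ι) where
  open CommutativeRing R hiding (zero)
  open RingMorphisms.IsRingHomomorphism isHom
  open SetoidReasoning setoid
  open Evaluation R ι isHom public

  private
    morphism : ℤ.+-*-rawRing -Raw-AlmostCommutative⟶ fromCommutativeRing R
    morphism = record
      { ⟦_⟧ = ι ; +-homo = +-homo ; *-homo = *-homo ; -‿homo = -‿homo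
      ; 0-homo = 0#-homo ; 1-homo = 1#-homo }

    coefficient-equality : ∀ a b → Maybe (ι a ≈ ι b)
    coefficient-equality a b = case a ℤ.≟ b of λ
      { (yes a≡b) → just (reflexive (≡.cong ι a≡b)) ; (no _) → nothing }

  open RingSolver ℤ.+-*-rawRing (fromCommutativeRing R) morphism coefficient-equality public
    using (solve; _:=_; _:+_; _:*_; _:-_; :-_; con)

  -- The vector `x` is kept as an argument so that, through `act-*`, factors can be moved into it
  -- and inductions on the list can vary it.
  act : List ℤ → Carrier → Carrier → Carrier
  act []       f x = x
  act (a ∷ as) f x = (f - ι a) * act as f x

  act-cong : ∀ as {f g x y} → f ≈ g → x ≈ y → act as f x ≈ act as g y
  act-cong []       f≈g x≈y = x≈y
  act-cong (a ∷ as) f≈g x≈y = *-cong (+-congʳ f≈g) (act-cong as f≈g x≈y)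

  act-* : ∀ as f x y → act as f (x * y) ≈ x * act as f y
  act-* []       f x y = refl
  act-* (a ∷ as) f x y = trans (*-congˡ (act-* as f x y))
    (solve 3 (λ u x z → u :* (x :* z) := x :* (u :* z)) refl (f - ι a) x (act as f y))

  act-++ : ∀ as bs f x → act (as ++ bs) f x ≈ act as f (act bs f x)
  act-++ []       bs f x = refl
  act-++ (a ∷ as) bs f x = *-congˡ (act-++ as bs f x)

  act-zero : ∀ as f {x} → x ≈ 0# → act as f x ≈ 0#
  act-zero []       f x≈0 = x≈0
  act-zero (a ∷ as) f x≈0 = trans (*-congˡ (act-zero as f x≈0)) (zeroʳ _)

  eval-linearFactors : ∀ as f → eval f (linearFactorsPolynomial as) ≈ act as f 1#
  eval-linearFactors []       f = trans (eval-constant f (+ 1)) 1#-homo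
  eval-linearFactors (a ∷ as) f = begin
    eval f ((ℤ.- a ∷ + 1 ∷ []) ⊠ linearFactorsPolynomial as)
      ≈⟨ eval-⊠ f (ℤ.- a ∷ + 1 ∷ []) (linearFactorsPolynomial as) ⟩
    (ι (ℤ.- a) + f * (ι (+ 1) + f * 0#)) * eval f (linearFactorsPolynomial as)
      ≈⟨ *-cong (+-cong (-‿homo a) (*-congˡ (+-cong 1#-homo (zeroʳ f)))) (eval-linearFactors as f) ⟩
    (- ι a + f * (1# + 0#)) * act as f 1#
      ≈⟨ *-congʳ (trans (+-congˡ (trans (*-congˡ (+-identityʳ 1#)) (*-identityʳ f))) (+-comm _ _)) ⟩
    (f - ι a) * act as f 1# ∎

  -- The divided difference (q(t) - q(f)) / (t - f) of q = ∏ (x - a).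
  cofactor : List ℤ → Carrier → ℤ → Carrier
  cofactor []       f t = 0#
  cofactor (a ∷ as) f t = ι (t ℤ.- a) * cofactor as f t + act as f 1#

  cofactor-identity : ∀ as f t → (ι t - f) * cofactor as f t ≈ ι (linearFactors as t) - act as f 1#
  cofactor-identity []       f t = trans (zeroʳ _) (sym (trans (+-congʳ 1#-homo) (-‿inverseʳ 1#)))
  cofactor-identity (a ∷ as) f t = begin
    (ι t - f) * (ι (t ℤ.- a) * G + P)
      ≈⟨ *-congˡ (+-congʳ (*-congʳ ι[t-a])) ⟩
    (ι t - f) * ((ι t - ι a) * G + P)
      ≈⟨ solve 5 (λ t f a c p → (t :- f) :* ((t :- a) :* c :+ p) := (t :- a) :* ((t :- f) :* c) :+ (t :- f) :* p) refl (ι t) f (ι a) G P ⟩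
    (ι t - ι a) * ((ι t - f) * G) + (ι t - f) * P
      ≈⟨ +-congʳ (*-congˡ (cofactor-identity as f t)) ⟩
    (ι t - ι a) * (Q - P) + (ι t - f) * P
      ≈⟨ solve 5 (λ t f a q p → (t :- a) :* (q :- p) :+ (t :- f) :* p := (t :- a) :* q :- (f :- a) :* p) refl (ι t) f (ι a) Q P ⟩
    (ι t - ι a) * Q - (f - ι a) * P
      ≈⟨ +-congʳ (trans (*-congʳ (sym ι[t-a])) (sym (*-homo (t ℤ.- a) (linearFactors as t)))) ⟩
    ι ((t ℤ.- a) ℤ.* linearFactors as t) - (f - ι a) * P ∎
    where
    G = cofactor as f t
    P = act as f 1#
    Q = ι (linearFactors as t)

    ι[t-a] : ι (t ℤ.- a) ≈ ι t - ι a
    ι[t-a] = trans (+-homo t (ℤ.- a)) (+-congˡ (-‿homo a))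

  Split : Carrier → Set ℓ
  Split f = ∃ λ as → act as f 1# ≈ 0#

  split-cong : ∀ {f g} → f ≈ g → Split f → Split g
  split-cong f≈g (as , eq) = as , trans (act-cong as (sym f≈g) refl) eq

  split-zero : Split 0#
  split-zero = + 0 ∷ [] , trans (*-identityʳ _) (trans (+-congˡ (-‿cong 0#-homo)) (-‿inverseʳ 0#))

  split-quasi-idempotent : ∀ k g → g * g ≈ ι k * g → Split g
  split-quasi-idempotent k g g²≈kg = + 0 ∷ k ∷ [] , (begin
    (g - ι (+ 0)) * ((g - ι k) * 1#) ≈⟨ *-congˡ (*-identityʳ _) ⟩
    (g - ι (+ 0)) * (g - ι k)        ≈⟨ solve 2 (λ g k → (g :- con (+ 0)) :* (g :- k) := g :* g :- k :* g) refl g (ι k) ⟩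
    g * g - ι k * g                  ≈⟨ +-congʳ g²≈kg ⟩
    ι k * g - ι k * g                ≈⟨ -‿inverseʳ _ ⟩
    0#                               ∎)

  split-scale : ∀ k f → Split f → Split (ι k * f)
  split-scale k f (as , eq) = List.map (k ℤ.*_) as , scaled as eq
    where
    scaled : ∀ as {x} → act as f x ≈ 0# → act (List.map (k ℤ.*_) as) (ι k * f) x ≈ 0#
    scaled []       eq = eq
    scaled (a ∷ as) {x} eq = begin
      (ι k * f - ι (k ℤ.* a)) * act (List.map (k ℤ.*_) as) (ι k * f) x
        ≈⟨ *-congʳ (+-congˡ (-‿cong (*-homo k a))) ⟩
      (ι k * f - ι k * ι a) * act (List.map (k ℤ.*_) as) (ι k * f) x
        ≈⟨ solve 4 (λ k f a y → (k :* f :- k :* a) :* y := k :* ((f :- a) :* y)) refl (ι k) f (ι a) _ ⟩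
      ι k * ((f - ι a) * act (List.map (k ℤ.*_) as) (ι k * f) x)
        ≈⟨ *-congˡ (act-* (List.map (k ℤ.*_) as) (ι k * f) (f - ι a) x) ⟨
      ι k * act (List.map (k ℤ.*_) as) (ι k * f) ((f - ι a) * x)
        ≈⟨ *-congˡ (scaled as (trans (act-* as f (f - ι a) x) eq)) ⟩
      ι k * 0#
        ≈⟨ zeroʳ _ ⟩
      0# ∎

  -- On an eigenvector of `f` for `a`, the factor `f + g - (a + b)` acts as `g - b`.
  act-shift : ∀ bs a {f g w} → (f - ι a) * w ≈ 0# →
    act (List.map (ℤ._+_ a) bs) (f + g) w ≈ act bs g w
  act-shift []       a eq = refl
  act-shift (b ∷ bs) a {f} {g} {w} eq = begin
    ((f + g) - ι (a ℤ.+ b)) * act (List.map (ℤ._+_ a) bs) (f + g) w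
      ≈⟨ *-cong (+-congˡ (-‿cong (+-homo a b))) (act-shift bs a eq) ⟩
    ((f + g) - (ι a + ι b)) * act bs g w
      ≈⟨ solve 5 (λ f g a b y → ((f :+ g) :- (a :+ b)) :* y := (f :- a) :* y :+ (g :- b) :* y) refl f g (ι a) (ι b) (act bs g w) ⟩
    (f - ι a) * act bs g w + (g - ι b) * act bs g w
      ≈⟨ +-congʳ (trans (sym (act-* bs g (f - ι a) w)) (act-zero bs g eq)) ⟩
    0# + (g - ι b) * act bs g w
      ≈⟨ +-identityˡ _ ⟩
    (g - ι b) * act bs g w ∎

  -- Commuting elements: the candidates for roots of `f + g` are all sums `a + b`. In `go`, the
  -- factors for the remaining roots turn the vector into an eigenvector of `f` for `a`, where
  -- `act-shift` reduces to `g`.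
  split-+ : ∀ f g → Split f → Split g → Split (f + g)
  split-+ f g (as , f-split) (bs , g-split) = pairs as , go as f-split
    where
    pairs : List ℤ → List ℤ
    pairs = List.concatMap (λ a → List.map (ℤ._+_ a) bs)

    g-kills : ∀ x → act bs g x ≈ 0#
    g-kills x = begin
      act bs g x        ≈⟨ act-cong bs refl (*-identityʳ x) ⟨
      act bs g (x * 1#) ≈⟨ act-* bs g x 1# ⟩
      x * act bs g 1#   ≈⟨ *-congˡ g-split ⟩
      x * 0#            ≈⟨ zeroʳ x ⟩
      0#                ∎

    go : ∀ as {x} → act as f x ≈ 0# → act (pairs as) (f + g) x ≈ 0#
    go []       eq = eq
    go (a ∷ as) {x} eq = begin
      act (List.map (ℤ._+_ a) bs ++ pairs as) (f + g) x         ≈⟨ act-++ (List.map (ℤ._+_ a) bs) (pairs as) (f + g) x ⟩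
      act (List.map (ℤ._+_ a) bs) (f + g) (act (pairs as) (f + g) x) ≈⟨ act-shift bs a annihilated ⟩
      act bs g (act (pairs as) (f + g) x)                      ≈⟨ g-kills _ ⟩
      0#                                                       ∎
      where
      annihilated : (f - ι a) * act (pairs as) (f + g) x ≈ 0#
      annihilated = trans (sym (act-* (pairs as) (f + g) (f - ι a) x))
        (go as (trans (act-* as f (f - ι a) x) eq))

  -- Congruences modulo `p` and interpolation

  record Multiple (p : ℤ) (w : Carrier) : Set (c ⊔ ℓ) where
    constructor multiple
    field
      factor : Carrier
      equation  : w ≈ ι p * factor

  multiple-cong : ∀ {p v w} → v ≈ w → Multiple p v → Multiple p w
  multiple-cong v≈w (multiple z eq) = multiple z (trans (sym v≈w) eq)

  multiple-+ : ∀ {p v w} → Multiple p v → Multiple p w → Multiple p (v + w)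
  multiple-+ (multiple y v≈) (multiple z w≈) = multiple (y + z) (trans (+-cong v≈ w≈) (sym (distribˡ _ y z)))

  multiple-neg : ∀ {p v} → Multiple p v → Multiple p (- v)
  multiple-neg {p} (multiple y v≈) = multiple (- y)
    (trans (-‿cong v≈) (solve 2 (λ p y → :- (p :* y) := p :* (:- y)) refl (ι p) y))

  multiple-* : ∀ {p v} x → Multiple p v → Multiple p (x * v)
  multiple-* {p} x (multiple y v≈) = multiple (x * y)
    (trans (*-congˡ v≈) (solve 3 (λ x p y → x :* (p :* y) := p :* (x :* y)) refl x (ι p) y))

  -- A polynomial in `f` acts on an eigenvector by its value at the eigenvalue; here both the
  -- eigenvector equation and the conclusion hold modulo `p`.
  act-eigen : ∀ {p} as a f w → Multiple p ((f - ι a) * w) → Multiple p (act as f w - ι (linearFactors as a) * w)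
  act-eigen []       a f w _ = multiple 0# (begin
    w - ι (+ 1) * w ≈⟨ solve 1 (λ w → w :- con (+ 1) :* w := con (+ 0)) refl w ⟩
    ι (+ 0)         ≈⟨ 0#-homo ⟩
    0#              ≈⟨ zeroʳ _ ⟨
    _               ∎)
  act-eigen (b ∷ as) a f w eigen = multiple-cong (begin
    (f - ι b) * (P - L * w) + L * ((f - ι a) * w)
      ≈⟨ solve 6 (λ f a b p l w → (f :- b) :* (p :- l :* w) :+ l :* ((f :- a) :* w) := (f :- b) :* p :- ((a :- b) :* l) :* w) refl f (ι a) (ι b) P L w ⟩
    (f - ι b) * P - ((ι a - ι b) * L) * w
      ≈⟨ +-congˡ (-‿cong (*-congʳ (*-congʳ (sym (trans (+-homo a (ℤ.- b)) (+-congˡ (-‿homo b))))))) ⟩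
    (f - ι b) * P - (ι (a ℤ.- b) * L) * w
      ≈⟨ +-congˡ (-‿cong (*-congʳ (sym (*-homo (a ℤ.- b) (linearFactors as a))))) ⟩
    (f - ι b) * P - ι ((a ℤ.- b) ℤ.* linearFactors as a) * w ∎)
    (multiple-+ (multiple-* (f - ι b) (act-eigen as a f w eigen)) (multiple-* L eigen))
    where
    P = act as f w
    L = ι (linearFactors as a)

  act-∈ : ∀ {a as} → a ∈ as → ∀ f x → ∃ λ z → act as f x ≈ (f - ι a) * z
  act-∈ {a} {_ ∷ as} (here ≡.refl) f x = act as f x , refl
  act-∈ {a} {b ∷ as} (there a∈as)  f x with act-∈ a∈as f x
  ... | z , eq = (f - ι b) * z , trans (*-congˡ eq)
    (solve 3 (λ p q z → p :* (q :* z) := q :* (p :* z)) refl (f - ι b) (f - ι a) z)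

  -- Lagrange interpolation: Δ is a product of differences of distinct roots,
  -- repeated roots being discarded because nilpotent good elements vanish.
  module Interpolation {g} (f : Carrier) (Good : Carrier → Set g)
    (good-act : ∀ a {x} → Good x → Good ((f - ι a) * x))
    (good-reduced : ∀ {x} → Good x → x * x ≈ 0# → x ≈ 0#) where

    private
      good-acts : ∀ as {x} → Good x → Good (act as f x)
      good-acts []       good = good
      good-acts (a ∷ as) good = good-act a (good-acts as good)

    -- For `g = fᵖ - f` this is Fermat's congruence at each eigenvalue, phrased so that `f` need not
    -- be diagonalised.
    KillsEigenvectors : ℤ → Carrier → Set (c ⊔ ℓ)
    KillsEigenvectors p g = ∀ a w → (f - ι a) * w ≈ 0# → Multiple p (g * w)

    interpolate : ∀ as {h} → Good h → act as f h ≈ 0# →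
      ∃ λ Δ → Δ ≢ + 0 × (∀ p g → KillsEigenvectors p g → Multiple p (ι Δ * (g * h)))
    interpolate []       {h} good eq = + 1 , (λ ()) , λ p g _ → multiple 0# (begin
      ι (+ 1) * (g * h) ≈⟨ *-congˡ (trans (*-congˡ eq) (zeroʳ g)) ⟩
      ι (+ 1) * 0#      ≈⟨ zeroʳ _ ⟩
      0#                ≈⟨ zeroʳ _ ⟨
      _                 ∎)
    interpolate (a ∷ as) {h} good eq with a ∈? as
    ... | yes a∈as = interpolate as good (good-reduced (good-acts as good) square-zero)
      where
      square-zero : act as f h * act as f h ≈ 0#
      square-zero with act-∈ a∈as f h
      ... | z , factor = begin
        act as f h * act as f h         ≈⟨ *-congˡ factor ⟩
        act as f h * ((f - ι a) * z)    ≈⟨ solve 3 (λ p q z → p :* (q :* z) := (q :* p) :* z) refl (act as f h) (f - ι a) z ⟩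
        ((f - ι a) * act as f h) * z    ≈⟨ *-congʳ eq ⟩
        0# * z                          ≈⟨ zeroˡ z ⟩
        0#                              ∎
    ... | no a∉as with interpolate as (good-act a good) (trans (act-* as f (f - ι a) h) eq)
    -- The recursion is applied to `(f - ι a) * h`. The new factor is the value at `a` of the
    -- remaining product, nonzero because `a` is not among its roots.
    ...   | Δ , Δ≢0 , kills = linearFactors as a ℤ.* Δ , product≢0 , conclusion
      where
      L = linearFactors as a

      nonroot : ∀ as → a ∉ as → linearFactors as a ≢ + 0
      nonroot (b ∷ bs) a∉ e = case ℤₚ.i*j≡0⇒i≡0∨j≡0 (a ℤ.- b) e of λ
        { (inj₁ a-b≡0) → a∉ (here (ℤₚ.i-j≡0⇒i≡j a b a-b≡0))
        ; (inj₂ rest≡0) → nonroot bs (a∉ ∘ there) rest≡0 }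

      product≢0 : L ℤ.* Δ ≢ + 0
      product≢0 e = case ℤₚ.i*j≡0⇒i≡0∨j≡0 L e of λ
        { (inj₁ L≡0) → nonroot as a∉as L≡0 ; (inj₂ Δ≡0) → Δ≢0 Δ≡0 }

      conclusion : ∀ p g → KillsEigenvectors p g → Multiple p (ι (L ℤ.* Δ) * (g * h))
      conclusion p g eigen = multiple-cong (begin
        A + - (A - ι L * W)         ≈⟨ solve 2 (λ a b → a :+ (:- (a :- b)) := b) refl A (ι L * W) ⟩
        ι L * (ι Δ * (g * h))       ≈⟨ *-assoc _ _ _ ⟨
        (ι L * ι Δ) * (g * h)       ≈⟨ *-congʳ (*-homo L Δ) ⟨
        ι (L ℤ.* Δ) * (g * h)       ∎)
        -- Modulo `p`, the remaining factors send `W` to zero, because `act as f h` is an exact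
        -- eigenvector for `a`. They also multiply `W` by `linearFactors as a`, because the
        -- recursion makes `W` an eigenvector. So that multiple of `W` is zero.
        (multiple-+ vanishing (multiple-neg (act-eigen as a f W eigenvector)))
        where
        W = ι Δ * (g * h)
        A = act as f W

        eigenvector : Multiple p ((f - ι a) * W)
        eigenvector = multiple-cong
          (solve 4 (λ d g u h → d :* (g :* (u :* h)) := u :* (d :* (g :* h))) refl (ι Δ) g (f - ι a) h)
          (kills p g eigen)

        vanishing : Multiple p A
        vanishing = multiple-cong (begin
          ι Δ * (g * act as f h)  ≈⟨ *-congˡ (act-* as f g h) ⟨
          ι Δ * act as f (g * h)  ≈⟨ act-* as f (ι Δ) (g * h) ⟨
          A                       ∎)
          (multiple-* (ι Δ) (eigen a (act as f h) eq))

-- The Frobenius congruence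

prime∤factorial : ∀ {p} → Prime p → ∀ j → j ℕ.< p → ¬ (p ∣ j !)
prime∤factorial p-prime zero    j<p p∣1 = ¬prime[1] (≡.subst Prime (∣1⇒≡1 p∣1) p-prime)
prime∤factorial p-prime (suc j) j<p p∣j! with euclidsLemma (suc j) (j !) p-prime p∣j!
... | inj₁ p∣1+j = contradiction (∣⇒≤ p∣1+j) (ℕₚ.<⇒≱ j<p)
... | inj₂ p∣j!′ = prime∤factorial p-prime j (ℕₚ.<⇒≤ j<p) p∣j!′

-- `p` divides `p !`, which is the binomial coefficient times `k ! (p - k) !`, and both of these
-- factorials are of numbers below `p`.
prime∣binomial : ∀ {p} → Prime p → ∀ k → 0 ℕ.< k → k ℕ.< p → p ∣ (p C k)
prime∣binomial {p@(suc q)} p-prime k 0<k k<p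
  with euclidsLemma (p C k) (k ! ℕ.* (p ℕ.∸ k) !) p-prime (≡.subst (p ∣_) (≡.sym quotient*divisor) (m∣m*n (q !)))
  where
  instance
    _ = ℕₚ._!≢0 k
    _ = ℕₚ._!≢0 (p ℕ.∸ k)
    _ = ℕₚ.m*n≢0 (k !) ((p ℕ.∸ k) !)

  quotient*divisor : (p C k) ℕ.* (k ! ℕ.* (p ℕ.∸ k) !) ≡ p !
  quotient*divisor = ≡.trans (≡.cong (ℕ._* (k ! ℕ.* (p ℕ.∸ k) !)) (nCk≡n!/k![n-k]! (ℕₚ.<⇒≤ k<p)))
    (m/n*n≡m (k![n∸k]!∣n! (ℕₚ.<⇒≤ k<p)))
... | inj₁ p∣C = p∣C
... | inj₂ p∣rest with euclidsLemma (k !) ((p ℕ.∸ k) !) p-prime p∣rest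
...   | inj₁ p∣k! = contradiction p∣k! (prime∤factorial p-prime k k<p)
...   | inj₂ p∣[p-k]! = contradiction p∣[p-k]! (prime∤factorial p-prime (p ℕ.∸ k) (ℕₚ.∸-monoʳ-< 0<k (ℕₚ.<⇒≤ k<p)))

module Frobenius {c ℓ} (R : CommutativeRing c ℓ) (ι : ℤ → CommutativeRing.Carrier R)
  (isHom : RingMorphisms.IsRingHomomorphism ℤ.+-*-rawRing (CommutativeRing.rawRing R) ι) where
  open CommutativeRing R hiding (zero)
  open RingMorphisms.IsRingHomomorphism isHom
  open SetoidReasoning setoid
  open SemiringSum semiring
  open SemiringExp semiring
  open SemiringMult semiring using () renaming (_×_ to _·_)
  open IntegerAlgebra R ι isHom

  multiple-sum : ∀ {p n} (t : Fin n → Carrier) → (∀ i → Multiple p (t i)) → Multiple p (sum t)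
  multiple-sum {n = zero}  t _ = multiple 0# (sym (zeroʳ _))
  multiple-sum {n = suc n} t t-multiple = multiple-+ (t-multiple zero) (multiple-sum (t ∘ suc) (t-multiple ∘ suc))

  ·≈ι* : ∀ n x → n · x ≈ ι (+ n) * x
  ·≈ι* zero    x = sym (trans (*-congʳ 0#-homo) (zeroˡ x))
  ·≈ι* (suc n) x = begin
    x + n · x                  ≈⟨ +-cong (sym (*-identityˡ x)) (·≈ι* n x) ⟩
    1# * x + ι (+ n) * x       ≈⟨ distribʳ x 1# (ι (+ n)) ⟨
    (1# + ι (+ n)) * x         ≈⟨ *-congʳ (+-congʳ (sym 1#-homo)) ⟩
    (ι (+ 1) + ι (+ n)) * x    ≈⟨ *-congʳ (+-homo (+ 1) (+ n)) ⟨
    ι (+ suc n) * x            ∎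

  ·-multiple : ∀ {p n} → p ∣ n → ∀ x → Multiple (+ p) (n · x)
  ·-multiple {p} (divides q ≡.refl) x = multiple (ι (+ q) * x) (begin
    (q ℕ.* p) · x           ≈⟨ ·≈ι* (q ℕ.* p) x ⟩
    ι (+ (q ℕ.* p)) * x     ≈⟨ *-congʳ (trans (reflexive (≡.cong ι (≡.trans (ℤₚ.pos-* q p) (ℤₚ.*-comm (+ q) (+ p))))) (*-homo (+ p) (+ q))) ⟩
    (ι (+ p) * ι (+ q)) * x ≈⟨ *-assoc _ _ _ ⟩
    ι (+ p) * (ι (+ q) * x) ∎)

  -- Both end terms of the binomial expansion are split off, `y ^ p` at index zero and `x ^ p` at
  -- index `p`. The indices `suc (inject₁ i)` run through the rest, where `p` divides the
  -- coefficient.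
  frobenius : ∀ {p} → Prime p → ∀ x y → Multiple (+ p) ((x + y) ^ p - (x ^ p + y ^ p))
  frobenius {zero}  p-prime x y = contradiction p-prime ¬prime[0]
  frobenius {suc q} p-prime x y = multiple-cong (sym (begin
    (x + y) ^ p - (x ^ p + y ^ p)
      ≈⟨ +-congʳ (theorem p x y) ⟩
    t zero + sum (t ∘ suc) - (x ^ p + y ^ p)
      ≈⟨ +-congʳ (+-cong first (trans (sum-init-last (t ∘ suc)) (+-congˡ final))) ⟩
    y ^ p + (sum middle + x ^ p) - (x ^ p + y ^ p)
      ≈⟨ solve 3 (λ a b s → b :+ (s :+ a) :- (a :+ b) := s) refl (x ^ p) (y ^ p) (sum middle) ⟩
    sum middle ∎))
    (multiple-sum middle λ i → ·-multiple (prime∣binomial p-prime (suc (toℕ (inject₁ i))) ℕₚ.0<1+n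
      (ℕ.s≤s (≡.subst (ℕ._< q) (≡.sym (Finₚ.toℕ-inject₁ i)) (Finₚ.toℕ<n i)))) (binomial x y p (suc (inject₁ i))))
    where
    open Binomial commutativeSemiring
    p = suc q
    t = binomialTerm x y p

    middle : Fin q → Carrier
    middle i = t (suc (inject₁ i))

    first : t zero ≈ y ^ p
    first = begin
      (p C 0) · (1# * y ^ p) ≈⟨ reflexive (≡.cong (_· (1# * y ^ p)) (≡.trans (nCk≡nC[n∸k] {0} {p} ℕ.z≤n) (nCn≡1 p))) ⟩
      1 · (1# * y ^ p)       ≈⟨ +-identityʳ _ ⟩
      1# * y ^ p             ≈⟨ *-identityˡ _ ⟩
      y ^ p                  ∎

    final : t (suc (fromℕ q)) ≈ x ^ p
    final = begin
      (p C suc (toℕ (fromℕ q))) · (x ^ suc (toℕ (fromℕ q)) * y ^ (q ℕ.∸ toℕ (fromℕ q)))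
        ≈⟨ reflexive (≡.cong (λ k → (p C suc k) · (x ^ suc k * y ^ (q ℕ.∸ k))) (Finₚ.toℕ-fromℕ q)) ⟩
      (p C p) · (x ^ p * y ^ (q ℕ.∸ q))
        ≈⟨ reflexive (≡.cong₂ (λ k l → k · (x ^ p * y ^ l)) (nCn≡1 p) (ℕₚ.n∸n≡0 q)) ⟩
      1 · (x ^ p * 1#)       ≈⟨ +-identityʳ _ ⟩
      x ^ p * 1#             ≈⟨ *-identityʳ _ ⟩
      x ^ p                  ∎

-- The integral group ring of a finite abelian group

module ∑ = SemiringSum ℤₚ.+-*-semiring

module GroupRing {m : ℕ} (B : FinAbGroup m) where
  open FinAbGroup B public

  abelianGroup : AbelianGroup 0ℓ 0ℓ
  abelianGroup = record { isAbelianGroup = isAbelianGroup }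

  open AbelianGroup abelianGroup public using (assoc; comm; identityˡ; identityʳ; inverseˡ; inverseʳ; group; commutativeMonoid)
  open GroupProperties group public using (⁻¹-involutive; ε⁻¹≈ε)
  open AbelianGroupProperties abelianGroup public using (⁻¹-∙-comm)
  open ≡.≡-Reasoning

  b⁻¹∙[b∙c] : ∀ b c → (b ⁻¹) ∙ (b ∙ c) ≡ c
  b⁻¹∙[b∙c] b c = ≡.trans (≡.sym (assoc _ b c)) (≡.trans (≡.cong (_∙ c) (inverseˡ b)) (identityˡ c))

  b∙[b⁻¹∙c] : ∀ b c → b ∙ ((b ⁻¹) ∙ c) ≡ c
  b∙[b⁻¹∙c] b c = ≡.trans (≡.sym (assoc b _ c)) (≡.trans (≡.cong (_∙ c) (inverseʳ b)) (identityˡ c))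

  k⁻¹c-involutive : ∀ k c → (((k ⁻¹) ∙ c) ⁻¹) ∙ c ≡ k
  k⁻¹c-involutive k c = begin
    (((k ⁻¹) ∙ c) ⁻¹) ∙ c            ≡⟨ ≡.cong (_∙ c) (⁻¹-∙-comm (k ⁻¹) c) ⟨
    (((k ⁻¹) ⁻¹) ∙ (c ⁻¹)) ∙ c       ≡⟨ assoc _ _ c ⟩
    ((k ⁻¹) ⁻¹) ∙ ((c ⁻¹) ∙ c)       ≡⟨ ≡.cong₂ _∙_ (⁻¹-involutive k) (inverseˡ c) ⟩
    k ∙ ε                            ≡⟨ identityʳ k ⟩
    k                                ∎

  sum-translate : ∀ b (f : Fin m → ℤ) → sumℤ f ≡ sumℤ (λ k → f (b ∙ k))
  sum-translate b f = ∑.sum-permute f (permutation (b ∙_) ((b ⁻¹) ∙_) (b∙[b⁻¹∙c] b) (b⁻¹∙[b∙c] b))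

  sum-reflect : ∀ c (f : Fin m → ℤ) → sumℤ f ≡ sumℤ (λ k → f ((k ⁻¹) ∙ c))
  sum-reflect c f = ∑.sum-permute f (permutation (λ k → (k ⁻¹) ∙ c) (λ k → (k ⁻¹) ∙ c)
    (λ k → k⁻¹c-involutive k c) (λ k → k⁻¹c-involutive k c))

  infixl 7 _⊛_
  infix 4 _≋_

  _≋_ : (Fin m → ℤ) → (Fin m → ℤ) → Set
  f ≋ g = ∀ c → f c ≡ g c

  _⊛_ : (Fin m → ℤ) → (Fin m → ℤ) → Fin m → ℤ
  (f ⊛ g) c = sumℤ (λ k → f k ℤ.* g ((k ⁻¹) ∙ c))

  -- The group element `b` inside the group ring. Taking it to be a row of the identity matrix lets
  -- the lemmas on `e` serve for both.
  δ : Fin m → Fin m → ℤ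
  δ = eℤ

  sum-δ : ∀ b (f : Fin m → ℤ) → sumℤ (λ k → δ b k ℤ.* f k) ≡ f b
  sum-δ b f = begin
    sumℤ (λ k → δ b k ℤ.* f k) ≡⟨ ℤDet.sum-single b _ (λ k k≢b → ≡.trans (≡.cong (ℤ._* f k) (ℤDet.e-off-diagonal k≢b)) (ℤₚ.*-zeroˡ (f k))) ⟩
    δ b b ℤ.* f b              ≡⟨ ≡.cong (ℤ._* f b) (ℤDet.e-diagonal b) ⟩
    + 1 ℤ.* f b                ≡⟨ ℤₚ.*-identityˡ (f b) ⟩
    f b                        ∎

  δ-⊛ : ∀ b g → δ b ⊛ g ≋ (λ c → g ((b ⁻¹) ∙ c))
  δ-⊛ b g c = sum-δ b (λ k → g ((k ⁻¹) ∙ c))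

  ⊛-cong : ∀ {f f′ g g′} → f ≋ f′ → g ≋ g′ → f ⊛ g ≋ f′ ⊛ g′
  ⊛-cong f≋f′ g≋g′ c = sum-cong {m} λ k → ≡.cong₂ ℤ._*_ (f≋f′ k) (g≋g′ ((k ⁻¹) ∙ c))

  ⊛-comm : ∀ f g → f ⊛ g ≋ g ⊛ f
  ⊛-comm f g c = begin
    sumℤ (λ k → f k ℤ.* g ((k ⁻¹) ∙ c))
      ≡⟨ sum-reflect c (λ k → f k ℤ.* g ((k ⁻¹) ∙ c)) ⟩
    sumℤ (λ k → f ((k ⁻¹) ∙ c) ℤ.* g ((((k ⁻¹) ∙ c) ⁻¹) ∙ c))
      ≡⟨ sum-cong {m} (λ k → ≡.trans (≡.cong (λ q → f ((k ⁻¹) ∙ c) ℤ.* g q) (k⁻¹c-involutive k c)) (ℤₚ.*-comm (f ((k ⁻¹) ∙ c)) (g k))) ⟩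
    sumℤ (λ k → g k ℤ.* f ((k ⁻¹) ∙ c)) ∎

  ⊛-assoc : ∀ f g h → (f ⊛ g) ⊛ h ≋ f ⊛ (g ⊛ h)
  ⊛-assoc f g h c = begin
    sumℤ (λ k → sumℤ (λ j → f j ℤ.* g ((j ⁻¹) ∙ k)) ℤ.* h ((k ⁻¹) ∙ c))
      ≡⟨ sum-cong {m} (λ k → ∑.*-distribʳ-sum (h ((k ⁻¹) ∙ c)) (λ j → f j ℤ.* g ((j ⁻¹) ∙ k))) ⟩
    sumℤ (λ k → sumℤ (λ j → f j ℤ.* g ((j ⁻¹) ∙ k) ℤ.* h ((k ⁻¹) ∙ c)))
      ≡⟨ ∑.∑-comm (λ k j → f j ℤ.* g ((j ⁻¹) ∙ k) ℤ.* h ((k ⁻¹) ∙ c)) ⟩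
    sumℤ (λ j → sumℤ (λ k → f j ℤ.* g ((j ⁻¹) ∙ k) ℤ.* h ((k ⁻¹) ∙ c)))
      ≡⟨ sum-cong {m} inner ⟩
    sumℤ (λ j → f j ℤ.* sumℤ (λ k → g k ℤ.* h ((k ⁻¹) ∙ ((j ⁻¹) ∙ c)))) ∎
    where
    shift : ∀ j k → ((j ∙ k) ⁻¹) ∙ c ≡ (k ⁻¹) ∙ ((j ⁻¹) ∙ c)
    shift j k = begin
      ((j ∙ k) ⁻¹) ∙ c        ≡⟨ ≡.cong (λ q → (q ⁻¹) ∙ c) (comm j k) ⟩
      ((k ∙ j) ⁻¹) ∙ c        ≡⟨ ≡.cong (_∙ c) (⁻¹-∙-comm k j) ⟨
      ((k ⁻¹) ∙ (j ⁻¹)) ∙ c   ≡⟨ assoc _ _ c ⟩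
      (k ⁻¹) ∙ ((j ⁻¹) ∙ c)   ∎

    inner : ∀ j → sumℤ (λ k → f j ℤ.* g ((j ⁻¹) ∙ k) ℤ.* h ((k ⁻¹) ∙ c)) ≡
                  f j ℤ.* sumℤ (λ k → g k ℤ.* h ((k ⁻¹) ∙ ((j ⁻¹) ∙ c)))
    inner j = begin
      sumℤ (λ k → f j ℤ.* g ((j ⁻¹) ∙ k) ℤ.* h ((k ⁻¹) ∙ c))
        ≡⟨ sum-translate j (λ k → f j ℤ.* g ((j ⁻¹) ∙ k) ℤ.* h ((k ⁻¹) ∙ c)) ⟩
      sumℤ (λ k → f j ℤ.* g ((j ⁻¹) ∙ (j ∙ k)) ℤ.* h (((j ∙ k) ⁻¹) ∙ c))
        ≡⟨ sum-cong {m} (λ k → ≡.trans (≡.cong₂ (λ p q → f j ℤ.* g p ℤ.* h q) (b⁻¹∙[b∙c] j k) (shift j k))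
             (ℤₚ.*-assoc (f j) (g k) (h ((k ⁻¹) ∙ ((j ⁻¹) ∙ c))))) ⟩
      sumℤ (λ k → f j ℤ.* (g k ℤ.* h ((k ⁻¹) ∙ ((j ⁻¹) ∙ c))))
        ≡⟨ ∑.*-distribˡ-sum (f j) (λ k → g k ℤ.* h ((k ⁻¹) ∙ ((j ⁻¹) ∙ c))) ⟨
      f j ℤ.* sumℤ (λ k → g k ℤ.* h ((k ⁻¹) ∙ ((j ⁻¹) ∙ c))) ∎

  ⊛-identityˡ : ∀ f → δ ε ⊛ f ≋ f
  ⊛-identityˡ f c = ≡.trans (δ-⊛ ε f c) (≡.cong f (≡.trans (≡.cong (_∙ c) ε⁻¹≈ε) (identityˡ c)))

  ⊛-distribˡ : ∀ f g h → f ⊛ (λ c → g c ℤ.+ h c) ≋ (λ c → (f ⊛ g) c ℤ.+ (f ⊛ h) c)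
  ⊛-distribˡ f g h c = ≡.trans (sum-cong {m} λ k → ℤₚ.*-distribˡ-+ (f k) (g ((k ⁻¹) ∙ c)) (h ((k ⁻¹) ∙ c)))
    (∑.∑-distrib-+ (λ k → f k ℤ.* g ((k ⁻¹) ∙ c)) (λ k → f k ℤ.* h ((k ⁻¹) ∙ c)))

  ℤ[B] : CommutativeRing 0ℓ 0ℓ
  ℤ[B] = record
    { Carrier = Fin m → ℤ
    ; _≈_ = _≋_
    ; _+_ = λ f g c → f c ℤ.+ g c
    ; _*_ = _⊛_
    ; -_ = λ f c → ℤ.- f c
    ; 0# = λ _ → + 0
    ; 1# = δ ε
    ; isCommutativeRing = record
      { isRing = record
        { +-isAbelianGroup = record
          { isGroup = record
            { isMonoid = record
              { isSemigroup = record
                { isMagma = record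
                  { isEquivalence = record
                    { refl = λ _ → ≡.refl
                    ; sym = λ f≋g c → ≡.sym (f≋g c)
                    ; trans = λ f≋g g≋h c → ≡.trans (f≋g c) (g≋h c) }
                  ; ∙-cong = λ f≋f′ g≋g′ c → ≡.cong₂ ℤ._+_ (f≋f′ c) (g≋g′ c) }
                ; assoc = λ f g h c → ℤₚ.+-assoc (f c) (g c) (h c) }
              ; identity = (λ f c → ℤₚ.+-identityˡ (f c)) , (λ f c → ℤₚ.+-identityʳ (f c)) }
            ; inverse = (λ f c → ℤₚ.+-inverseˡ (f c)) , (λ f c → ℤₚ.+-inverseʳ (f c))
            ; ⁻¹-cong = λ f≋g c → ≡.cong (ℤ.-_) (f≋g c) }
          ; comm = λ f g c → ℤₚ.+-comm (f c) (g c) }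
        ; *-cong = ⊛-cong
        ; *-assoc = ⊛-assoc
        ; *-identity = ⊛-identityˡ , (λ f c → ≡.trans (⊛-comm f (δ ε) c) (⊛-identityˡ f c))
        ; distrib = ⊛-distribˡ , (λ f g h c → ≡.trans (⊛-comm (λ c → g c ℤ.+ h c) f c)
            (≡.trans (⊛-distribˡ f g h c) (≡.cong₂ ℤ._+_ (⊛-comm f g c) (⊛-comm f h c)))) }
      ; *-comm = ⊛-comm }
    }

  module R = CommutativeRing ℤ[B]

  ι : ℤ → Fin m → ℤ
  ι a c = a ℤ.* δ ε c

  ι-⊛ : ∀ a f → ι a ⊛ f ≋ (λ c → a ℤ.* f c)
  ι-⊛ a f c = begin
    sumℤ (λ k → a ℤ.* δ ε k ℤ.* f ((k ⁻¹) ∙ c))   ≡⟨ sum-cong {m} (λ k → ℤₚ.*-assoc a (δ ε k) (f ((k ⁻¹) ∙ c))) ⟩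
    sumℤ (λ k → a ℤ.* (δ ε k ℤ.* f ((k ⁻¹) ∙ c))) ≡⟨ ∑.*-distribˡ-sum a (λ k → δ ε k ℤ.* f ((k ⁻¹) ∙ c)) ⟨
    a ℤ.* (δ ε ⊛ f) c                             ≡⟨ ≡.cong (a ℤ.*_) (⊛-identityˡ f c) ⟩
    a ℤ.* f c                                     ∎

  ι-isRingHomomorphism : RingMorphisms.IsRingHomomorphism ℤ.+-*-rawRing R.rawRing ι
  ι-isRingHomomorphism = record
    { isSemiringHomomorphism = record
      { isNearSemiringHomomorphism = record
        { +-isMonoidHomomorphism = record
          { isMagmaHomomorphism = record
            { isRelHomomorphism = record { cong = λ { ≡.refl c → ≡.refl } }
            ; homo = λ a b c → ℤₚ.*-distribʳ-+ (δ ε c) a b }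
          ; ε-homo = λ c → ℤₚ.*-zeroˡ (δ ε c) }
        ; *-homo = λ a b c → ≡.trans (ℤₚ.*-assoc a b (δ ε c)) (≡.sym (ι-⊛ a (ι b) c)) }
      ; 1#-homo = λ c → ℤₚ.*-identityˡ (δ ε c) }
    ; -‿homo = λ a c → ≡.sym (ℤₚ.neg-distribˡ-* a (δ ε c)) }

  open CommutativeMonoidMult commutativeMonoid public
    using (×-homo-+; ×-assocˡ; ×-distrib-+; ×-homo-1) renaming (_×_ to _^ᵍ_)

  -- The product of all elements is unchanged when every factor is multiplied by b.
  ^ᵍ-order : ∀ b → m ^ᵍ b ≡ ε
  ^ᵍ-order b = GroupProperties.identityˡ-unique group (m ^ᵍ b) total (begin
    (m ^ᵍ b) ∙ total                          ≡⟨ ≡.cong (_∙ total) (∏.sum-replicate m) ⟨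
    ∏.sum {m} (λ _ → b) ∙ total               ≡⟨ ∏.∑-distrib-+ {m} (λ _ → b) id ⟨
    ∏.sum {m} (λ k → b ∙ k)                   ≡⟨ ∏.sum-permute id (permutation (b ∙_) ((b ⁻¹) ∙_) (b∙[b⁻¹∙c] b) (b⁻¹∙[b∙c] b)) ⟨
    total                                     ∎)
    where
    module ∏ = CommutativeMonoidSum commutativeMonoid
    total = ∏.sum {m} id

-- Integral spectra of circulants and power invariance

bounded : ∀ {n} (f : Fin n → ℤ) → ∃ λ K → ∀ i → ∣ f i ∣ ℕ.≤ K
bounded {zero}  f = 0 , λ ()
bounded {suc n} f with bounded (f ∘ suc)
... | K , f≤K = ∣ f zero ∣ ℕ.+ K , λ
  { zero → ℕₚ.m≤m+n _ K ; (suc i) → ℕₚ.≤-trans (f≤K i) (ℕₚ.m≤n+m K ∣ f zero ∣) }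

sum-of-squares-zero : ∀ {n} (x : Fin n → ℤ) → sumℤ (λ k → x k ℤ.* x k) ≡ + 0 → ∀ k → x k ≡ + 0
sum-of-squares-zero x eq = λ k → ℤₚ.∣i∣≡0⇒i≡0 (zeros x (ℤₚ.+-injective (≡.trans (≡.sym (natural x)) eq)) k)
  where
  square : ∀ i → i ℤ.* i ≡ + (∣ i ∣ ℕ.* ∣ i ∣)
  square (+ n)    = ≡.sym (ℤₚ.pos-* n n)
  square -[1+ n ] = ≡.refl

  squares : ∀ {n} → (Fin n → ℤ) → ℕ
  squares {zero}  x = 0
  squares {suc n} x = ∣ x zero ∣ ℕ.* ∣ x zero ∣ ℕ.+ squares (x ∘ suc)

  natural : ∀ {n} (x : Fin n → ℤ) → sumℤ (λ k → x k ℤ.* x k) ≡ + squares x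
  natural {zero}  x = ≡.refl
  natural {suc n} x = ≡.cong₂ ℤ._+_ (square (x zero)) (natural (x ∘ suc))

  zeros : ∀ {n} (x : Fin n → ℤ) → squares x ≡ 0 → ∀ k → ∣ x k ∣ ≡ 0
  zeros x eq zero    = case ℕₚ.m*n≡0⇒m≡0∨n≡0 ∣ x zero ∣ (ℕₚ.m+n≡0⇒m≡0 _ eq) of λ
    { (inj₁ e) → e ; (inj₂ e) → e }
  zeros x eq (suc k) = zeros (x ∘ suc) (ℕₚ.m+n≡0⇒n≡0 (∣ x zero ∣ ℕ.* ∣ x zero ∣) eq) k

module Circulant {m : ℕ} (B : FinAbGroup m) where
  open GroupRing B
  open IntegerAlgebra ℤ[B] ι ι-isRingHomomorphism
  open Frobenius ℤ[B] ι ι-isRingHomomorphism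
  open SemiringExp R.semiring using (_^_; ^-congˡ)
  open SemiringSum R.semiring using () renaming (sum to sumᴿ)
  private module RDet = Determinant ℤ[B]

  -- The matrix of multiplication by `f`: row `i` lists the coefficients of `δ i ⊛ f`.
  circulant : (Fin m → ℤ) → Matrix m
  circulant f i j = f ((i ⁻¹) ∙ j)

  δ-≡ : ∀ {b c b′ c′} → (b ≡ c → b′ ≡ c′) → (b′ ≡ c′ → b ≡ c) → δ b c ≡ δ b′ c′
  δ-≡ {b} {c} {b′} {c′} to from with c Finₚ.≟ b | c′ Finₚ.≟ b′
  ... | yes _   | yes _   = ≡.refl
  ... | yes c≡b | no c′≢b′ = contradiction (≡.sym (to (≡.sym c≡b))) c′≢b′
  ... | no c≢b  | yes c′≡b′ = contradiction (≡.sym (from (≡.sym c′≡b′))) c≢b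
  ... | no _    | no _    = ≡.refl

  δ-translate : ∀ a b c → δ b ((a ⁻¹) ∙ c) ≡ δ (a ∙ b) c
  δ-translate a b c = δ-≡
    (λ b≡ → ≡.trans (≡.cong (a ∙_) b≡) (b∙[b⁻¹∙c] a c))
    (λ ab≡c → ≡.trans (≡.sym (b⁻¹∙[b∙c] a b)) (≡.cong ((a ⁻¹) ∙_) ab≡c))

  δε-translate : ∀ i j → δ ε ((i ⁻¹) ∙ j) ≡ δ j i
  δε-translate i j = ≡.trans (δ-translate i ε j) (≡.trans (≡.cong (λ k → δ k j) (identityʳ i)) (ℤDet.e-sym i j))

  circulant-⊗ : ∀ f g i j → (circulant f ℤDet.⊗ circulant g) i j ≡ circulant (f ⊛ g) i j
  circulant-⊗ f g i j = begin
    sumℤ (λ k → f ((i ⁻¹) ∙ k) ℤ.* g ((k ⁻¹) ∙ j))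
      ≡⟨ sum-cong {m} (λ k → ≡.cong (λ q → f ((i ⁻¹) ∙ k) ℤ.* g q) (shift k)) ⟨
    sumℤ (λ k → f ((i ⁻¹) ∙ k) ℤ.* g ((((i ⁻¹) ∙ k) ⁻¹) ∙ ((i ⁻¹) ∙ j)))
      ≡⟨ sum-translate (i ⁻¹) (λ k → f k ℤ.* g ((k ⁻¹) ∙ ((i ⁻¹) ∙ j))) ⟨
    (f ⊛ g) ((i ⁻¹) ∙ j) ∎
    where
    open ≡.≡-Reasoning

    shift : ∀ k → (((i ⁻¹) ∙ k) ⁻¹) ∙ ((i ⁻¹) ∙ j) ≡ (k ⁻¹) ∙ j
    shift k = begin
      (((i ⁻¹) ∙ k) ⁻¹) ∙ ((i ⁻¹) ∙ j)       ≡⟨ ≡.cong (λ q → (q ⁻¹) ∙ ((i ⁻¹) ∙ j)) (comm (i ⁻¹) k) ⟩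
      ((k ∙ (i ⁻¹)) ⁻¹) ∙ ((i ⁻¹) ∙ j)       ≡⟨ ≡.cong (_∙ ((i ⁻¹) ∙ j)) (⁻¹-∙-comm k (i ⁻¹)) ⟨
      ((k ⁻¹) ∙ ((i ⁻¹) ⁻¹)) ∙ ((i ⁻¹) ∙ j)  ≡⟨ assoc (k ⁻¹) ((i ⁻¹) ⁻¹) ((i ⁻¹) ∙ j) ⟩
      (k ⁻¹) ∙ (((i ⁻¹) ⁻¹) ∙ ((i ⁻¹) ∙ j))  ≡⟨ ≡.cong ((k ⁻¹) ∙_) (b⁻¹∙[b∙c] (i ⁻¹) j) ⟩
      (k ⁻¹) ∙ j                             ∎

  charPoly-circulant : ∀ f t → charPoly (circulant f) t ≡ determinantℤ (circulant (ι t R.- f))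
  charPoly-circulant f t = ≡.trans (charPoly≡determinant (circulant f) t) (determinantℤ-cong λ i j →
    ≡.trans (ℤₚ.+-comm (ℤ.- circulant f i j) _)
      (≡.cong (λ d → t ℤ.* d ℤ.- circulant f i j) (≡.sym (δε-translate i j))))

  -- As the product of the `f - ι a` vanishes, `t - f` times `cofactor as f t` is the scalar
  -- `linearFactors as t`. Taking determinants of the circulants makes the characteristic polynomial
  -- divide the `m`-th power of that scalar, with a polynomial quotient.
  split⇒integralSpectrum : ∀ f → Split f → IntegralSpectrum (circulant f)
  split⇒integralSpectrum f (as , annihilates) =
    let bs , splits = monic-divisor-splits (List.concat (List.replicate m as)) (proj₁ χ) (proj₁ ψ) divisibility
    in bs , λ t → ≡.trans (proj₂ χ t) (splits t)
    where
    open ≡.≡-Reasoning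
    χ = charPoly-monic (circulant f)

    cofactor-isPolynomial : ∀ as c → IsPolynomial (λ t → cofactor as f t c)
    cofactor-isPolynomial []       c = polynomial-const (+ 0)
    cofactor-isPolynomial (a ∷ as) c
      with polynomial-+
             (polynomial-* (polynomial-+ polynomial-var (polynomial-const (ℤ.- a))) (cofactor-isPolynomial as c))
             (polynomial-const (act as f R.1# c))
    ... | p , eq = p , λ t → ≡.trans (≡.cong (ℤ._+ act as f R.1# c) (ι-⊛ (t ℤ.- a) (cofactor as f t) c)) (eq t)

    ψ : IsPolynomial (λ t → determinantℤ (circulant (cofactor as f t)))
    ψ = determinant-isPolynomial (λ t → circulant (cofactor as f t)) (λ i j → cofactor-isPolynomial as ((i ⁻¹) ∙ j))

    cofactor-product : ∀ t c → ((ι t R.- f) ⊛ cofactor as f t) c ≡ ι (linearFactors as t) c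
    cofactor-product t c = ≡.trans (cofactor-identity as f t c)
      (≡.trans (≡.cong (λ x → ι (linearFactors as t) c ℤ.- x) (annihilates c)) (ℤₚ.+-identityʳ _))

    divisibility : ∀ t → monic (proj₁ χ) t ℤ.* evalℤ t (proj₁ ψ) ≡ linearFactors (List.concat (List.replicate m as)) t
    divisibility t = begin
      monic (proj₁ χ) t ℤ.* evalℤ t (proj₁ ψ)
        ≡⟨ ≡.cong₂ ℤ._*_ (≡.trans (≡.sym (proj₂ χ t)) (charPoly-circulant f t)) (≡.sym (proj₂ ψ t)) ⟩
      determinantℤ (circulant (ι t R.- f)) ℤ.* determinantℤ (circulant (cofactor as f t))
        ≡⟨ ℤDet.determinant-* (circulant (ι t R.- f)) (circulant (cofactor as f t)) ⟨
      determinantℤ (circulant (ι t R.- f) ℤDet.⊗ circulant (cofactor as f t))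
        ≡⟨ determinantℤ-cong (λ i j → ≡.trans (circulant-⊗ (ι t R.- f) (cofactor as f t) i j)
             (≡.trans (cofactor-product t ((i ⁻¹) ∙ j)) (≡.cong (linearFactors as t ℤ.*_) (δε-translate i j)))) ⟩
      determinantℤ {m} (λ i j → linearFactors as t ℤ.* eℤ j i)
        ≡⟨ scalar-determinant m as t ⟩
      linearFactors (List.concat (List.replicate m as)) t ∎

  sumᴿ-pointwise : ∀ {n} (t : Fin n → Fin m → ℤ) c → sumᴿ t c ≡ sumℤ (λ j → t j c)
  sumᴿ-pointwise {zero}  t c = ≡.refl
  sumᴿ-pointwise {suc n} t c = ≡.cong (λ x → t zero c ℤ.+ x) (sumᴿ-pointwise (t ∘ suc) c)

  -- Cayley–Hamilton: the matrix f·1 - circulant f over ℤ[B] kills the vector of all δ b.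
  integralSpectrum⇒split : ∀ f → IntegralSpectrum (circulant f) → Split f
  integralSpectrum⇒split f (λs , splits) = as , R.trans (R.sym (eval-linearFactors as f)) (R.trans (R.sym same) cayleyHamilton)
    where
    as = Vec.toList λs

    -- The matrix `t - circulant f` with polynomial entries, so that `P` is the characteristic
    -- polynomial as a coefficient list, ready to be evaluated at `f`.
    X : Fin m → Fin m → List ℤ
    X i j = (ℤ.- circulant f i j) ∷ eℤ j i ∷ []

    P = RawDeterminant.determinant polynomialRawRing X
    Q = linearFactorsPolynomial as

    vanishes : ∀ t → evalℤ t (P ⊞ List.map (ℤ.-_) Q) ≡ + 0
    vanishes t = ≡.trans (evalℤ-⊞ t P (List.map (ℤ.-_) Q)) (≡.trans (≡.cong₂ ℤ._+_ P[t] (evalℤ-neg t Q))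
      (ℤₚ.i≡j⇒i-j≡0 (proj₂ (linearFactors-isPolynomial as) t)))
      where
      P[t] : evalℤ t P ≡ linearFactors as t
      P[t] = ≡.trans (PreservesRingOperations.determinant-homo (evalℤ-preserves t) X)
        (≡.trans (determinantℤ-cong λ i j → ≡.cong (λ x → (ℤ.- circulant f i j) ℤ.+ t ℤ.* x) (evalℤ-constant t (eℤ j i)))
        (≡.trans (≡.sym (charPoly≡determinant (circulant f) t))
        (≡.trans (splits t) (prodFin≡linearFactors λs t))))

    -- `P` and `Q` agree at all integers but may differ in trailing zeros, so their difference is
    -- compared with zero instead of the lists with each other.
    same : eval f P R.≈ eval f Q
    same c = ℤₚ.i-j≡0⇒i≡j (eval f P c) (eval f Q c) (≡.trans
      (≡.cong (λ x → eval f P c ℤ.+ x) (≡.sym (eval-neg f Q c)))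
      (≡.trans (≡.sym (eval-⊞ f P (List.map (ℤ.-_) Q) c))
        (eval-zero f (P ⊞ List.map (ℤ.-_) Q) (eventually-zero (P ⊞ List.map (ℤ.-_) Q) 0 (λ t _ → vanishes (+ t))) c)))

    E : Fin m → Fin m → Fin m → ℤ
    E i j = eval f (X i j)

    entry : ∀ i j c → (δ j ⊛ E i j) c ≡ δ j i ℤ.* f ((j ⁻¹) ∙ c) ℤ.+ ℤ.- (δ c j ℤ.* circulant f i j)
    entry i j c = begin
      (δ j ⊛ E i j) c
        ≡⟨ δ-⊛ j (E i j) c ⟩
      E i j ((j ⁻¹) ∙ c)
        ≡⟨ ≡.cong₂ ℤ._+_ (≡.cong ((ℤ.- circulant f i j) ℤ.*_) (δε-translate j c))
             (≡.trans (R.*-congˡ {f} (eval-constant f (eℤ j i)) ((j ⁻¹) ∙ c))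
               (≡.trans (⊛-comm f (ι (eℤ j i)) ((j ⁻¹) ∙ c)) (ι-⊛ (eℤ j i) f ((j ⁻¹) ∙ c)))) ⟩
      (ℤ.- circulant f i j) ℤ.* δ c j ℤ.+ δ j i ℤ.* f ((j ⁻¹) ∙ c)
        ≡⟨ identity (circulant f i j) (δ c j) (δ j i ℤ.* f ((j ⁻¹) ∙ c)) ⟩
      δ j i ℤ.* f ((j ⁻¹) ∙ c) ℤ.+ ℤ.- (δ c j ℤ.* circulant f i j) ∎
      where
      open ≡.≡-Reasoning
      identity : ∀ x d y → (ℤ.- x) ℤ.* d ℤ.+ y ≡ y ℤ.+ ℤ.- (d ℤ.* x)
      identity = ℤ-Solver.solve-∀

    -- Both parts equal `δ i ⊛ f`: once as a product, once expanded in the basis with row `i` of the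
    -- circulant as coefficients.
    kernel : ∀ i → sumᴿ (λ j → δ j ⊛ E i j) R.≈ R.0#
    kernel i c = begin
      sumᴿ (λ j → δ j ⊛ E i j) c
        ≡⟨ sumᴿ-pointwise (λ j → δ j ⊛ E i j) c ⟩
      sumℤ (λ j → (δ j ⊛ E i j) c)
        ≡⟨ sum-cong {m} (λ j → ≡.trans (entry i j c) (≡.cong₂ ℤ._+_ (≡.cong (ℤ._* f ((j ⁻¹) ∙ c)) (ℤDet.e-sym j i)) (ℤₚ.neg-distribʳ-* (δ c j) (circulant f i j)))) ⟩
      sumℤ (λ j → δ i j ℤ.* f ((j ⁻¹) ∙ c) ℤ.+ δ c j ℤ.* ℤ.- circulant f i j)
        ≡⟨ ∑.∑-distrib-+ (λ j → δ i j ℤ.* f ((j ⁻¹) ∙ c)) (λ j → δ c j ℤ.* ℤ.- circulant f i j) ⟩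
      sumℤ (λ j → δ i j ℤ.* f ((j ⁻¹) ∙ c)) ℤ.+ sumℤ (λ j → δ c j ℤ.* ℤ.- circulant f i j)
        ≡⟨ ≡.cong₂ ℤ._+_ (sum-δ i (λ j → f ((j ⁻¹) ∙ c))) (sum-δ c (λ j → ℤ.- circulant f i j)) ⟩
      f ((i ⁻¹) ∙ c) ℤ.- f ((i ⁻¹) ∙ c)
        ≡⟨ ℤₚ.+-inverseʳ (f ((i ⁻¹) ∙ c)) ⟩
      + 0 ∎
      where open ≡.≡-Reasoning

    cayleyHamilton : eval f P R.≈ R.0#
    cayleyHamilton = R.trans (PreservesRingOperations.determinant-homo (eval-preserves f) X)
      -- The entry of the kernel vector at `ε` is the unit `δ ε`, so the determinant itself is zero.
      (R.trans (R.sym (R.*-identityˡ (RDet.determinant E))) (RDet.determinant-kernel E δ kernel ε))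

  -- Power maps and Adams operations

  PowerInvariantAbove : ℕ → (Fin m → ℤ) → Set
  PowerInvariantAbove L f = ∀ p → Prime p → L ℕ.< p → ∀ c → f (p ^ᵍ c) ≡ f c

  Symmetric : (Fin m → ℤ) → Set
  Symmetric f = ∀ c → f (c ⁻¹) ≡ f c

  ^ᵍ-ε : ∀ n → n ^ᵍ ε ≡ ε
  ^ᵍ-ε zero    = ≡.refl
  ^ᵍ-ε (suc n) = ≡.trans (identityˡ _) (^ᵍ-ε n)

  ^ᵍ-multiple : ∀ k c → (k ℕ.* m) ^ᵍ c ≡ ε
  ^ᵍ-multiple k c = ≡.trans (≡.sym (×-assocˡ c k m)) (≡.trans (≡.cong (k ^ᵍ_) (^ᵍ-order c)) (^ᵍ-ε k))

  m≢0 : m ≢ 0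
  m≢0 m≡0 = case ≡.subst Fin m≡0 ε of λ ()

  powerInverse : ∀ {p} → Coprime p m → ∃ λ r → ∀ c → r ^ᵍ (p ^ᵍ c) ≡ c
  powerInverse {p} coprime with coprime-Bézout coprime
  ... | Bézout.+- x y eq = x , λ c → begin
    x ^ᵍ (p ^ᵍ c)           ≡⟨ ×-assocˡ c x p ⟩
    (x ℕ.* p) ^ᵍ c          ≡⟨ ≡.cong (_^ᵍ c) eq ⟨
    c ∙ ((y ℕ.* m) ^ᵍ c)    ≡⟨ ≡.cong (c ∙_) (^ᵍ-multiple y c) ⟩
    c ∙ ε                   ≡⟨ identityʳ c ⟩
    c                       ∎
    where open ≡.≡-Reasoning
  -- Here `1 + x p` is a multiple of `m`, so the exponent `x p` acts as inversion; a second
  -- application of it undoes the sign while keeping the exponent natural.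
  ... | Bézout.-+ x y eq = (x ℕ.* p) ℕ.* x , λ c → begin
    ((x ℕ.* p) ℕ.* x) ^ᵍ (p ^ᵍ c)   ≡⟨ ×-assocˡ (p ^ᵍ c) (x ℕ.* p) x ⟨
    (x ℕ.* p) ^ᵍ (x ^ᵍ (p ^ᵍ c))    ≡⟨ ≡.cong ((x ℕ.* p) ^ᵍ_) (×-assocˡ c x p) ⟩
    (x ℕ.* p) ^ᵍ ((x ℕ.* p) ^ᵍ c)   ≡⟨ inverts ((x ℕ.* p) ^ᵍ c) ⟩
    ((x ℕ.* p) ^ᵍ c) ⁻¹             ≡⟨ ≡.cong _⁻¹ (inverts c) ⟩
    (c ⁻¹) ⁻¹                       ≡⟨ ⁻¹-involutive c ⟩
    c                               ∎
    where
    open ≡.≡-Reasoning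
    inverts : ∀ d → (x ℕ.* p) ^ᵍ d ≡ d ⁻¹
    inverts d = GroupProperties.inverseʳ-unique group d ((x ℕ.* p) ^ᵍ d)
      (≡.trans (≡.cong (_^ᵍ d) eq) (^ᵍ-multiple y d))

  ^ᵍ-commute : ∀ a b c → a ^ᵍ (b ^ᵍ c) ≡ b ^ᵍ (a ^ᵍ c)
  ^ᵍ-commute a b c = ≡.trans (×-assocˡ c a b) (≡.trans (≡.cong (_^ᵍ c) (ℕₚ.*-comm a b)) (≡.sym (×-assocˡ c b a)))

  δ-^ : ∀ b n → δ b ^ n ≋ δ (n ^ᵍ b)
  δ-^ b zero    c = ≡.refl
  δ-^ b (suc n) c = ≡.trans (R.*-congˡ {δ b} (δ-^ b n) c)
    (≡.trans (δ-⊛ b (δ (n ^ᵍ b)) c) (δ-translate b (n ^ᵍ b) c))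

  module AdamsOperation {p} (p-prime : Prime p) {r} (r-inverse : ∀ c → r ^ᵍ (p ^ᵍ c) ≡ c) where
    open SetoidReasoning R.setoid

    -- The linear extension of `b ↦ p ^ᵍ b`, the Adams operation of the group ring. As a function of
    -- coefficients it precomposes with the inverse power map, hence `r`.
    ψ : (Fin m → ℤ) → Fin m → ℤ
    ψ f c = f (r ^ᵍ c)

    ψ-δ : ∀ b → ψ (δ b) ≋ δ (p ^ᵍ b)
    ψ-δ b c = δ-≡
      (λ b≡rc → ≡.trans (≡.cong (p ^ᵍ_) b≡rc) (≡.trans (^ᵍ-commute p r c) (r-inverse c)))
      (λ pb≡c → ≡.trans (≡.sym (r-inverse b)) (≡.cong (r ^ᵍ_) pb≡c))

    Congruent : (Fin m → ℤ) → Set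
    Congruent f = Multiple (+ p) (f ^ p R.- ψ f)

    congruent-cong : ∀ {f g} → f ≋ g → Congruent f → Congruent g
    congruent-cong f≋g = multiple-cong (R.+-cong (^-congˡ p f≋g) (R.-‿cong (λ c → f≋g (r ^ᵍ c))))

    congruent-+ : ∀ f g → Congruent f → Congruent g → Congruent (f R.+ g)
    congruent-+ f g f-cong g-cong = multiple-cong
      (solve 5 (λ s x y a b → (s :- (x :+ y)) :+ ((x :- a) :+ (y :- b)) := s :- (a :+ b)) R.refl
        ((f R.+ g) ^ p) (f ^ p) (g ^ p) (ψ f) (ψ g))
      (multiple-+ (frobenius p-prime f g) (multiple-+ f-cong g-cong))

    0^p≈0 : R.0# ^ p R.≈ R.0#
    0^p≈0 = zero-power p p-prime
      where
      zero-power : ∀ q → Prime q → R.0# ^ q R.≈ R.0#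
      zero-power zero    q-prime = contradiction q-prime ¬prime[0]
      zero-power (suc q) _       = R.zeroˡ (R.0# ^ q)

    congruent-0 : Congruent R.0#
    congruent-0 = multiple R.0# (R.trans (R.+-congʳ 0^p≈0) (R.trans (R.-‿inverseʳ R.0#) (R.sym (R.zeroʳ (ι (+ p))))))

    -- Applying `frobenius` to `f` and its negative, whose sum has zero `p`-th power, treats `p = 2`
    -- and odd `p` alike.
    congruent-neg : ∀ f → Congruent f → Congruent (R.- f)
    congruent-neg f f-cong = multiple-cong (begin
      R.- (f ^ p R.- ψ f) R.+ R.- (z R.- (f ^ p R.+ n))
        ≈⟨ solve 4 (λ x a z n → (:- (x :- a)) :+ (:- (z :- (x :+ n))) := n :- (:- a) :- z) R.refl (f ^ p) (ψ f) z n ⟩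
      n R.- (R.- ψ f) R.- z
        ≈⟨ R.+-congˡ {n R.- (R.- ψ f)} (R.-‿cong (R.trans (^-congˡ p (R.-‿inverseʳ f)) 0^p≈0)) ⟩
      n R.- (R.- ψ f) R.- R.0#
        ≈⟨ (λ c → ℤₚ.+-identityʳ ((n R.- (R.- ψ f)) c)) ⟩
      n R.- ψ (R.- f) ∎)
      (multiple-+ (multiple-neg f-cong) (multiple-neg (frobenius p-prime f (R.- f))))
      where
      z = (f R.+ R.- f) ^ p
      n = (R.- f) ^ p

    congruent-δ : ∀ b → Congruent (δ b)
    congruent-δ b = multiple R.0# (begin
      δ b ^ p R.- ψ (δ b)               ≈⟨ R.+-cong (δ-^ b p) (R.-‿cong (ψ-δ b)) ⟩
      δ (p ^ᵍ b) R.- δ (p ^ᵍ b)         ≈⟨ R.-‿inverseʳ (δ (p ^ᵍ b)) ⟩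
      R.0#                              ≈⟨ R.zeroʳ (ι (+ p)) ⟨
      ι (+ p) ⊛ R.0#                    ∎)

    congruent-scaled-δ : ∀ a b → Congruent (λ c → a ℤ.* δ b c)
    congruent-scaled-δ (+ n) b = natural n
      where
      natural : ∀ n → Congruent (λ c → + n ℤ.* δ b c)
      natural zero    = congruent-cong (λ c → ≡.sym (ℤₚ.*-zeroˡ (δ b c))) congruent-0
      natural (suc n) = congruent-cong (λ c → ≡.sym (ℤₚ.suc-* (+ n) (δ b c)))
        (congruent-+ (δ b) (λ c → + n ℤ.* δ b c) (congruent-δ b) (natural n))
    congruent-scaled-δ -[1+ n ] b = congruent-cong (λ c → ℤₚ.neg-distribˡ-* (+ suc n) (δ b c))
      (congruent-neg (λ c → + suc n ℤ.* δ b c) (congruent-scaled-δ (+ suc n) b))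

    congruent-sum : ∀ {n} (t : Fin n → Fin m → ℤ) → (∀ i → Congruent (t i)) → Congruent (sumᴿ t)
    congruent-sum {zero}  t _      = congruent-0
    congruent-sum {suc n} t t-cong = congruent-+ (t zero) (sumᴿ (t ∘ suc)) (t-cong zero) (congruent-sum (t ∘ suc) (t-cong ∘ suc))

    congruent : ∀ f → Congruent f
    congruent f = congruent-cong expansion (congruent-sum (λ b c → f b ℤ.* δ b c) (λ b → congruent-scaled-δ (f b) b))
      where
      expansion : sumᴿ (λ b c → f b ℤ.* δ b c) ≋ f
      expansion c = ≡.trans (sumᴿ-pointwise (λ b c → f b ℤ.* δ b c) c) (≡.trans
        (sum-cong {m} λ b → ≡.trans (ℤₚ.*-comm (f b) (δ b c)) (≡.cong (ℤ._* f b) (ℤDet.e-sym b c)))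
        (sum-δ c f))

    ψ-ι : ∀ a → ψ (ι a) ≋ ι a
    ψ-ι a c = ≡.cong (a ℤ.*_) (≡.trans (ψ-δ ε c) (≡.cong (λ b → δ b c) (^ᵍ-ε p)))

    -- On the eigenvector `fᵖ` acts as `aᵖ`. That `aᵖ` and `a` agree modulo `p` is the Frobenius
    -- congruence for `ι a`, since scalars are fixed by `ψ`.
    killsEigenvectors : ∀ f a w → (f R.- ι a) ⊛ w ≋ R.0# → Multiple (+ p) ((f ^ p R.- f) ⊛ w)
    killsEigenvectors f a w eigen = multiple-cong (begin
      w ⊛ (ι a ^ p R.- ψ (ι a))      ≈⟨ R.*-congˡ {w} (R.+-congˡ {ι a ^ p} (R.-‿cong (ψ-ι a))) ⟩
      w ⊛ (ι a ^ p R.- ι a)          ≈⟨ solve 3 (λ w x a → w :* (x :- a) := x :* w :- a :* w) R.refl w (ι a ^ p) (ι a) ⟩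
      ι a ^ p ⊛ w R.- ι a ⊛ w        ≈⟨ R.+-cong (powers p) (R.-‿cong f⊛w) ⟨
      f ^ p ⊛ w R.- f ⊛ w            ≈⟨ solve 3 (λ x f w → x :* w :- f :* w := (x :- f) :* w) R.refl (f ^ p) f w ⟩
      (f ^ p R.- f) ⊛ w              ∎)
      (multiple-* w (congruent (ι a)))
      where
      f⊛w : f ⊛ w ≋ ι a ⊛ w
      f⊛w = begin
        f ⊛ w                           ≈⟨ solve 3 (λ f a w → f :* w := (f :- a) :* w :+ a :* w) R.refl f (ι a) w ⟩
        (f R.- ι a) ⊛ w R.+ ι a ⊛ w     ≈⟨ R.+-congʳ eigen ⟩
        R.0# R.+ ι a ⊛ w                ≈⟨ R.+-identityˡ (ι a ⊛ w) ⟩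
        ι a ⊛ w                         ∎

      powers : ∀ n → f ^ n ⊛ w ≋ ι a ^ n ⊛ w
      powers zero    = R.refl
      powers (suc n) = begin
        (f ⊛ f ^ n) ⊛ w        ≈⟨ solve 3 (λ f x w → (f :* x) :* w := f :* (x :* w)) R.refl f (f ^ n) w ⟩
        f ⊛ (f ^ n ⊛ w)        ≈⟨ R.*-congˡ {f} (powers n) ⟩
        f ⊛ (ι a ^ n ⊛ w)      ≈⟨ solve 3 (λ f x w → f :* (x :* w) := x :* (f :* w)) R.refl f (ι a ^ n) w ⟩
        ι a ^ n ⊛ (f ⊛ w)      ≈⟨ R.*-congˡ {ι a ^ n} f⊛w ⟩
        ι a ^ n ⊛ (ι a ⊛ w)    ≈⟨ solve 3 (λ a x w → x :* (a :* w) := (a :* x) :* w) R.refl (ι a) (ι a ^ n) w ⟩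
        (ι a ⊛ ι a ^ n) ⊛ w    ∎

  ι-symmetric : ∀ a → Symmetric (ι a)
  ι-symmetric a c = ≡.cong (a ℤ.*_) (δ-≡
    (λ ε≡c⁻¹ → ≡.trans (≡.sym ε⁻¹≈ε) (≡.trans (≡.cong _⁻¹ ε≡c⁻¹) (⁻¹-involutive c)))
    (λ ε≡c → ≡.trans (≡.sym ε⁻¹≈ε) (≡.cong _⁻¹ ε≡c)))

  ⊛-symmetric : ∀ {f g} → Symmetric f → Symmetric g → Symmetric (f ⊛ g)
  ⊛-symmetric {f} {g} f-sym g-sym c = begin
    sumℤ (λ k → f k ℤ.* g ((k ⁻¹) ∙ (c ⁻¹)))
      ≡⟨ sum-reflect ε (λ k → f k ℤ.* g ((k ⁻¹) ∙ (c ⁻¹))) ⟩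
    sumℤ (λ k → f ((k ⁻¹) ∙ ε) ℤ.* g ((((k ⁻¹) ∙ ε) ⁻¹) ∙ (c ⁻¹)))
      ≡⟨ sum-cong {m} (λ k → ≡.cong₂ ℤ._*_
           (≡.trans (≡.cong f (identityʳ (k ⁻¹))) (f-sym k))
           (≡.trans (≡.cong (λ q → g ((q ⁻¹) ∙ (c ⁻¹))) (identityʳ (k ⁻¹)))
             (≡.trans (≡.cong g (⁻¹-∙-comm (k ⁻¹) c)) (g-sym ((k ⁻¹) ∙ c))))) ⟩
    sumℤ (λ k → f k ℤ.* g ((k ⁻¹) ∙ c)) ∎
    where open ≡.≡-Reasoning

  -- The coefficient of x² at ε is the sum of the squares of the coefficients of x.
  symmetric-reduced : ∀ {x} → Symmetric x → x ⊛ x ≋ R.0# → x ≋ R.0#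
  symmetric-reduced {x} x-sym x²≋0 = sum-of-squares-zero x (≡.trans
    (sum-cong {m} λ k → ≡.cong (x k ℤ.*_) (≡.sym (≡.trans (≡.cong x (identityʳ (k ⁻¹))) (x-sym k)))) (x²≋0 ε))

  δε-symmetric : Symmetric (δ ε)
  δε-symmetric c = ≡.trans (≡.sym (ℤₚ.*-identityˡ (δ ε (c ⁻¹)))) (≡.trans (ι-symmetric (+ 1) c) (ℤₚ.*-identityˡ (δ ε c)))

  module _ (f : Fin m → ℤ) {p} (p-prime : Prime p) {r} (r-inverse : ∀ c → r ^ᵍ (p ^ᵍ c) ≡ c)
    {Δ} (Δ≢0 : Δ ≢ + 0) (Δ<p : ∣ Δ ∣ ℕ.< p) {K} (f≤K : ∀ c → ∣ f c ∣ ℕ.≤ K) (2K<p : K ℕ.+ K ℕ.< p) where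
    open ≡.≡-Reasoning
    open AdamsOperation p-prime {r} r-inverse
    open Multiple

    -- Since `p` exceeds `∣ Δ ∣` it cancels `Δ`, so `f ^ p` is congruent to `f` as well as to `ψ f`.
    -- The coefficients of `ψ f - f` are then multiples of `p` of absolute value at most `2K`.
    Adams-fixed : Multiple (+ p) (ι Δ ⊛ (f ^ p R.- f)) → ∀ d → f (r ^ᵍ d) ≡ f d
    Adams-fixed M = equal
      where
      p∣Δ[f^p-f] : ∀ d → p ∣ ∣ Δ ∣ ℕ.* ∣ (f ^ p R.- f) d ∣
      p∣Δ[f^p-f] d = divides ∣ factor M d ∣ (begin
        ∣ Δ ∣ ℕ.* ∣ (f ^ p R.- f) d ∣          ≡⟨ ℤₚ.abs-* Δ ((f ^ p R.- f) d) ⟨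
        ∣ Δ ℤ.* (f ^ p R.- f) d ∣              ≡⟨ ≡.cong ∣_∣ (ι-⊛ Δ (f ^ p R.- f) d) ⟨
        ∣ (ι Δ ⊛ (f ^ p R.- f)) d ∣            ≡⟨ ≡.cong ∣_∣ (equation M d) ⟩
        ∣ (ι (+ p) ⊛ factor M) d ∣             ≡⟨ ≡.cong ∣_∣ (ι-⊛ (+ p) (factor M) d) ⟩
        ∣ + p ℤ.* factor M d ∣                 ≡⟨ ℤₚ.abs-* (+ p) (factor M d) ⟩
        p ℕ.* ∣ factor M d ∣                   ≡⟨ ℕₚ.*-comm p _ ⟩
        ∣ factor M d ∣ ℕ.* p                   ∎)

      p∣f^p-f : ∀ d → + p Signed.∣ (f ^ p R.- f) d
      p∣f^p-f d with euclidsLemma ∣ Δ ∣ ∣ (f ^ p R.- f) d ∣ p-prime (p∣Δ[f^p-f] d)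
      ... | inj₁ p∣Δ = contradiction (∣⇒≤ {{ℕ.≢-nonZero (Δ≢0 ∘ ℤₚ.∣i∣≡0⇒i≡0)}} p∣Δ) (ℕₚ.<⇒≱ Δ<p)
      ... | inj₂ p∣  = Signed.∣ᵤ⇒∣ p∣

      p∣f^p-ψf : ∀ d → + p Signed.∣ (f ^ p R.- ψ f) d
      p∣f^p-ψf d = Signed.divides (factor (congruent f) d)
        (≡.trans (equation (congruent f) d) (≡.trans (ι-⊛ (+ p) (factor (congruent f)) d) (ℤₚ.*-comm (+ p) _)))

      difference : ∀ x y z → (x ℤ.- y) ℤ.- (x ℤ.- z) ≡ z ℤ.- y
      difference = ℤ-Solver.solve-∀

      p∣ψf-f : ∀ d → + p Signed.∣ ψ f d ℤ.- f d
      p∣ψf-f d = ≡.subst (+ p Signed.∣_) (difference ((f ^ p) d) (f d) (ψ f d))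
        (Signed.∣m∣n⇒∣m-n (p∣f^p-f d) (p∣f^p-ψf d))

      equal : ∀ d → f (r ^ᵍ d) ≡ f d
      equal d with ∣ ψ f d ℤ.- f d ∣ ℕ.≟ 0
      ... | yes e = ℤₚ.i-j≡0⇒i≡j (ψ f d) (f d) (ℤₚ.∣i∣≡0⇒i≡0 e)
      ... | no e≢0 = contradiction
        (ℕₚ.≤-trans (∣⇒≤ {{ℕ.≢-nonZero e≢0}} (Signed.∣⇒∣ᵤ (p∣ψf-f d)))
          (ℕₚ.≤-trans (ℤₚ.∣i-j∣≤∣i∣+∣j∣ (ψ f d) (f d)) (ℕₚ.+-mono-≤ (f≤K (r ^ᵍ d)) (f≤K d))))
        (ℕₚ.<⇒≱ 2K<p)

  split⇒powerInvariant : ∀ f → Symmetric f → Split f → ∃ λ L → PowerInvariantAbove L f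
  split⇒powerInvariant f f-sym (as , annihilates) =
    invariant (bounded f) (interpolate as δε-symmetric annihilates)
    where
    open Interpolation f Symmetric
      (λ a x-sym → ⊛-symmetric (λ c → ≡.cong₂ ℤ._-_ (f-sym c) (ι-symmetric a c)) x-sym) symmetric-reduced

    invariant : (∃ λ K → ∀ c → ∣ f c ∣ ℕ.≤ K) →
      (∃ λ Δ → Δ ≢ + 0 × (∀ p g → KillsEigenvectors p g → Multiple p (ι Δ ⊛ (g ⊛ δ ε)))) →
      ∃ λ L → PowerInvariantAbove L f
    -- The bound dominates three numbers: `∣ Δ ∣` to cancel `Δ`, `2K` to turn the congruence into an
    -- equality, and `m` to make `p` coprime to the group order.
    invariant (K , f≤K) (Δ , Δ≢0 , interpolation) = ∣ Δ ∣ ℕ.+ (K ℕ.+ K ℕ.+ m) , λ p p-prime L<p →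
      fixed p-prime
        (ℕₚ.≤-<-trans (ℕₚ.m≤m+n ∣ Δ ∣ _) L<p)
        (ℕₚ.≤-<-trans (ℕₚ.≤-trans (ℕₚ.m≤m+n (K ℕ.+ K) m) (ℕₚ.m≤n+m _ ∣ Δ ∣)) L<p)
        (powerInverse (prime⇒coprime p-prime {{ℕ.≢-nonZero m≢0}}
          (ℕₚ.≤-<-trans (ℕₚ.≤-trans (ℕₚ.m≤n+m m (K ℕ.+ K)) (ℕₚ.m≤n+m _ ∣ Δ ∣)) L<p)))
      where
      fixed : ∀ {p} → Prime p → ∣ Δ ∣ ℕ.< p → K ℕ.+ K ℕ.< p → (∃ λ r → ∀ c → r ^ᵍ (p ^ᵍ c) ≡ c) → ∀ c → f (p ^ᵍ c) ≡ f c
      -- `Adams-fixed` gives invariance under the power `r`; evaluated at `p ^ᵍ c` it becomes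
      -- invariance under `p`.
      fixed {p} p-prime Δ<p 2K<p (r , r-inverse) c = ≡.trans
        (≡.sym (Adams-fixed f p-prime {r} r-inverse Δ≢0 Δ<p f≤K 2K<p
          (multiple-cong (R.*-congˡ {ι Δ} (R.*-identityʳ (f ^ p R.- f)))
            (interpolation (+ p) (f ^ p R.- f) (AdamsOperation.killsEigenvectors p-prime {r} r-inverse f)))
          (p ^ᵍ c)))
        (≡.cong f (r-inverse c))

-- Power-invariant functions are split

least : ∀ {P : ℕ → Set} → Decidable P → ∀ n → P n → ∃ λ k → P k × (∀ j → P j → k ℕ.≤ j)
least {P} P? n Pn = search n 0 (ℕₚ.+-identityʳ n) (λ _ _ → ℕ.z≤n)
  where
  search : ∀ d k → d ℕ.+ k ≡ n → (∀ j → P j → k ℕ.≤ j) → ∃ λ k → P k × (∀ j → P j → k ℕ.≤ j)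
  search zero    k ≡.refl below = n , Pn , below
  search (suc d) k d+k≡n  below with P? k
  ... | yes Pk = k , Pk , below
  ... | no ¬Pk = search d (suc k) (≡.trans (ℕₚ.+-suc d k) d+k≡n)
    λ j Pj → ℕₚ.≤∧≢⇒< (below j Pj) (λ { ≡.refl → ¬Pk Pj })

-- Its prime divisors are exactly the primes up to `l` that do not divide `j`. Multiplying all
-- numbers coprime to `j`, not only primes, keeps the definition a test of coprimality.
coprimeProduct : ℕ → ℕ → ℕ
coprimeProduct j zero    = 1
coprimeProduct j (suc l) with coprime? (suc l) j
... | yes _ = suc l ℕ.* coprimeProduct j l
... | no _  = coprimeProduct j l

∣coprimeProduct : ∀ j L q → 0 ℕ.< q → q ℕ.≤ L → Coprime q j → q ∣ coprimeProduct j L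
∣coprimeProduct j zero    q       0<q q≤L coprime = contradiction q≤L (ℕₚ.<⇒≱ 0<q)
∣coprimeProduct j (suc l) q 0<q q≤L coprime with coprime? (suc l) j | q ℕ.≟ suc l
... | yes _   | yes ≡.refl = m∣m*n (coprimeProduct j l)
... | no ¬c   | yes ≡.refl = ⊥-elim (¬c coprime)
... | yes _   | no q≢      = ∣n⇒∣m*n (suc l) (∣coprimeProduct j l q 0<q (ℕ.s≤s⁻¹ (ℕₚ.≤∧≢⇒< q≤L q≢)) coprime)
... | no _    | no q≢      = ∣coprimeProduct j l q 0<q (ℕ.s≤s⁻¹ (ℕₚ.≤∧≢⇒< q≤L q≢)) coprime

prime∣coprimeProduct : ∀ j L {q} → Prime q → q ∣ j → ¬ (q ∣ coprimeProduct j L)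
prime∣coprimeProduct j zero    q-prime q∣j q∣1 = ¬prime[1] (≡.subst Prime (∣1⇒≡1 q∣1) q-prime)
prime∣coprimeProduct j (suc l) q-prime q∣j q∣ with coprime? (suc l) j
... | no _ = prime∣coprimeProduct j l q-prime q∣j q∣
... | yes coprime with euclidsLemma (suc l) (coprimeProduct j l) q-prime q∣
...   | inj₁ q∣1+l = ¬prime[1] (≡.subst Prime (coprime (q∣1+l , q∣j)) q-prime)
...   | inj₂ q∣t   = prime∣coprimeProduct j l q-prime q∣j q∣t

-- With t = coprimeProduct j L, a prime q ≤ L divides exactly one of j and t o.
roughRepresentative : ∀ {j o} → Coprime j o → ∀ L →
  ∃ λ t → ∀ q → Prime q → q ∣ j ℕ.+ t ℕ.* o → L ℕ.< q
roughRepresentative {j} {o} coprime L = coprimeProduct j L , λ q q-prime q∣ → ℕₚ.≰⇒> (small q q-prime q∣)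
  where
  t = coprimeProduct j L

  small : ∀ q → Prime q → q ∣ j ℕ.+ t ℕ.* o → ¬ (q ℕ.≤ L)
  small q q-prime q∣ q≤L with q ∣? j
  ... | yes q∣j with euclidsLemma t o q-prime (∣m+n∣m⇒∣n q∣ q∣j)
  ...   | inj₁ q∣t = prime∣coprimeProduct j L q-prime q∣j q∣t
  ...   | inj₂ q∣o = ¬prime[1] (≡.subst Prime (coprime (q∣j , q∣o)) q-prime)
  small q q-prime q∣ q≤L | no q∤j = q∤j (∣m+n∣m⇒∣n (≡.subst (q ∣_) (ℕₚ.+-comm j (t ℕ.* o)) q∣) (∣m⇒∣m*n o q∣t))
    where
    q-coprime : Coprime q j
    q-coprime (d∣q , d∣j) = case prime⇒irreducible q-prime d∣q of λ
      { (inj₁ d≡1) → d≡1 ; (inj₂ ≡.refl) → contradiction d∣j q∤j }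

    0<q : 0 ℕ.< q
    0<q = ℕₚ.n≢0⇒n>0 λ { ≡.refl → ¬prime[0] q-prime }

    q∣t : q ∣ t
    q∣t = ∣coprimeProduct j L q 0<q q≤L q-coprime

module Elimination {m : ℕ} (B : FinAbGroup m) where
  open GroupRing B
  open IntegerAlgebra ℤ[B] ι ι-isRingHomomorphism
  open Circulant B
  open ≡.≡-Reasoning

  private instance
    m-nonZero : ℕ.NonZero m
    m-nonZero = ℕ.≢-nonZero m≢0

  Generates : Fin m → Fin m → Set
  Generates b c = ∃ λ j → j ^ᵍ b ≡ c

  generates? : ∀ b c → Dec (Generates b c)
  generates? b c = map′ (λ (j , eq) → toℕ j , eq) reduce (Finₚ.any? λ j → (toℕ j ^ᵍ b) Finₚ.≟ c)
    where
    reduce : Generates b c → ∃ λ (j : Fin m) → toℕ j ^ᵍ b ≡ c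
    reduce (j , eq) = Fin.fromℕ< (m%n<n j m) , (begin
      toℕ (Fin.fromℕ< (m%n<n j m)) ^ᵍ b          ≡⟨ ≡.cong (_^ᵍ b) (Finₚ.toℕ-fromℕ< (m%n<n j m)) ⟩
      (j % m) ^ᵍ b                               ≡⟨ identityʳ _ ⟨
      ((j % m) ^ᵍ b) ∙ ε                         ≡⟨ ≡.cong (((j % m) ^ᵍ b) ∙_) (^ᵍ-multiple (j / m) b) ⟨
      ((j % m) ^ᵍ b) ∙ ((j / m ℕ.* m) ^ᵍ b)      ≡⟨ ×-homo-+ b (j % m) (j / m ℕ.* m) ⟨
      (j % m ℕ.+ j / m ℕ.* m) ^ᵍ b               ≡⟨ ≡.cong (_^ᵍ b) (m≡m%n+[m/n]*n j m) ⟨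
      j ^ᵍ b                                     ≡⟨ eq ⟩
      c                                          ∎)

  generates-self : ∀ b → Generates b b
  generates-self b = 1 , ×-homo-1 b

  generates-∙ : ∀ {b c d} → Generates b c → Generates b d → Generates b (c ∙ d)
  generates-∙ {b} (i , ≡.refl) (j , ≡.refl) = i ℕ.+ j , ×-homo-+ b i j

  generates-^ : ∀ {b c} n → Generates b c → Generates b (n ^ᵍ c)
  generates-^ {b} n (j , ≡.refl) = n ℕ.* j , ≡.sym (×-assocˡ b n j)

  generates-⁻¹ : ∀ {b c} → Generates b c → Generates b (c ⁻¹)
  generates-⁻¹ {b} {c} gen = ≡.subst (Generates b) inverse (generates-^ (ℕ.pred m) gen)
    where
    inverse : ℕ.pred m ^ᵍ c ≡ c ⁻¹
    inverse = GroupProperties.inverseʳ-unique group c (ℕ.pred m ^ᵍ c)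
      (≡.trans (≡.cong (_^ᵍ c) (ℕₚ.suc-pred m)) (^ᵍ-order c))

  indicator : Fin m → Fin m → ℤ
  indicator b c with generates? b c
  ... | yes _ = + 1
  ... | no _  = + 0

  indicator-yes : ∀ {b c} → Generates b c → indicator b c ≡ + 1
  indicator-yes {b} {c} gen with generates? b c
  ... | yes _   = ≡.refl
  ... | no ¬gen = contradiction gen ¬gen

  indicator-no : ∀ {b c} → ¬ Generates b c → indicator b c ≡ + 0
  indicator-no {b} {c} ¬gen with generates? b c
  ... | yes gen = contradiction gen ¬gen
  ... | no _    = ≡.refl

  indicator-≡ : ∀ {b c d} → (Generates b c → Generates b d) → (Generates b d → Generates b c) →
    indicator b c ≡ indicator b d
  indicator-≡ {b} {c} to from with generates? b c
  ... | yes gen = ≡.sym (indicator-yes (to gen))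
  ... | no ¬gen = ≡.sym (indicator-no (¬gen ∘ from))

  indicator-split : ∀ b → Split (indicator b)
  indicator-split b = split-quasi-idempotent size (indicator b) λ c → begin
    sumℤ (λ k → indicator b k ℤ.* indicator b ((k ⁻¹) ∙ c))  ≡⟨ sum-cong {m} (absorb c) ⟩
    sumℤ (λ k → indicator b k ℤ.* indicator b c)             ≡⟨ ∑.*-distribʳ-sum (indicator b c) (indicator b) ⟨
    size ℤ.* indicator b c                                   ≡⟨ ι-⊛ size (indicator b) c ⟨
    (ι size ⊛ indicator b) c                                 ∎
    where
    size = sumℤ (indicator b)

    absorb : ∀ c k → indicator b k ℤ.* indicator b ((k ⁻¹) ∙ c) ≡ indicator b k ℤ.* indicator b c
    absorb c k with generates? b k
    ... | no _    = ≡.trans (ℤₚ.*-zeroˡ (indicator b ((k ⁻¹) ∙ c))) (≡.sym (ℤₚ.*-zeroˡ (indicator b c)))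
    ... | yes gen = ≡.cong (+ 1 ℤ.*_) (indicator-≡
      (λ gen′ → ≡.subst (Generates b) (b∙[b⁻¹∙c] k c) (generates-∙ gen gen′))
      (λ gen′ → generates-∙ (generates-⁻¹ gen) gen′))

  -- A prime above `m` has an inverse exponent, so `c` and `p ^ᵍ c` generate the same subgroup. This
  -- lets `eliminate` subtract indicators without losing invariance.
  indicator-powerInvariant : ∀ b → PowerInvariantAbove m (indicator b)
  indicator-powerInvariant b p p-prime m<p c =
    let r , r-inverse = powerInverse (prime⇒coprime p-prime m<p)
    in indicator-≡ (λ gen → ≡.subst (Generates b) (r-inverse c) (generates-^ r gen)) (generates-^ p)

  order-spec : ∀ b → ∃ λ k → suc k ^ᵍ b ≡ ε × (∀ j → suc j ^ᵍ b ≡ ε → k ℕ.≤ j)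
  order-spec b = least (λ k → (suc k ^ᵍ b) Finₚ.≟ ε) (ℕ.pred m)
    (≡.trans (≡.cong (_^ᵍ b) (ℕₚ.suc-pred m)) (^ᵍ-order b))

  order : Fin m → ℕ
  order b = suc (proj₁ (order-spec b))

  order-ε : ∀ b → order b ^ᵍ b ≡ ε
  order-ε b = proj₁ (proj₂ (order-spec b))

  order-minimal : ∀ b n .{{_ : ℕ.NonZero n}} → n ^ᵍ b ≡ ε → order b ℕ.≤ n
  order-minimal b (suc n) eq = ℕ.s≤s (proj₂ (proj₂ (order-spec b)) n eq)

  order-generates : ∀ {b c} → Generates b c → order c ℕ.≤ order b
  order-generates {b} (j , ≡.refl) = order-minimal _ (order b)
    (≡.trans (^ᵍ-commute (order b) j b) (≡.trans (≡.cong (j ^ᵍ_) (order-ε b)) (^ᵍ-ε j)))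

  -- A common divisor `d` of `j` and the order `o` of `b` makes `o / d` kill `j ^ᵍ b`; as that
  -- element also has order `o`, this forces `d = 1`.
  same-order⇒coprime : ∀ b j → order (j ^ᵍ b) ≡ order b → Coprime j (order b)
  same-order⇒coprime b j same {d} (divides j′ j≡j′d , divides o′ o≡o′d) =
    ℕₚ.≤-antisym (ℕₚ.*-cancelˡ-≤ o′ {{o′-nonZero}} (ℕₚ.≤-trans (ℕₚ.≤-reflexive (≡.sym o≡o′d))
      (ℕₚ.≤-trans (ℕₚ.≤-reflexive (≡.sym same)) (ℕₚ.≤-trans (order-minimal (j ^ᵍ b) o′ {{o′-nonZero}} kills)
        (ℕₚ.≤-reflexive (≡.sym (ℕₚ.*-identityʳ o′))))))) (ℕₚ.n≢0⇒n>0 d≢0)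
    where
    o′≢0 : o′ ≢ 0
    o′≢0 o′≡0 = ℕₚ.1+n≢0 (≡.trans o≡o′d (≡.cong (ℕ._* d) o′≡0))

    o′-nonZero : ℕ.NonZero o′
    o′-nonZero = ℕ.≢-nonZero o′≢0

    d≢0 : d ≢ 0
    d≢0 d≡0 = ℕₚ.1+n≢0 (≡.trans o≡o′d (≡.trans (≡.cong (o′ ℕ.*_) d≡0) (ℕₚ.*-zeroʳ o′)))

    kills : o′ ^ᵍ (j ^ᵍ b) ≡ ε
    kills = begin
      o′ ^ᵍ (j ^ᵍ b)                ≡⟨ ≡.cong (λ k → o′ ^ᵍ (k ^ᵍ b)) j≡j′d ⟩
      o′ ^ᵍ ((j′ ℕ.* d) ^ᵍ b)       ≡⟨ ≡.cong (o′ ^ᵍ_) (×-assocˡ b j′ d) ⟨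
      o′ ^ᵍ (j′ ^ᵍ (d ^ᵍ b))        ≡⟨ ^ᵍ-commute o′ j′ (d ^ᵍ b) ⟩
      j′ ^ᵍ (o′ ^ᵍ (d ^ᵍ b))        ≡⟨ ≡.cong (j′ ^ᵍ_) (×-assocˡ b o′ d) ⟩
      j′ ^ᵍ ((o′ ℕ.* d) ^ᵍ b)       ≡⟨ ≡.cong (λ k → j′ ^ᵍ (k ^ᵍ b)) o≡o′d ⟨
      j′ ^ᵍ (order b ^ᵍ b)          ≡⟨ ≡.cong (j′ ^ᵍ_) (order-ε b) ⟩
      j′ ^ᵍ ε                       ≡⟨ ^ᵍ-ε j′ ⟩
      ε                             ∎

  module _ {L} (2≤L : 2 ℕ.≤ L) (m≤L : m ℕ.≤ L) where

    invariant-product : ∀ {f} → PowerInvariantAbove L f → ∀ ps → All Prime ps → All (L ℕ.<_) ps →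
      ∀ c → f (product ps ^ᵍ c) ≡ f c
    invariant-product {f} inv []       []               []           c = ≡.cong f (×-homo-1 c)
    invariant-product {f} inv (p ∷ ps) (p-prime ∷ primes) (L<p ∷ large) c = begin
      f ((p ℕ.* product ps) ^ᵍ c) ≡⟨ ≡.cong f (×-assocˡ c p (product ps)) ⟨
      f (p ^ᵍ (product ps ^ᵍ c))  ≡⟨ inv p p-prime L<p _ ⟩
      f (product ps ^ᵍ c)         ≡⟨ invariant-product inv ps primes large c ⟩
      f c                              ∎

    -- The exponent `j` matters only modulo the order of `b`, so it may be replaced by a number all
    -- of whose prime factors exceed `L`, and invariance is applied once per prime factor.
    invariant-same-order : ∀ {f} → PowerInvariantAbove L f → ∀ {b c} → Generates b c → order c ≡ order b → f c ≡ f b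
    invariant-same-order {f} inv {b} (j , ≡.refl) same with roughRepresentative (same-order⇒coprime b j same) L
    ... | t , rough = begin
      f (j ^ᵍ b)                              ≡⟨ ≡.cong f (identityʳ _) ⟨
      f ((j ^ᵍ b) ∙ ε)                        ≡⟨ ≡.cong (λ x → f ((j ^ᵍ b) ∙ x)) killed ⟨
      f ((j ^ᵍ b) ∙ ((t ℕ.* order b) ^ᵍ b))   ≡⟨ ≡.cong f (×-homo-+ b j (t ℕ.* order b)) ⟨
      f (n ^ᵍ b)                              ≡⟨ ≡.cong (λ k → f (k ^ᵍ b)) isFactorisation ⟩
      f (product factors ^ᵍ b)           ≡⟨ invariant-product inv factors factorsPrime (large factors factorsPrime (λ p p∣ → ≡.subst (p ∣_) (≡.sym isFactorisation) p∣)) b ⟩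
      f b                                     ∎
      where
      n = j ℕ.+ t ℕ.* order b

      n≢0 : n ≢ 0
      -- Zero is divisible by 2, which roughness would then put above `L`; this is the purpose of
      -- `2 ≤ L`.
      n≢0 n≡0 = ℕₚ.<⇒≱ (rough 2 prime[2] (≡.subst (2 ∣_) (≡.sym n≡0) (2 ∣0))) 2≤L

      open PrimeFactorisation (factorise n {{ℕ.≢-nonZero n≢0}})

      killed : (t ℕ.* order b) ^ᵍ b ≡ ε
      killed = ≡.trans (≡.sym (×-assocˡ b t (order b))) (≡.trans (≡.cong (t ^ᵍ_) (order-ε b)) (^ᵍ-ε t))

      large : ∀ ps → All Prime ps → (∀ p → p ∣ product ps → p ∣ n) → All (L ℕ.<_) ps
      large []       []                _   = []
      large (p ∷ ps) (p-prime ∷ primes) div =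
        rough p p-prime (div p (m∣m*n (product ps))) ∷ large ps primes (λ q q∣ → div q (∣n⇒∣m*n p q∣))

    -- Clears the support of f in decreasing order k; xs lists the elements of order k still to be cleared.
    eliminate : ∀ k (xs : List (Fin m)) f → PowerInvariantAbove L f →
      (∀ c → f c ≡ + 0 ⊎ (order c ℕ.< k ⊎ (order c ≡ k × c ∈ xs))) → Split f
    eliminate zero    [] f inv support = split-cong (λ c → ≡.sym (vanishes c)) split-zero
      where
      vanishes : ∀ c → f c ≡ + 0
      vanishes c with support c
      ... | inj₁ f≡0 = f≡0
      ... | inj₂ (inj₁ ())
      ... | inj₂ (inj₂ ())
    eliminate (suc k) [] f inv support = eliminate k (List.allFin m) f inv support′
      where
      support′ : ∀ c → f c ≡ + 0 ⊎ (order c ℕ.< k ⊎ (order c ≡ k × c ∈ List.allFin m))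
      support′ c with support c
      ... | inj₁ f≡0 = inj₁ f≡0
      ... | inj₂ (inj₁ o<1+k) with ℕₚ.m≤n⇒m<n∨m≡n (ℕ.s≤s⁻¹ o<1+k)
      ...   | inj₁ o<k = inj₂ (inj₁ o<k)
      ...   | inj₂ o≡k = inj₂ (inj₂ (o≡k , ∈-allFin c))
    eliminate k (x ∷ xs) f inv support with order x ℕ.≟ k
    ... | no ox≢k = eliminate k xs f inv support′
      where
      support′ : ∀ c → f c ≡ + 0 ⊎ (order c ℕ.< k ⊎ (order c ≡ k × c ∈ xs))
      support′ c with support c
      ... | inj₁ f≡0 = inj₁ f≡0
      ... | inj₂ (inj₁ o<k) = inj₂ (inj₁ o<k)
      ... | inj₂ (inj₂ (o≡k , here ≡.refl)) = contradiction o≡k ox≢k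
      ... | inj₂ (inj₂ (o≡k , there c∈xs)) = inj₂ (inj₂ (o≡k , c∈xs))
    ... | yes ox≡k = split-cong recombine
      (split-+ g (ι (f x) ⊛ indicator x) (eliminate k xs g g-inv support′) (split-scale (f x) (indicator x) (indicator-split x)))
      where
      -- Elements of the subgroup of `x` with the order of `x` share the value `f x` and are
      -- cleared. Its other elements have smaller order, so any new support there is removed in
      -- later rounds.
      g : Fin m → ℤ
      g c = f c ℤ.- f x ℤ.* indicator x c

      recombine : (λ c → g c ℤ.+ (ι (f x) ⊛ indicator x) c) ≋ f
      recombine c = ≡.trans (≡.cong (λ y → g c ℤ.+ y) (ι-⊛ (f x) (indicator x) c)) (identity (f c) (f x ℤ.* indicator x c))
        where
        identity : ∀ a b → (a ℤ.- b) ℤ.+ b ≡ a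
        identity = ℤ-Solver.solve-∀

      g-inv : PowerInvariantAbove L g
      g-inv p p-prime L<p c = ≡.cong₂ (λ a b → a ℤ.- f x ℤ.* b) (inv p p-prime L<p c)
        (indicator-powerInvariant x p p-prime (ℕₚ.≤-<-trans m≤L L<p) c)

      g-outside : ∀ {c} → ¬ Generates x c → g c ≡ f c
      g-outside {c} ¬gen = ≡.trans (≡.cong (λ y → f c ℤ.- f x ℤ.* y) (indicator-no ¬gen)) (identity (f c) (f x))
        where
        identity : ∀ a b → a ℤ.- b ℤ.* + 0 ≡ a
        identity = ℤ-Solver.solve-∀

      g-inside : ∀ {c} → Generates x c → f c ≡ f x → g c ≡ + 0
      g-inside {c} gen fc≡fx = ≡.trans (≡.cong₂ (λ a y → a ℤ.- f x ℤ.* y) fc≡fx (indicator-yes gen)) (identity (f x))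
        where
        identity : ∀ a → a ℤ.- a ℤ.* + 1 ≡ + 0
        identity = ℤ-Solver.solve-∀

      support′ : ∀ c → g c ≡ + 0 ⊎ (order c ℕ.< k ⊎ (order c ≡ k × c ∈ xs))
      support′ c = case generates? x c of λ
        { (yes gen) → case ℕₚ.m≤n⇒m<n∨m≡n (order-generates gen) of λ
          { (inj₁ oc<ox) → inj₂ (inj₁ (≡.subst (order c ℕ.<_) ox≡k oc<ox))
          ; (inj₂ oc≡ox) → inj₁ (g-inside gen (invariant-same-order inv gen oc≡ox)) }
        ; (no ¬gen) → case support c of λ
          { (inj₁ fc≡0) → inj₁ (≡.trans (g-outside ¬gen) fc≡0)
          ; (inj₂ (inj₁ oc<k)) → inj₂ (inj₁ oc<k)
          ; (inj₂ (inj₂ (oc≡k , here ≡.refl))) → contradiction (generates-self x) ¬gen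
          ; (inj₂ (inj₂ (oc≡k , there c∈xs))) → inj₂ (inj₂ (oc≡k , c∈xs)) } }

  powerInvariant⇒split : ∀ f → (∃ λ L → PowerInvariantAbove L f) → Split f
  powerInvariant⇒split f (L , inv) = eliminate
    (ℕₚ.≤-trans (ℕₚ.m≤m+n 2 m) (ℕₚ.m≤n+m (2 ℕ.+ m) L)) (ℕₚ.≤-trans (ℕₚ.m≤n+m m 2) (ℕₚ.m≤n+m (2 ℕ.+ m) L))
    -- Every order is at most `m`, so at `suc m` with nothing listed the support condition holds for
    -- any function.
    (suc m) [] f
    (λ p p-prime L<p → inv p p-prime (ℕₚ.≤-<-trans (ℕₚ.m≤m+n L (2 ℕ.+ m)) L<p))
    (λ c → inj₂ (inj₁ (ℕ.s≤s (order-minimal c m (^ᵍ-order c)))))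

  integralSpectrum⇒powerInvariant : ∀ f → Symmetric f → IntegralSpectrum (circulant f) → ∃ λ L → PowerInvariantAbove L f
  integralSpectrum⇒powerInvariant f f-sym spectrum = split⇒powerInvariant f f-sym (integralSpectrum⇒split f spectrum)

  powerInvariant⇒integralSpectrum : ∀ f → (∃ λ L → PowerInvariantAbove L f) → IntegralSpectrum (circulant f)
  powerInvariant⇒integralSpectrum f inv = split⇒integralSpectrum f (powerInvariant⇒split f inv)

-- Cayley graphs over generalized dicyclic groups

open import Data.Nat using (_≤_; _+_)

integralSpectrum-cong : ∀ {n} {M N : Matrix n} → (∀ i j → M i j ≡ N i j) → IntegralSpectrum M → IntegralSpectrum N
integralSpectrum-cong M≡N (λs , splits) = λs , λ t → ≡.trans (charPoly-cong (λ i j → ≡.sym (M≡N i j)) t) (splits t)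

true-iff⇒≡ : ∀ {x y} → (x ≡ true → y ≡ true) → (y ≡ true → x ≡ true) → x ≡ y
true-iff⇒≡ {true}  {_}     to from = ≡.sym (to ≡.refl)
true-iff⇒≡ {false} {false} to from = ≡.refl
true-iff⇒≡ {false} {true}  to from = from ≡.refl

module DirectProductWithC₂ {n : ℕ} (A : FinAbGroup n) where
  open FinAbGroup A
  open GroupRing A using (assoc; comm; identityˡ; inverseˡ)

  -- `inj₂` marks the nontrivial coset, as in the dicyclic group. With the same `splitAt` indexing,
  -- the matrices of both groups are compared entry by entry without reordering.
  _⊕_ : Fin n ⊎ Fin n → Fin n ⊎ Fin n → Fin n ⊎ Fin n
  inj₁ a ⊕ inj₁ b = inj₁ (a ∙ b)
  inj₁ a ⊕ inj₂ b = inj₂ (a ∙ b)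
  inj₂ a ⊕ inj₁ b = inj₂ (a ∙ b)
  inj₂ a ⊕ inj₂ b = inj₁ (a ∙ b)

  ⊖_ : Fin n ⊎ Fin n → Fin n ⊎ Fin n
  ⊖ inj₁ a = inj₁ (a ⁻¹)
  ⊖ inj₂ a = inj₂ (a ⁻¹)

  ⊕-assoc : ∀ u v w → (u ⊕ v) ⊕ w ≡ u ⊕ (v ⊕ w)
  ⊕-assoc (inj₁ a) (inj₁ b) (inj₁ c) = ≡.cong inj₁ (assoc a b c)
  ⊕-assoc (inj₁ a) (inj₁ b) (inj₂ c) = ≡.cong inj₂ (assoc a b c)
  ⊕-assoc (inj₁ a) (inj₂ b) (inj₁ c) = ≡.cong inj₂ (assoc a b c)
  ⊕-assoc (inj₁ a) (inj₂ b) (inj₂ c) = ≡.cong inj₁ (assoc a b c)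
  ⊕-assoc (inj₂ a) (inj₁ b) (inj₁ c) = ≡.cong inj₂ (assoc a b c)
  ⊕-assoc (inj₂ a) (inj₁ b) (inj₂ c) = ≡.cong inj₁ (assoc a b c)
  ⊕-assoc (inj₂ a) (inj₂ b) (inj₁ c) = ≡.cong inj₁ (assoc a b c)
  ⊕-assoc (inj₂ a) (inj₂ b) (inj₂ c) = ≡.cong inj₂ (assoc a b c)

  ⊕-comm : ∀ u v → u ⊕ v ≡ v ⊕ u
  ⊕-comm (inj₁ a) (inj₁ b) = ≡.cong inj₁ (comm a b)
  ⊕-comm (inj₁ a) (inj₂ b) = ≡.cong inj₂ (comm a b)
  ⊕-comm (inj₂ a) (inj₁ b) = ≡.cong inj₂ (comm a b)
  ⊕-comm (inj₂ a) (inj₂ b) = ≡.cong inj₁ (comm a b)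

  ⊕-identityˡ : ∀ u → inj₁ ε ⊕ u ≡ u
  ⊕-identityˡ (inj₁ a) = ≡.cong inj₁ (identityˡ a)
  ⊕-identityˡ (inj₂ a) = ≡.cong inj₂ (identityˡ a)

  ⊕-inverseˡ : ∀ u → (⊖ u) ⊕ u ≡ inj₁ ε
  ⊕-inverseˡ (inj₁ a) = ≡.cong inj₁ (inverseˡ a)
  ⊕-inverseˡ (inj₂ a) = ≡.cong inj₁ (inverseˡ a)

  private
    from : Fin (n + n) → Fin n ⊎ Fin n
    from = splitAt n

    to : Fin n ⊎ Fin n → Fin (n + n)
    to = join n n

    from-to : ∀ u → from (to u) ≡ u
    from-to = Finₚ.splitAt-join n n

    to-from : ∀ i → to (from i) ≡ i
    to-from = Finₚ.join-splitAt n n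

    _⋆_ : Fin (n + n) → Fin (n + n) → Fin (n + n)
    i ⋆ j = to (from i ⊕ from j)

    inverse : Fin (n + n) → Fin (n + n)
    inverse i = to (⊖ from i)

    ⋆-comm : ∀ i j → i ⋆ j ≡ j ⋆ i
    ⋆-comm i j = ≡.cong to (⊕-comm (from i) (from j))

    ⋆-identityˡ : ∀ i → to (inj₁ ε) ⋆ i ≡ i
    ⋆-identityˡ i = ≡.trans (≡.cong (λ u → to (u ⊕ from i)) (from-to (inj₁ ε)))
      (≡.trans (≡.cong to (⊕-identityˡ (from i))) (to-from i))

    ⋆-inverseˡ : ∀ i → inverse i ⋆ i ≡ to (inj₁ ε)
    ⋆-inverseˡ i = ≡.cong to (≡.trans (≡.cong (_⊕ from i) (from-to (⊖ from i))) (⊕-inverseˡ (from i)))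

    ⋆-assoc : ∀ i j k → (i ⋆ j) ⋆ k ≡ i ⋆ (j ⋆ k)
    ⋆-assoc i j k = ≡.cong to (≡.trans (≡.cong (_⊕ from k) (from-to (from i ⊕ from j)))
      (≡.trans (⊕-assoc (from i) (from j) (from k)) (≡.cong (from i ⊕_) (≡.sym (from-to (from j ⊕ from k))))))

  A×C₂ : FinAbGroup (n + n)
  A×C₂ = record
    { _∙_ = _⋆_
    ; ε = to (inj₁ ε)
    ; _⁻¹ = inverse
    ; isAbelianGroup = record
      { isGroup = record
        { isMonoid = record
          { isSemigroup = record
            { isMagma = record { isEquivalence = ≡.isEquivalence ; ∙-cong = ≡.cong₂ _⋆_ }
            ; assoc = ⋆-assoc }
          ; identity = ⋆-identityˡ , λ i → ≡.trans (⋆-comm i _) (⋆-identityˡ i) }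
        ; inverse = ⋆-inverseˡ , λ i → ≡.trans (⋆-comm i _) (⋆-inverseˡ i)
        ; ⁻¹-cong = ≡.cong inverse }
      ; comm = ⋆-comm }
    }

  splitAt-difference : ∀ i j → from (inverse i ⋆ j) ≡ (⊖ from i) ⊕ from j
  splitAt-difference i j = ≡.trans (from-to _) (≡.cong (_⊕ from j) (from-to (⊖ from i)))

  splitAt-inverse : ∀ i → from (inverse i) ≡ ⊖ from i
  splitAt-inverse i = from-to (⊖ from i)

  splitAt-identity : from (to (inj₁ ε)) ≡ inj₁ ε
  splitAt-identity = from-to (inj₁ ε)

module CayleyGraph {n : ℕ} (A : FinAbGroup n) (y : Fin n) (y-order2 : HasOrder2 A y) (S₁ S₂ : Subset n)
  (1∉S : Dic.Conn.inS A y S₁ S₂ (Dic.e A y) ≡ false)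
  (S⁻¹ : ∀ g → Dic.Conn.inS A y S₁ S₂ g ≡ true → Dic.Conn.inS A y S₁ S₂ (Dic.inv A y g) ≡ true)
  (S₂⁻¹ : ∀ b → lookup S₂ b ≡ true → lookup S₂ (FinAbGroup._⁻¹ A b) ≡ true)
  (D : Fin (n + n) → Fin (n + n) → ℕ) (D-distance : Dic.Conn.IsDistanceMatrix A y S₁ S₂ D) where
  open Dic A y
  open Conn S₁ S₂
  open DirectProductWithC₂ A

  module A where
    open GroupRing A public

  module B where
    open GroupRing A×C₂ public
    open Circulant A×C₂ public
    open Elimination A×C₂ public

  member : Elt → Bool
  member (inj₁ a) = lookup S₁ a
  member (inj₂ a) = lookup S₂ a

  s : Fin (n + n) → Bool
  s i = member (splitAt n i)

  S₁-symmetric : ∀ a → lookup S₁ (a A.⁻¹) ≡ lookup S₁ a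
  S₁-symmetric a = true-iff⇒≡
    (λ e → ≡.subst (λ b → lookup S₁ b ≡ true) (A.⁻¹-involutive a) (S⁻¹ (inj₁ (a A.⁻¹)) e)) (S⁻¹ (inj₁ a))

  S₂-symmetric : ∀ a → lookup S₂ (a A.⁻¹) ≡ lookup S₂ a
  S₂-symmetric a = true-iff⇒≡
    (λ e → ≡.subst (λ b → lookup S₂ b ≡ true) (A.⁻¹-involutive a) (S₂⁻¹ (a A.⁻¹) e)) (S₂⁻¹ a)

  ∙y∙y : ∀ a → (a A.∙ y) A.∙ y ≡ a
  ∙y∙y a = ≡.trans (A.assoc a y y) (≡.trans (≡.cong (a A.∙_) (proj₂ y-order2)) (A.identityʳ a))

  -- The inverse of `a x` in the dicyclic group is `a y x`, so closure of `S` under inverses is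
  -- invariance of `S₂` under `y`.
  S₂-translate : ∀ a → lookup S₂ ((a A.∙ y) A.⁻¹) ≡ lookup S₂ (a A.⁻¹)
  S₂-translate a = true-iff⇒≡
    (λ e → ≡.subst (λ b → lookup S₂ (b A.⁻¹) ≡ true) (∙y∙y a) (S⁻¹ (inj₂ (a A.∙ y)) e)) (S⁻¹ (inj₂ a))

  [ay]b⁻¹ : ∀ a b → (a A.∙ y) A.∙ (b A.⁻¹) ≡ (a A.∙ (b A.⁻¹)) A.∙ y
  [ay]b⁻¹ a b = ≡.trans (A.assoc a y (b A.⁻¹))
    (≡.trans (≡.cong (a A.∙_) (A.comm y (b A.⁻¹))) (≡.sym (A.assoc a (b A.⁻¹) y)))

  [ab⁻¹]⁻¹ : ∀ a b → (a A.∙ (b A.⁻¹)) A.⁻¹ ≡ (a A.⁻¹) A.∙ b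
  [ab⁻¹]⁻¹ a b = ≡.trans (≡.sym (A.⁻¹-∙-comm a (b A.⁻¹))) (≡.cong ((a A.⁻¹) A.∙_) (A.⁻¹-involutive b))

  -- Although Dic(A,y) is not A × C₂, the two Cayley graphs have the same edges.
  inS≡member : ∀ u v → inS (inv u · v) ≡ member ((⊖ u) ⊕ v)
  inS≡member (inj₁ a) (inj₁ b) = ≡.refl
  inS≡member (inj₁ a) (inj₂ b) = S₂-symmetric ((a A.⁻¹) A.∙ b)
  -- Inverting `a x` introduces a factor `y`. In this mixed case `S₂-translate` absorbs it; in the
  -- next it cancels against the `y` from `x² = y`.
  inS≡member (inj₂ a) (inj₁ b) = ≡.trans (≡.cong (λ c → lookup S₂ (c A.⁻¹)) ([ay]b⁻¹ a b))
    (≡.trans (S₂-translate (a A.∙ (b A.⁻¹))) (≡.cong (lookup S₂) ([ab⁻¹]⁻¹ a b)))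
  inS≡member (inj₂ a) (inj₂ b) = ≡.trans
    (≡.cong (lookup S₁) (≡.trans (≡.cong (A._∙ y) ([ay]b⁻¹ a b)) (∙y∙y (a A.∙ (b A.⁻¹)))))
    (≡.trans (≡.sym (S₁-symmetric (a A.∙ (b A.⁻¹)))) (≡.cong (lookup S₁) ([ab⁻¹]⁻¹ a b)))

  adj≡s : ∀ i j → adj i j ≡ s ((i B.⁻¹) B.∙ j)
  adj≡s i j = ≡.trans (inS≡member (splitAt n i) (splitAt n j)) (≡.cong member (≡.sym (splitAt-difference i j)))

  s-ε : s B.ε ≡ false
  s-ε = ≡.trans (≡.cong member splitAt-identity) 1∉S

  s-symmetric : ∀ c → s (c B.⁻¹) ≡ s c
  s-symmetric c = ≡.trans (≡.cong member (splitAt-inverse c)) (member-symmetric (splitAt n c))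
    where
    member-symmetric : ∀ u → member (⊖ u) ≡ member u
    member-symmetric (inj₁ a) = S₁-symmetric a
    member-symmetric (inj₂ a) = S₂-symmetric a

  -- Distances and symmetries of the graph

  walk-map : (φ : Fin (n + n) → Fin (n + n)) → (∀ i j → adj (φ i) (φ j) ≡ adj i j) →
    ∀ {k i j} → Walk k i j → Walk k (φ i) (φ j)
  walk-map φ φ-adj here         = here
  walk-map φ φ-adj (step e walk) = step (≡.trans (φ-adj _ _) e) (walk-map φ φ-adj walk)

  -- `D` is known only through shortest walks, which gives inequalities. Equalities below come from
  -- using a map together with its inverse.
  D-contracts : (φ : Fin (n + n) → Fin (n + n)) → (∀ i j → adj (φ i) (φ j) ≡ adj i j) →
    ∀ i j → D (φ i) (φ j) ≤ D i j
  D-contracts φ φ-adj i j = proj₂ (D-distance (φ i) (φ j)) _ (walk-map φ φ-adj (proj₁ (D-distance i j)))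

  d : Fin (n + n) → ℕ
  d = D B.ε

  translate-adj : ∀ g i j → adj (g B.∙ i) (g B.∙ j) ≡ adj i j
  translate-adj g i j = ≡.trans (adj≡s (g B.∙ i) (g B.∙ j)) (≡.trans (≡.cong s cancel) (≡.sym (adj≡s i j)))
    where
    open ≡.≡-Reasoning
    cancel : ((g B.∙ i) B.⁻¹) B.∙ (g B.∙ j) ≡ (i B.⁻¹) B.∙ j
    cancel = begin
      ((g B.∙ i) B.⁻¹) B.∙ (g B.∙ j)          ≡⟨ ≡.cong (λ k → (k B.⁻¹) B.∙ (g B.∙ j)) (B.comm g i) ⟩
      ((i B.∙ g) B.⁻¹) B.∙ (g B.∙ j)          ≡⟨ ≡.cong (B._∙ (g B.∙ j)) (B.⁻¹-∙-comm i g) ⟨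
      ((i B.⁻¹) B.∙ (g B.⁻¹)) B.∙ (g B.∙ j)   ≡⟨ B.assoc (i B.⁻¹) (g B.⁻¹) (g B.∙ j) ⟩
      (i B.⁻¹) B.∙ ((g B.⁻¹) B.∙ (g B.∙ j))   ≡⟨ ≡.cong ((i B.⁻¹) B.∙_) (B.b⁻¹∙[b∙c] g j) ⟩
      (i B.⁻¹) B.∙ j                          ∎

  D≡d : ∀ i j → D i j ≡ d ((i B.⁻¹) B.∙ j)
  D≡d i j = ℕₚ.≤-antisym
    (≡.subst₂ (λ a b → D a b ≤ d ((i B.⁻¹) B.∙ j)) (B.identityʳ i) (B.b∙[b⁻¹∙c] i j)
      (D-contracts (i B.∙_) (translate-adj i) B.ε ((i B.⁻¹) B.∙ j)))
    (≡.subst (λ a → D a ((i B.⁻¹) B.∙ j) ≤ D i j) (B.inverseˡ i)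
      (D-contracts ((i B.⁻¹) B.∙_) (translate-adj (i B.⁻¹)) i j))

  d-contracts : (φ : Fin (n + n) → Fin (n + n)) → φ B.ε ≡ B.ε →
    (∀ i j → φ ((i B.⁻¹) B.∙ j) ≡ (φ i B.⁻¹) B.∙ φ j) → (∀ c → s (φ c) ≡ s c) → ∀ c → d (φ c) ≤ d c
  d-contracts φ φε≡ε φ-homo φ-s c = ≡.subst (λ a → D a (φ c) ≤ d c) φε≡ε
    (D-contracts φ (λ i j → ≡.trans (adj≡s (φ i) (φ j))
      (≡.trans (≡.cong s (≡.sym (φ-homo i j))) (≡.trans (φ-s ((i B.⁻¹) B.∙ j)) (≡.sym (adj≡s i j))))) B.ε c)

  -- Inversion is a homomorphism of the abelian group preserving the connection set, hence a graph
  -- automorphism, and it is its own inverse.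
  d-symmetric : ∀ c → d (c B.⁻¹) ≡ d c
  d-symmetric c = ℕₚ.≤-antisym (contracts c)
    (≡.subst (λ a → d a ≤ d (c B.⁻¹)) (B.⁻¹-involutive c) (contracts (c B.⁻¹)))
    where
    contracts = d-contracts B._⁻¹ B.ε⁻¹≈ε (λ i j → ≡.sym (B.⁻¹-∙-comm (i B.⁻¹) j)) s-symmetric

  d-power-contracts : ∀ k → (∀ c → s (k B.^ᵍ c) ≡ s c) → ∀ c → d (k B.^ᵍ c) ≤ d c
  d-power-contracts k = d-contracts (k B.^ᵍ_) (B.^ᵍ-ε k) λ i j →
    ≡.trans (B.×-distrib-+ (i B.⁻¹) j k) (≡.cong (B._∙ (k B.^ᵍ j)) (power-inverse i))
    where
    power-inverse : ∀ i → k B.^ᵍ (i B.⁻¹) ≡ (k B.^ᵍ i) B.⁻¹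
    power-inverse i = GroupProperties.inverseʳ-unique B.group (k B.^ᵍ i) (k B.^ᵍ (i B.⁻¹))
      (≡.trans (≡.sym (B.×-distrib-+ i (i B.⁻¹) k)) (≡.trans (≡.cong (k B.^ᵍ_) (B.inverseʳ i)) (B.^ᵍ-ε k)))

  -- A member of the connection set has distance at most one; distance zero would put the identity
  -- into the set, against `s-ε`.
  s⇔d≡1 : ∀ c → (s c ≡ true → d c ≡ 1) × (d c ≡ 1 → s c ≡ true)
  s⇔d≡1 c = to , from
    where
    edge : adj B.ε c ≡ s c
    edge = ≡.trans (adj≡s B.ε c) (≡.cong s (≡.trans (≡.cong (B._∙ c) B.ε⁻¹≈ε) (B.identityˡ c)))

    trivial-walk : ∀ {k i j} → Walk k i j → k ≡ 0 → i ≡ j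
    trivial-walk here ≡.refl = ≡.refl

    single-step : ∀ {k i j} → Walk k i j → k ≡ 1 → adj i j ≡ true
    single-step (step e here) ≡.refl = e

    to : s c ≡ true → d c ≡ 1
    to sc = ℕₚ.≤-antisym (proj₂ (D-distance B.ε c) 1 (step (≡.trans edge sc) here))
      (ℕₚ.n≢0⇒n>0 λ d≡0 → case ≡.trans (≡.sym sc) (≡.trans (≡.cong s (≡.sym (trivial-walk (proj₁ (D-distance B.ε c)) d≡0))) s-ε) of λ ())

    from : d c ≡ 1 → s c ≡ true
    from d≡1 = ≡.trans (≡.sym edge) (single-step (proj₁ (D-distance B.ε c)) d≡1)

  adjacency distance : Fin (n + n) → ℤ
  adjacency c = if s c then + 1 else + 0
  distance c = + d c

  adjacency-reflects : ∀ {c c′} → adjacency c ≡ adjacency c′ → s c ≡ s c′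
  adjacency-reflects {c} {c′} eq with s c | s c′
  ... | true  | true  = ≡.refl
  ... | false | false = ≡.refl

  distance⇒adjacency : (∃ λ L → B.PowerInvariantAbove L distance) → ∃ λ L → B.PowerInvariantAbove L adjacency
  distance⇒adjacency (L , inv) = L , λ p p-prime L<p c →
    let d≡ = ℤₚ.+-injective (inv p p-prime L<p c)
    in ≡.cong (λ b → if b then + 1 else + 0) (true-iff⇒≡
      (λ sp → proj₂ (s⇔d≡1 c) (≡.trans (≡.sym d≡) (proj₁ (s⇔d≡1 (p B.^ᵍ c)) sp)))
      (λ sc → proj₂ (s⇔d≡1 (p B.^ᵍ c)) (≡.trans d≡ (proj₁ (s⇔d≡1 c) sc))))

  adjacency⇒distance : (∃ λ L → B.PowerInvariantAbove L adjacency) → ∃ λ L → B.PowerInvariantAbove L distance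
  -- The bound is raised by the group order so that `p` has an inverse exponent `r`; both powers
  -- preserve the connection set, and their two contractions give equality of distances.
  adjacency⇒distance (L , inv) = L + (n + n) , λ p p-prime L′<p → invariant p
    (λ c → adjacency-reflects (inv p p-prime (ℕₚ.≤-<-trans (ℕₚ.m≤m+n L (n + n)) L′<p) c))
    (B.powerInverse (prime⇒coprime p-prime {{ℕ.≢-nonZero B.m≢0}} (ℕₚ.≤-<-trans (ℕₚ.m≤n+m (n + n) L) L′<p)))
    where
    invariant : ∀ p → (∀ c → s (p B.^ᵍ c) ≡ s c) → (∃ λ r → ∀ c → r B.^ᵍ (p B.^ᵍ c) ≡ c) →
      ∀ c → distance (p B.^ᵍ c) ≡ distance c
    invariant p s-inv (r , r-inverse) c = ≡.cong +_ (ℕₚ.≤-antisym (d-power-contracts p s-inv c)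
      (≡.subst (λ a → d a ≤ d (p B.^ᵍ c)) (r-inverse c) (d-power-contracts r s-inv′ (p B.^ᵍ c))))
      where
      s-inv′ : ∀ c → s (r B.^ᵍ c) ≡ s c
      s-inv′ c = ≡.trans (≡.sym (s-inv (r B.^ᵍ c))) (≡.cong s (≡.trans (B.^ᵍ-commute p r c) (r-inverse c)))

  Adjacency≡circulant : ∀ i j → Adjacency i j ≡ B.circulant adjacency i j
  Adjacency≡circulant i j = ≡.cong (λ b → if b then + 1 else + 0) (adj≡s i j)

  Distance≡circulant : ∀ i j → DistanceMatrix D i j ≡ B.circulant distance i j
  Distance≡circulant i j = ≡.cong +_ (D≡d i j)

  distanceIntegral⇔integral : IntegralSpectrum (DistanceMatrix D) ⇔ IntegralSpectrum Adjacency
  distanceIntegral⇔integral = mk⇔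
    (λ spectrum → integralSpectrum-cong (λ i j → ≡.sym (Adjacency≡circulant i j))
      (B.powerInvariant⇒integralSpectrum adjacency (distance⇒adjacency
        (B.integralSpectrum⇒powerInvariant distance (λ c → ≡.cong +_ (d-symmetric c))
          (integralSpectrum-cong Distance≡circulant spectrum)))))
    (λ spectrum → integralSpectrum-cong (λ i j → ≡.sym (Distance≡circulant i j))
      (B.powerInvariant⇒integralSpectrum distance (adjacency⇒distance
        (B.integralSpectrum⇒powerInvariant adjacency
          (λ c → ≡.cong (λ b → if b then + 1 else + 0) (s-symmetric c))
          (integralSpectrum-cong Adjacency≡circulant spectrum)))))

theorem6p1 : (n : ℕ) (A : FinAbGroup n) → 2 ∣ n
    → Σ ℕ (λ ex → IsExponent A ex × 3 ≤ ex)
    → (y : Fin n) → HasOrder2 A y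
    → (S₁ S₂ : Subset n)
    → let open FinAbGroup A
          open Dic A y
          open Conn S₁ S₂
      in inS e ≡ false
    → (∀ g → inS g ≡ true → inS (inv g) ≡ true)
    → (∀ g → InGen g)
    → (∀ b → lookup S₂ b ≡ true → lookup S₂ (b ⁻¹) ≡ true)
    → (D : Fin (n + n) → Fin (n + n) → ℕ) → IsDistanceMatrix D
    → IntegralSpectrum (DistanceMatrix D) ⇔ IntegralSpectrum Adjacency
theorem6p1 n A _ _ y y-order2 S₁ S₂ 1∉S S⁻¹ _ S₂⁻¹ D D-distance =
  CayleyGraph.distanceIntegral⇔integral A y y-order2 S₁ S₂ 1∉S S⁻¹ S₂⁻¹ D D-distance
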